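{- Let $n\ge 2$ and let $K_n$ be the complete graph on $n$ vertices. Fix any total ordering of $E(K_n)$ and any field $\Bbbk$. Then $$h_{K_n}(z)=\prod_{j=1}^{n-2}(1+jz),\qquad \mathrm{Hilb}(\Bbbk[\mathrm{BC}(K_n)];z)=\frac{\prod_{j=1}^{n-2}(1+jz)}{(1-z)^{n-1}}.$$ In particular, writing $h_{K_n}(z)=\sum_i h_i z^i$, one has $$h_i=\left[{n-1\atop n-1-i}\right]\qquad(0\le i\le n-2),$$ an unsigned Stirling number of the first kind.
   Context: Empty products equal $1$. The unsigned Stirling number of the first kind $\left[{a\atop b}\right]$ is the number of permutations of $a$ elements with exactly $b$ cycles. For a finite connected loopless graph $G$ with a fixed total order on $E(G)$, a broken circuit is a set $C\setminus\{\max C\}$, where $C$ is the edge set of a cycle of $G$ and $\max C$ is its largest edge. The broken-circuit complex $\mathrm{BC}(G)$ is the simplicial complex on $E(G)$ whose faces are the edge sets containing no broken circuit. Its Stanley--Reisner ring is $\Bbbk[\mathrm{BC}(G)]=\Bbbk[x_e:e\in E(G)]/I_{\mathrm{BC}(G)}$, with $I_{\mathrm{BC}(G)}$ generated by the monomials $\prod_{e\in C\setminus\{\max C\}}x_e$ over all cycles $C$ of $G$; it is graded by $\deg x_e=1$, and $\mathrm{Hilb}$ denotes its Hilbert series. With $r=|V(G)|-1$ and $b_i$ the number of faces of $\mathrm{BC}(G)$ having exactly $i$ elements, the $h$-polynomial of $\mathrm{BC}(G)$ is $h_G(z)=\sum_{i=0}^{r}b_i z^i(1-z)^{r-i}$.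 -}

module Defs where

open import Level using (Level; _⊔_)
open import Algebra.Apartness.Bundles using (HeytingField)
open import Algebra.Bundles.Raw using (RawRing)
open import Algebra.Module.Bundles.Raw using (RawLeftModule)
import Algebra.Definitions.RawMonoid as RawMonoidDefinitions
import Algebra.Definitions.RawSemiring as RawSemiringDefinitions
open import Data.Bool.Base using (true; false; if_then_else_)
open import Data.Fin.Base as Fin using (Fin; toℕ; fromℕ<)
import Data.Fin.Properties as Fin
open import Data.Fin.Subset as Subset using (Subset; _∈_; _⊆_; ⁅_⁆; ⋃; ∣_∣)
open import Data.Fin.Subset.Properties using (_∈?_; _⊆?_; anySubset?)
open import Data.Integer.Base as ℤ using (ℤ; 0ℤ; 1ℤ)
import Data.Integer.Properties as ℤ
open import Data.List.Base as List using (List; []; _∷_; _++_; length; filter; allFin; cartesianProduct; cartesianProductWith; deduplicate)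
open import Data.List.Membership.Propositional using () renaming (_∈_ to _∈ₗ_)
open import Data.List.Membership.Propositional.Properties using (∈-filter⁺; ∈-filter⁻; ∈-cartesianProduct⁺; ∈-allFin; ∈-lookup)
open import Data.List.Relation.Unary.Any as Any using ()
open import Data.List.Relation.Unary.Any.Properties using (lookup-index)
open import Data.Nat.Base as ℕ using (ℕ; zero; suc; pred)
open import Data.Nat.DivMod using (_mod_)
import Data.Nat.Properties as ℕ
open import Data.Product.Base using (∃; Σ; _×_; _,_; proj₁; proj₂)
open import Data.Product.Properties as Product using ()
open import Data.Sum.Base using (_⊎_; inj₁; inj₂)
open import Data.Vec.Base as Vec using (Vec; []; _∷_; lookup)
open import Data.Vec.Functional using (Vector)
import Data.Vec.Properties as Vec
import Data.Bool.Properties as Bool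
open import Function.Definitions using (Injective)
open import Relation.Binary.Construct.Closure.ReflexiveTransitive using (Star; ε; _◅_)
open import Relation.Binary.Core using (Rel)
open import Relation.Binary.Definitions using (tri<; tri≈; tri>)
import Relation.Binary.Definitions as Binary
open import Relation.Binary.PropositionalEquality using (_≡_; _≢_; _≗_; refl; sym; subst)
open import Relation.Binary.Structures using (IsTotalOrder)
open import Relation.Nullary using (¬_; Dec; yes; no; does)
open import Relation.Nullary.Decidable using (map′; _×-dec_; _⊎-dec_; _→-dec_; ¬?)
open import Relation.Unary using (Pred; Decidable)

private
  variable
    a p c ℓ ℓ₁ ℓ₂ : Level
    A : Set a
    k m n : ℕ

allVecs : List A → ∀ n → List (Vec A n)
allVecs xs zero    = [] ∷ []
allVecs xs (suc n) = cartesianProductWith _∷_ xs (allVecs xs n)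

allSubsets : ∀ n → List (Subset n)
allSubsets = allVecs (true ∷ false ∷ [])

count : {P : Pred A p} → Decidable P → List A → ℕ
count P? xs = length (filter P? xs)

entries : Vec (Fin n) k → Subset n
entries xs = ⋃ (Vec.toList (Vec.map ⁅_⁆ xs))

anyVec? : {P : Pred (Vec (Fin n) k) p} → Decidable P → Dec (∃ P)
anyVec? {k = zero}  P? = map′ ([] ,_) (λ { ([] , px) → px }) (P? [])
anyVec? {k = suc k} P? =
  map′ (λ { (x , xs , px) → x ∷ xs , px }) (λ { (x ∷ xs , px) → x , xs , px })
       (Fin.any? λ x → anyVec? λ xs → P? (x ∷ xs))

injective? : (f : Fin k → Fin n) → Dec (Injective _≡_ _≡_ f)
injective? f =
  map′ (λ inj {x} {y} → inj x y) (λ inj x y → inj {x} {y})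
       (Fin.all? λ x → Fin.all? λ y → (f x Fin.≟ f y) →-dec (x Fin.≟ y))

-- Finite connected loopless graphs; parallel edges are allowed.
record Graph : Set where
  field
    ∣V∣ ∣E∣ : ℕ

  Vertex : Set
  Vertex = Fin ∣V∣

  Edge : Set
  Edge = Fin ∣E∣

  field
    ends     : Edge → Vertex × Vertex
    loopless : ∀ e → proj₁ (ends e) ≢ proj₂ (ends e)

  Joins : Edge → Vertex → Vertex → Set
  Joins e u v = ends e ≡ (u , v) ⊎ ends e ≡ (v , u)

  field
    connected : ∀ u v → Star (λ x y → ∃ λ e → Joins e x y) u v

  joins? : ∀ e u v → Dec (Joins e u v)
  joins? e u v = (ends e ≟ (u , v)) ⊎-dec (ends e ≟ (v , u))
    where _≟_ = Product.≡-dec Fin._≟_ Fin._≟_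

  CyclicWalk : Vec Vertex (suc k) → Vec Edge (suc k) → Set
  CyclicWalk {k} vs es =
    ∀ i → Joins (lookup es i) (lookup vs i) (lookup vs (suc (toℕ i) mod suc k))

  IsCycleOfLength1+ : ∀ k → Subset ∣E∣ → Set
  IsCycleOfLength1+ k C = Σ (Vec Vertex (suc k)) λ vs → Σ (Vec Edge (suc k)) λ es →
    Injective _≡_ _≡_ (lookup vs) × Injective _≡_ _≡_ (lookup es) ×
    CyclicWalk vs es × C ≡ entries es

  -- C is the edge set of a cycle, of length k + 1. Length one is impossible as
  -- there are no loops; length two is a pair of parallel edges.
  IsCycle : Subset ∣E∣ → Set
  IsCycle C = ∃ λ k → IsCycleOfLength1+ k C

  isCycle? : Decidable IsCycle
  isCycle? C = map′ to from (Fin.any? {n = ∣E∣} λ k → ofLength? (toℕ k))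
    where
    ofLength? : ∀ k → Dec (IsCycleOfLength1+ k C)
    ofLength? k = anyVec? λ vs → anyVec? λ es →
      injective? (lookup vs) ×-dec injective? (lookup es) ×-dec
      Fin.all? (λ i → joins? _ _ _) ×-dec Vec.≡-dec Bool._≟_ C (entries es)

    to : (∃ λ k → IsCycleOfLength1+ (toℕ k) C) → IsCycle C
    to (k , cyc) = toℕ k , cyc

    from : IsCycle C → ∃ λ k → IsCycleOfLength1+ (toℕ k) C
    from (k , cyc@(_ , _ , _ , es-inj , _)) =
      fromℕ< k< , subst (λ k → IsCycleOfLength1+ k C) (sym (Fin.toℕ-fromℕ< k<)) cyc
      where k< = Fin.injective⇒≤ es-inj

open Graph public using (Edge; ∣V∣; ∣E∣)

module _ (n : ℕ) where

  ordered? : Decidable {A = Fin n × Fin n} (λ (u , v) → u Fin.< v)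
  ordered? (u , v) = u Fin.<? v

  edgesK : List (Fin n × Fin n)
  edgesK = filter ordered? (cartesianProduct (allFin n) (allFin n))

  endsK : Fin (length edgesK) → Fin n × Fin n
  endsK = List.lookup edgesK

  ordered : ∀ e → proj₁ (endsK e) Fin.< proj₂ (endsK e)
  ordered e = proj₂ (∈-filter⁻ ordered? {xs = cartesianProduct (allFin n) (allFin n)}
                               (∈-lookup {xs = edgesK} e))

  edge : ∀ {u v} → u Fin.< v → ∃ λ e → endsK e ≡ (u , v)
  edge {u} {v} u<v = Any.index uv∈ , sym (lookup-index uv∈)
    where
    uv∈ : (u , v) ∈ₗ edgesK
    uv∈ = ∈-filter⁺ ordered? (∈-cartesianProduct⁺ (∈-allFin u) (∈-allFin v)) u<v

  connectedK : ∀ u v →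
    Star (λ x y → ∃ λ e → endsK e ≡ (x , y) ⊎ endsK e ≡ (y , x)) u v
  connectedK u v with Fin.<-cmp u v
  ... | tri< u<v _ _  = let e , eq = edge u<v in (e , inj₁ eq) ◅ ε
  ... | tri≈ _ refl _ = ε
  ... | tri> _ _ v<u  = let e , eq = edge v<u in (e , inj₂ eq) ◅ ε

  K : Graph
  K = record
    { ∣V∣       = n
    ; ∣E∣       = length edgesK
    ; ends      = endsK
    ; loopless  = λ e → Fin.<⇒≢ (ordered e)
    ; connected = connectedK
    }

module _ (G : Graph) {_≤_ : Rel (Edge G) ℓ} (isTotal : IsTotalOrder _≡_ _≤_) where

  open Graph G using (IsCycle; isCycle?)

  IsMax : Subset (∣E∣ G) → Edge G → Set ℓ
  IsMax C e = e ∈ C × (∀ f → f ∈ C → f ≤ e)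

  IsBrokenCircuit : Subset (∣E∣ G) → Set ℓ
  IsBrokenCircuit B = ∃ λ C → ∃ λ e → IsCycle C × IsMax C e × B ≡ C Subset.- e

  IsFace : Subset (∣E∣ G) → Set ℓ
  IsFace F = ¬ (∃ λ B → IsBrokenCircuit B × B ⊆ F)

  _≤?_ : Binary.Decidable _≤_
  e ≤? f with e Fin.≟ f | IsTotalOrder.total isTotal e f
  ... | yes refl | _        = yes (IsTotalOrder.refl isTotal)
  ... | no  _    | inj₁ e≤f = yes e≤f
  ... | no  e≢f  | inj₂ f≤e = no λ e≤f → e≢f (IsTotalOrder.antisym isTotal e≤f f≤e)

  isBrokenCircuit? : Decidable IsBrokenCircuit
  isBrokenCircuit? B = anySubset? λ C → Fin.any? λ e →
    isCycle? C ×-dec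
    ((e ∈? C) ×-dec Fin.all? (λ f → (f ∈? C) →-dec (f ≤? e))) ×-dec
    Vec.≡-dec Bool._≟_ B (C Subset.- e)

  isFace? : Decidable IsFace
  isFace? F = ¬? (anySubset? λ B → isBrokenCircuit? B ×-dec (B ⊆? F))

  faceCount : ℕ → ℕ
  faceCount i = count (λ F → isFace? F ×-dec (∣ F ∣ ℕ.≟ i)) (allSubsets (∣E∣ G))

-- A permutation of Fin n is given by its vector of values; an injective
-- self-map of a finite set is bijective.
IsPermutation : Vec (Fin n) n → Set
IsPermutation π = Injective _≡_ _≡_ (lookup π)

-- The cycle through x consists of x, π x, …, πⁿ⁻¹ x.
cycleThrough : Vec (Fin n) n → Fin n → Subset n
cycleThrough {n} π x = entries (Vec.iterate (lookup π) x n)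

cycleCount : Vec (Fin n) n → ℕ
cycleCount {n} π =
  length (deduplicate (Vec.≡-dec Bool._≟_) (List.map (cycleThrough π) (allFin n)))

stirling₁ : ℕ → ℕ → ℕ
stirling₁ a b =
  count {P = λ π → IsPermutation π × cycleCount π ≡ b}
        (λ π → injective? (lookup π) ×-dec (cycleCount π ℕ.≟ b))
        (allVecs (allFin a) a)

module _ (𝕜 : HeytingField c ℓ₁ ℓ₂) where

  private
    module 𝕜 = HeytingField 𝕜

  Monomial : ℕ → Set
  Monomial m = Vec ℕ m

  degree : Monomial m → ℕ
  degree = Vec.sum

  -- A polynomial in m variables is a formal sum of terms (coefficient and
  -- exponent vector); monomials may repeat, and equality compares total
  -- coefficients.
  Poly : ℕ → Set c
  Poly m = List (𝕜.Carrier × Monomial m)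

  coeff : Poly m → Monomial m → 𝕜.Carrier
  coeff []            μ = 𝕜.0#
  coeff ((a , ν) ∷ p) μ =
    if does (Vec.≡-dec ℕ._≟_ ν μ) then a 𝕜.+ coeff p μ else coeff p μ

  _≈ₚ_ : Rel (Poly m) ℓ₁
  p ≈ₚ q = ∀ μ → coeff p μ 𝕜.≈ coeff q μ

  0ₚ 1ₚ : Poly m
  0ₚ = []
  1ₚ = (𝕜.1# , Vec.replicate _ 0) ∷ []

  _+ₚ_ _*ₚ_ : Poly m → Poly m → Poly m
  _+ₚ_ = _++_
  _*ₚ_ = cartesianProductWith (λ (a , μ) (b , ν) → a 𝕜.* b , Vec.zipWith ℕ._+_ μ ν)

  _·ₚ_ : 𝕜.Carrier → Poly m → Poly m
  a ·ₚ p = List.map (λ (b , μ) → a 𝕜.* b , μ) p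

  -ₚ_ : Poly m → Poly m
  -ₚ p = (𝕜.- 𝕜.1#) ·ₚ p

  squarefree : Subset m → Poly m
  squarefree S = (𝕜.1# , Vec.map (λ s → if s then 1 else 0) S) ∷ []

  data Ideal {m} (Gen : Pred (Poly m) ℓ) : Poly m → Set (c ⊔ ℓ₁ ⊔ ℓ) where
    gen  : ∀ {p} → Gen p → Ideal Gen p
    zero : Ideal Gen 0ₚ
    add  : ∀ {p q} → Ideal Gen p → Ideal Gen q → Ideal Gen (p +ₚ q)
    mul  : ∀ q {p} → Ideal Gen p → Ideal Gen (q *ₚ p)
    resp : ∀ {p q} → p ≈ₚ q → Ideal Gen p → Ideal Gen q

  Quotient : Pred (Poly m) ℓ → RawRing c (c ⊔ ℓ₁ ⊔ ℓ)
  Quotient {m = m} Gen = record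
    { Carrier = Poly m
    ; _≈_     = λ p q → Ideal Gen (p +ₚ (-ₚ q))
    ; _+_     = _+ₚ_
    ; _*_     = _*ₚ_
    ; -_      = -ₚ_
    ; 0#      = 0ₚ
    ; 1#      = 1ₚ
    }

  Homogeneous : ℕ → Pred (Poly m) ℓ₁
  Homogeneous d p = ∀ μ → degree μ ≢ d → coeff p μ 𝕜.≈ 𝕜.0#

  coeff-+ : ∀ (p q : Poly m) μ → coeff (p +ₚ q) μ 𝕜.≈ coeff p μ 𝕜.+ coeff q μ
  coeff-+ []            q μ = 𝕜.sym (𝕜.+-identityˡ _)
  coeff-+ ((a , ν) ∷ p) q μ with does (Vec.≡-dec ℕ._≟_ ν μ)
  ... | true  = 𝕜.trans (𝕜.+-congˡ (coeff-+ p q μ)) (𝕜.sym (𝕜.+-assoc _ _ _))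
  ... | false = coeff-+ p q μ

  coeff-· : ∀ a (p : Poly m) μ → coeff (a ·ₚ p) μ 𝕜.≈ a 𝕜.* coeff p μ
  coeff-· a []            μ = 𝕜.sym (𝕜.zeroʳ a)
  coeff-· a ((b , ν) ∷ p) μ with does (Vec.≡-dec ℕ._≟_ ν μ)
  ... | true  = 𝕜.trans (𝕜.+-congˡ (coeff-· a p μ)) (𝕜.sym (𝕜.distribˡ _ _ _))
  ... | false = coeff-· a p μ

  homogeneous-+ : ∀ {d} {p q : Poly m} →
    Homogeneous d p → Homogeneous d q → Homogeneous d (p +ₚ q)
  homogeneous-+ {p = p} {q} hp hq μ ≢d =
    𝕜.trans (coeff-+ p q μ)
      (𝕜.trans (𝕜.+-cong (hp μ ≢d) (hq μ ≢d)) (𝕜.+-identityˡ _))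

  homogeneous-· : ∀ {d} a {p : Poly m} → Homogeneous d p → Homogeneous d (a ·ₚ p)
  homogeneous-· a {p} hp μ ≢d =
    𝕜.trans (coeff-· a p μ) (𝕜.trans (𝕜.*-congˡ (hp μ ≢d)) (𝕜.zeroʳ a))

  -- The image in the quotient of the homogeneous polynomials of degree d; it is
  -- the degree d part of the quotient when the generators are homogeneous.
  GradedPart : Pred (Poly m) ℓ → ℕ → RawLeftModule 𝕜.Carrier (c ⊔ ℓ₁) (c ⊔ ℓ₁ ⊔ ℓ)
  GradedPart {m = m} Gen d = record
    { Carrierᴹ = ∃ (Homogeneous {m} d)
    ; _≈ᴹ_     = λ (p , _) (q , _) → p ≈ q
    ; _+ᴹ_     = λ (p , hp) (q , hq) → p + q , homogeneous-+ {p = p} {q} hp hq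
    ; _*ₗ_     = λ a (p , hp) → a ·ₚ p , homogeneous-· a {p} hp
    ; 0ᴹ       = 0# , λ _ _ → 𝕜.refl
    ; -ᴹ_      = λ (p , hp) → - p , homogeneous-· _ {p} hp
    }
    where open RawRing (Quotient Gen)

  module _ {e ℓₑ} (M : RawLeftModule 𝕜.Carrier e ℓₑ) where
    open RawLeftModule M
    open RawMonoidDefinitions +ᴹ-rawMonoid using (sum)

    combination : Vector 𝕜.Carrier n → Vector Carrierᴹ n → Carrierᴹ
    combination a v = sum λ i → a i *ₗ v i

    IsBasis : Vector Carrierᴹ n → Set _
    IsBasis {n} v =
      (∀ (a : Vector 𝕜.Carrier n) → combination a v ≈ᴹ 0ᴹ → ∀ i → a i 𝕜.≈ 𝕜.0#) ×
      (∀ x → ∃ λ (a : Vector 𝕜.Carrier n) → x ≈ᴹ combination a v)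

    HasDimension : ℕ → Set _
    HasDimension n = ∃ λ (v : Vector Carrierᴹ n) → IsBasis v

  module _ (G : Graph) {_≤_ : Rel (Edge G) ℓ} (isTotal : IsTotalOrder _≡_ _≤_) where

    -- I_BC(G) is the ideal generated by these monomials.
    BrokenCircuitMonomial : Pred (Poly (∣E∣ G)) (c ⊔ ℓ)
    BrokenCircuitMonomial p = ∃ λ B → IsBrokenCircuit G isTotal B × p ≡ squarefree B

    𝕜[BC] : RawRing c (c ⊔ ℓ₁ ⊔ ℓ)
    𝕜[BC] = Quotient BrokenCircuitMonomial

    𝕜[BC]-part : ℕ → RawLeftModule 𝕜.Carrier (c ⊔ ℓ₁) (c ⊔ ℓ₁ ⊔ ℓ)
    𝕜[BC]-part = GradedPart BrokenCircuitMonomial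

-- ℤ⟦z⟧ as coefficient sequences. Polynomials in z are regarded as elements of
-- ℤ⟦z⟧, where they are equal iff they are equal in ℤ[z].
ℤ⟦z⟧ : RawRing _ _
ℤ⟦z⟧ = record
  { Carrier = ℕ → ℤ
  ; _≈_     = _≗_
  ; _+_     = λ f g d → f d ℤ.+ g d
  ; _*_     = λ f g d → sumℤ {suc d} λ i → f (toℕ i) ℤ.* g (d ℕ.∸ toℕ i)
  ; -_      = λ f d → ℤ.- f d
  ; 0#      = λ _ → 0ℤ
  ; 1#      = λ { zero → 1ℤ ; (suc _) → 0ℤ }
  }
  where open RawMonoidDefinitions ℤ.+-0-rawMonoid renaming (sum to sumℤ)

open RawRing ℤ⟦z⟧ public
  using (_≈_; _+_; _*_; -_; 0#; 1#) renaming (Carrier to Series)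
open RawSemiringDefinitions (RawRing.rawSemiring ℤ⟦z⟧) public
  using (_^_; sum; product)

infixl 6 _-_
_-_ : Series → Series → Series
f - g = f + (- g)

const : ℤ → Series
const a zero    = a
const a (suc _) = 0ℤ

z : Series
z 1 = 1ℤ
z _ = 0ℤ

hPolynomial : (G : Graph) {_≤_ : Rel (Edge G) ℓ} → IsTotalOrder _≡_ _≤_ → Series
hPolynomial G isTotal = sum {suc r} λ i →
  const (ℤ.+ faceCount G isTotal (toℕ i)) * z ^ toℕ i * (1# - z) ^ (r ℕ.∸ toℕ i)
  where r = pred (∣V∣ G)

IsHilbertSeries : (𝕜 : HeytingField c ℓ₁ ℓ₂) {e ℓₑ : Level} →
  (ℕ → RawLeftModule (HeytingField.Carrier 𝕜) e ℓₑ) → Series → Set _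
IsHilbertSeries 𝕜 M H = ∀ d → ∃ λ n → HasDimension 𝕜 (M d) n × H d ≡ ℤ.+ n

{-# OPTIONS --safe #-}

module Submission where

open import Defs hiding (_≈_; _+_; _*_; -_; _-_; 0#; 1#; _^_; sum; product; homogeneous-+)
open import Algebra.Apartness.Bundles using (HeytingField; HeytingCommutativeRing)
open import Algebra.Bundles using (CommutativeRing; Semiring)
open import Data.Bool.Base using (Bool; true; false; not; if_then_else_)
import Data.Bool.Properties as Bool
open import Data.Fin.Base as Fin using (Fin; zero; suc; toℕ; fromℕ; fromℕ<; inject₁; punchIn; punchOut)
import Data.Fin.Properties as Fin
open import Data.Fin.Subset as Subset using (Subset; _⊆_; ⁅_⁆; ∣_∣; inside; outside)
open import Data.Fin.Subset.Properties as Subset using (_∈?_; x∈⁅x⁆; x∈⁅y⁆⇒x≡y;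
  x∈p∪q⁺; x∈p∪q⁻; x∈p∧x≢y⇒x∈p-y; p─q⊆p; ∉⊥)
open import Data.Integer.Base as ℤ using (ℤ; 0ℤ; 1ℤ; -1ℤ; +_)
import Data.Integer.Properties as ℤ
open import Data.Integer.Tactic.RingSolver using (solve-∀)
open import Data.List.Base as List using (List; []; _∷_; _++_; filter; length; allFin;
  concatMap; cartesianProduct; cartesianProductWith; deduplicate)
import Data.List.Properties as List
open import Data.List.Membership.Propositional using (_∈_; _∉_; find; lose)
open import Data.List.Membership.Propositional.Properties
open import Data.List.Membership.Propositional.Properties.WithK using (unique∧set⇒bag)
open import Data.List.Relation.Binary.BagAndSetEquality using (∼bag⇒↭)
open import Data.List.Relation.Binary.Permutation.Propositional as Perm using (_↭_)
open import Data.List.Relation.Unary.All as All using (All; []; _∷_)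
open import Data.List.Relation.Unary.AllPairs using ([]; _∷_)
open import Data.List.Relation.Unary.Any as Any using (here; there; index)
open import Data.List.Relation.Unary.Any.Properties using (lookup-index)
open import Data.List.Relation.Unary.Unique.Propositional using (Unique)
import Data.List.Relation.Unary.Unique.DecPropositional.Properties as DecUnique
import Data.List.Relation.Unary.Unique.Propositional.Properties as Unique
open import Data.Nat.Base as ℕ using (ℕ; zero; suc; z≤n; s≤s; _≤_; _∸_)
open import Data.Nat.DivMod using (_mod_; m%n<n; m<n⇒m%n≡m; n%n≡0)
open import Data.Nat.GeneralisedArithmetic using (iterate)
import Data.Nat.Properties as ℕ
open import Data.Product.Base using (∃; Σ; _×_; _,_; proj₁; proj₂; uncurry)
open import Data.Sum.Base as Sum using (_⊎_; inj₁; inj₂)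
open import Data.Vec.Base as Vec using (Vec; []; _∷_; lookup; tabulate; zipWith; _∷ʳ_; _[_]%=_)
open import Data.Vec.Functional using (Vector)
import Data.Vec.Properties as Vec
open import Function.Base using (_∘_; id)
open import Function.Bundles using (mk⇔)
open import Function.Definitions using (Injective)
open import Level using (Level; 0ℓ)
open import Relation.Binary.Construct.Closure.ReflexiveTransitive as Star using (Star; ε; _◅_; _◅◅_)
open import Relation.Binary.Core using (Rel)
open import Relation.Binary.Definitions using (DecidableEquality; tri<; tri≈; tri>)
open import Relation.Binary.PropositionalEquality using (_≡_; _≢_; refl; sym; trans; cong; cong₂;
  subst; subst₂; module ≡-Reasoning)
open import Relation.Binary.Structures using (IsTotalOrder)
open import Relation.Nullary using (¬_; Dec; yes; no; does; contradiction)
open import Relation.Nullary.Decidable using (¬?; _×-dec_; _→-dec_; decidable-stable)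
open import Relation.Unary using (Pred; Decidable)

-- Whitney's broken circuit theorem, in the following form. For a colouring κ of the
-- vertices with q colours, the faces of BC(G) consisting of monochromatic edges only
-- form a cone, with apex the largest monochromatic edge, because a cycle all of whose
-- edges but one are monochromatic is monochromatic. Hence the sum of (-1)^|F| over
-- these faces is 0 unless κ is proper. Summed over κ, and since a face F is a forest,
-- with q^(|V| - |F|) colourings constant on its components, the number of proper
-- colourings is ∑ (-1)^|F| q^(|V| - |F|). For K_n it is also q(q - 1)…(q - n + 1), and
-- comparing coefficients makes the number of faces of size i the i-th elementary
-- symmetric polynomial of 1, …, n - 1, whatever the order of the edges.
--
-- The h-polynomial is then the product of the (1 - z) + j z over 1 ≤ j ≤ n - 1.
-- Its coefficients satisfy the recurrence of the Stirling numbers, which is that of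
-- inserting a point into the cycles of a permutation. The monomials supported on
-- faces are a basis of 𝕜[BC], so its Hilbert series is the sum of the
-- (z / (1 - z))^|F| over all faces.

-- Deletion and contraction would lead out of the family of complete graphs. Summing over colourings
-- keeps the graph fixed, and for one colouring the order of the edges enters only through the
-- largest monochromatic edge.
--
-- One piece of algebra serves twice. Put r = n - 1 and let H(x, y) be the sum of e_i x^i y^(r-i),
-- where e_i is the i-th elementary symmetric polynomial of 1, ..., r. It is the product of the
-- factors y + j x. At x = -1, y = q it is the number of proper colourings divided by q; at x = z, y
-- = 1 - z it is the h-polynomial. In the second case the factor for j is 1 + (j - 1) z, so j = 1
-- contributes nothing and the others run through 1 + z, ..., 1 + (n - 2) z. This is why the face
-- numbers belong to 1, ..., n - 1 and the h-numbers to 1, ..., n - 2. Sums and homogeneous forms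
-- are therefore set up over any commutative ring, to be used in ℤ and in ℤ⟦z⟧.
--
-- Identities in q are tested at positive integers, and Hilbert series are compared after
-- multiplication by (1 - z)^r, so that the computation stays inside these two rings.

private
  variable
    α β γ ρ ς ℓ ℓ₁ ℓ₂ : Level
    A : Set α
    B : Set β
    D : Set γ
    P : Set ρ
    Q : Set ς
    k m n q : ℕ

-- Finite sums over lists in a commutative ring

-- Injectivity is asked for on members of `xs` only, because the maps fed to `∑-bijection` are
-- inverse to each other only on the lists that are summed over.
Unique-map⁺ : {f : A → B} {xs : List A} →
  (∀ {x y} → x ∈ xs → y ∈ xs → f x ≡ f y → x ≡ y) → Unique xs → Unique (List.map f xs)
Unique-map⁺ inj []         = []
Unique-map⁺ {f = f} {xs = x ∷ xs} inj (x∉ ∷ uniq) =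
  All.tabulate (λ y∈ fx≡y → let z , z∈ , y≡fz = ∈-map⁻ f y∈ in
    All.lookup x∉ z∈ (inj (here refl) (there z∈) (trans fx≡y y≡fz)))
  ∷ Unique-map⁺ (λ x∈ y∈ → inj (there x∈) (there y∈)) uniq

module ListSum {c ℓ} (R : CommutativeRing c ℓ) where

  open CommutativeRing R renaming (refl to ≈-refl; sym to ≈-sym; trans to ≈-trans)
  open import Algebra.Properties.Ring ring using (-‿+-comm; -0#≈0#)
  open import Algebra.Properties.CommutativeSemigroup +-commutativeSemigroup using (interchange)
  open import Relation.Binary.Reasoning.Setoid setoid

  ∑ : List A → (A → Carrier) → Carrier
  ∑ []       f = 0#
  ∑ (x ∷ xs) f = f x + ∑ xs f

  ind : Dec P → Carrier
  ind d = if does d then 1# else 0#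

  ind-yes : (d : Dec P) → P → ind d ≈ 1#
  ind-yes (yes _) _ = ≈-refl
  ind-yes (no ¬p) p = contradiction p ¬p

  ind-no : (d : Dec P) → ¬ P → ind d ≈ 0#
  ind-no (yes p) ¬p = contradiction p ¬p
  ind-no (no _)  _  = ≈-refl

  ind-cong : (P? : Dec P) (Q? : Dec Q) → (P → Q) → (Q → P) → ind P? ≈ ind Q?
  ind-cong (yes p) Q? to from = ≈-sym (ind-yes Q? (to p))
  ind-cong (no ¬p) Q? to from = ≈-sym (ind-no Q? (¬p ∘ from))

  ind-× : (P? : Dec P) (Q? : Dec Q) → ind (P? ×-dec Q?) ≈ ind P? * ind Q?
  ind-× (yes _) (yes _) = ≈-sym (*-identityˡ _)
  ind-× (yes _) (no _)  = ≈-sym (*-identityˡ _)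
  ind-× (no _)  _       = ≈-sym (zeroˡ _)

  ind-*-cong : {x y : Carrier} (P? : Dec P) → (P → x ≈ y) → ind P? * x ≈ ind P? * y
  ind-*-cong (yes p) eq = *-congˡ (eq p)
  ind-*-cong (no _)  _  = ≈-trans (zeroˡ _) (≈-sym (zeroˡ _))

  module _ {A : Set α} where

    ∑-cong : (xs : List A) {f g : A → Carrier} → (∀ {x} → x ∈ xs → f x ≈ g x) → ∑ xs f ≈ ∑ xs g
    ∑-cong []       eq = ≈-refl
    ∑-cong (x ∷ xs) eq = +-cong (eq (here refl)) (∑-cong xs (eq ∘ there))

    ∑-0 : (xs : List A) → ∑ xs (λ _ → 0#) ≈ 0#
    ∑-0 []       = ≈-refl
    ∑-0 (x ∷ xs) = ≈-trans (+-identityˡ _) (∑-0 xs)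

    ∑-+ : (xs : List A) (f g : A → Carrier) → ∑ xs (λ x → f x + g x) ≈ ∑ xs f + ∑ xs g
    ∑-+ []       f g = ≈-sym (+-identityˡ 0#)
    ∑-+ (x ∷ xs) f g = ≈-trans (+-congˡ (∑-+ xs f g)) (interchange _ _ _ _)

    ∑-*ˡ : (xs : List A) (r : Carrier) (f : A → Carrier) → ∑ xs (λ x → r * f x) ≈ r * ∑ xs f
    ∑-*ˡ []       r f = ≈-sym (zeroʳ r)
    ∑-*ˡ (x ∷ xs) r f = ≈-trans (+-congˡ (∑-*ˡ xs r f)) (≈-sym (distribˡ r _ _))

    ∑-*ʳ : (xs : List A) (r : Carrier) (f : A → Carrier) → ∑ xs (λ x → f x * r) ≈ ∑ xs f * r
    ∑-*ʳ xs r f = ≈-trans (∑-cong xs (λ _ → *-comm _ _)) (≈-trans (∑-*ˡ xs r f) (*-comm _ _))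

    ∑-neg : (xs : List A) (f : A → Carrier) → ∑ xs (λ x → - f x) ≈ - ∑ xs f
    ∑-neg []       f = ≈-sym -0#≈0#
    ∑-neg (x ∷ xs) f = ≈-trans (+-congˡ (∑-neg xs f)) (-‿+-comm _ _)

    ∑-++ : (xs ys : List A) (f : A → Carrier) → ∑ (xs ++ ys) f ≈ ∑ xs f + ∑ ys f
    ∑-++ []       ys f = ≈-sym (+-identityˡ _)
    ∑-++ (x ∷ xs) ys f = ≈-trans (+-congˡ (∑-++ xs ys f)) (≈-sym (+-assoc _ _ _))

    ∑-filter : {P : Pred A ρ} (P? : Decidable P) (xs : List A) (f : A → Carrier) →
      ∑ (filter P? xs) f ≈ ∑ xs (λ x → ind (P? x) * f x)
    ∑-filter P? []       f = ≈-refl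
    ∑-filter P? (x ∷ xs) f with P? x
    ... | yes _ = +-cong (≈-sym (*-identityˡ _)) (∑-filter P? xs f)
    ... | no _  = ≈-trans (∑-filter P? xs f) (≈-trans (≈-sym (+-identityˡ _)) (+-congʳ (≈-sym (zeroˡ _))))

    ∑-↭ : {xs ys : List A} (f : A → Carrier) → xs ↭ ys → ∑ xs f ≈ ∑ ys f
    ∑-↭ f Perm.refl          = ≈-refl
    ∑-↭ f (Perm.prep x p)    = +-congˡ (∑-↭ f p)
    ∑-↭ f (Perm.swap x y p)  = begin
      f x + (f y + _) ≈⟨ +-assoc _ _ _ ⟨
      f x + f y + _   ≈⟨ +-cong (+-comm _ _) (∑-↭ f p) ⟩
      f y + f x + _   ≈⟨ +-assoc _ _ _ ⟩
      f y + (f x + _) ∎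
    ∑-↭ f (Perm.trans p p′)  = ≈-trans (∑-↭ f p) (∑-↭ f p′)

    ∑-δ : (_≟_ : DecidableEquality A) {xs : List A} {x : A} (f : A → Carrier) →
      Unique xs → x ∈ xs → ∑ xs (λ y → ind (x ≟ y) * f y) ≈ f x
    ∑-δ _≟_ {x ∷ xs} f (x∉ ∷ _) (here refl) = begin
      ind (x ≟ x) * f x + ∑ xs (λ y → ind (x ≟ y) * f y)
        ≈⟨ +-cong (≈-trans (*-congʳ (ind-yes (x ≟ x) refl)) (*-identityˡ _))
                  (∑-cong xs λ y∈ → ≈-trans (*-congʳ (ind-no (x ≟ _) (All.lookup x∉ y∈))) (zeroˡ _)) ⟩
      f x + ∑ xs (λ _ → 0#) ≈⟨ +-congˡ (∑-0 xs) ⟩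
      f x + 0#              ≈⟨ +-identityʳ _ ⟩
      f x ∎
    ∑-δ _≟_ {y ∷ xs} {x} f (y∉ ∷ uniq) (there x∈) = begin
      ind (x ≟ y) * f y + _
        ≈⟨ +-cong (≈-trans (*-congʳ (ind-no (x ≟ y) λ x≡y → All.lookup y∉ x∈ (sym x≡y))) (zeroˡ _))
                  (∑-δ _≟_ f uniq x∈) ⟩
      0# + f x ≈⟨ +-identityˡ _ ⟩
      f x ∎

  ∑-swap : (xs : List A) (ys : List B) (f : A → B → Carrier) →
    ∑ xs (λ x → ∑ ys (f x)) ≈ ∑ ys (λ y → ∑ xs (λ x → f x y))
  ∑-swap []       ys f = ≈-sym (∑-0 ys)
  ∑-swap (x ∷ xs) ys f = ≈-trans (+-congˡ (∑-swap xs ys f)) (≈-sym (∑-+ ys _ _))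

  ∑-map : (g : A → B) (xs : List A) (f : B → Carrier) → ∑ (List.map g xs) f ≈ ∑ xs (f ∘ g)
  ∑-map g []       f = ≈-refl
  ∑-map g (x ∷ xs) f = +-congˡ (∑-map g xs f)

  ∑-cartesianProductWith : (g : A → B → D) (xs : List A) (ys : List B) (f : D → Carrier) →
    ∑ (cartesianProductWith g xs ys) f ≈ ∑ xs (λ x → ∑ ys (λ y → f (g x y)))
  ∑-cartesianProductWith g []       ys f = ≈-refl
  ∑-cartesianProductWith g (x ∷ xs) ys f =
    ≈-trans (∑-++ (List.map (g x) ys) _ f) (+-cong (∑-map (g x) ys f) (∑-cartesianProductWith g xs ys f))

  -- The image of `xs` under `to` and the list `ys` are both free of duplicates and have the same
  -- members, hence are permutations of each other.
  ∑-bijection : {xs : List A} {ys : List B} (to : A → B) (from : B → A) (f : B → Carrier) →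
    Unique xs → Unique ys →
    (∀ {x} → x ∈ xs → to x ∈ ys × from (to x) ≡ x) →
    (∀ {y} → y ∈ ys → from y ∈ xs × to (from y) ≡ y) →
    ∑ xs (f ∘ to) ≈ ∑ ys f
  ∑-bijection {xs = xs} {ys = ys} to from f uxs uys t s =
    ≈-trans (≈-sym (∑-map to xs f)) (∑-↭ f (∼bag⇒↭ (unique∧set⇒bag
      (Unique-map⁺ (λ x∈ y∈ eq →
        trans (sym (proj₂ (t x∈))) (trans (cong from eq) (proj₂ (t y∈)))) uxs)
      uys
      (mk⇔ (λ y∈ → let x , x∈ , y≡ = ∈-map⁻ to y∈ in subst (_∈ ys) (sym y≡) (proj₁ (t x∈)))
           (λ y∈ → subst (_∈ List.map to xs) (proj₂ (s y∈)) (∈-map⁺ to (proj₁ (s y∈))))))))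

-- Homogeneous forms in two ring elements

-- The elementary symmetric polynomial of degree i in 1, …, r.
elementary : ℕ → ℕ → ℕ
elementary r       zero    = 1
elementary zero    (suc i) = 0
elementary (suc r) (suc i) = elementary r (suc i) ℕ.+ suc r ℕ.* elementary r i

elementary-vanishes : ∀ r i → r ℕ.< i → elementary r i ≡ 0
elementary-vanishes zero    (suc i) _         = refl
elementary-vanishes (suc r) (suc i) (s≤s r<i)
  rewrite elementary-vanishes r (suc i) (ℕ.m<n⇒m<1+n r<i) | elementary-vanishes r i r<i = ℕ.*-zeroʳ (suc r)

module Homogeneous {c ℓ} (R : CommutativeRing c ℓ) where

  open CommutativeRing R renaming (refl to ≈-refl; sym to ≈-sym; trans to ≈-trans)
  open ListSum R
  open import Algebra.Definitions.RawSemiring (Semiring.rawSemiring semiring) public using (_^_; sum)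
  open import Algebra.Properties.CommutativeMonoid.Sum +-commutativeMonoid using (sum-cong-≋; sum-init-last)
  open import Algebra.Properties.Semiring.Sum semiring using (*-distribˡ-sum)
  open import Algebra.Properties.CommutativeSemigroup *-commutativeSemigroup using (x∙yz≈y∙xz; xy∙z≈xz∙y)
  open import Algebra.Properties.CommutativeSemigroup +-commutativeSemigroup using (interchange)
  open import Relation.Binary.Reasoning.Setoid setoid

  module _ (x y : Carrier) where

    -- ∑ᵢ aᵢ xⁱ yʳ⁻ⁱ, for 0 ≤ i ≤ r
    homogeneous : (ℕ → Carrier) → ℕ → Carrier
    homogeneous a zero    = a 0
    homogeneous a (suc r) = y * homogeneous a r + a (suc r) * x ^ suc r

    homogeneous-cong : {a b : ℕ → Carrier} → ∀ r → (∀ i → i ℕ.≤ r → a i ≈ b i) → homogeneous a r ≈ homogeneous b r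
    homogeneous-cong zero    eq = eq 0 z≤n
    homogeneous-cong (suc r) eq =
      +-cong (*-congˡ (homogeneous-cong r (λ i i≤r → eq i (ℕ.m≤n⇒m≤1+n i≤r)))) (*-congʳ (eq (suc r) ℕ.≤-refl))

    -- Passing from `r` to `suc r` gives every old term one more factor `y`, and the new last term
    -- has `y` to the power 0. The left-hand side is the shape in which `hPolynomial` is defined.
    sum≈homogeneous : (a : ℕ → Carrier) → ∀ r →
      sum {suc r} (λ i → a (toℕ i) * x ^ toℕ i * y ^ (r ℕ.∸ toℕ i)) ≈ homogeneous a r
    sum≈homogeneous a zero    = ≈-trans (+-identityʳ _) (≈-trans (*-identityʳ _) (*-identityʳ _))
    sum≈homogeneous a (suc r) = begin
      sum {suc (suc r)} (term (suc r) ∘ toℕ) ≈⟨ sum-init-last (term (suc r) ∘ toℕ) ⟩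
      sum {suc r} (λ i → term (suc r) (toℕ (inject₁ i))) + term (suc r) (toℕ (fromℕ (suc r)))
        ≈⟨ +-cong (≈-trans (sum-cong-≋ init) (≈-sym (*-distribˡ-sum {suc r} y (term r ∘ toℕ))))
                  (reflexive (cong (term (suc r)) (Fin.toℕ-fromℕ (suc r)))) ⟩
      y * sum {suc r} (term r ∘ toℕ) + term (suc r) (suc r)
        ≈⟨ +-cong (*-congˡ (sum≈homogeneous a r)) last ⟩
      y * homogeneous a r + a (suc r) * x ^ suc r ∎
      where
      term : ℕ → ℕ → Carrier
      term r i = a i * x ^ i * y ^ (r ℕ.∸ i)

      init : (i : Fin (suc r)) → term (suc r) (toℕ (inject₁ i)) ≈ y * term r (toℕ i)
      init i = begin
        term (suc r) (toℕ (inject₁ i))                  ≡⟨ cong (term (suc r)) (Fin.toℕ-inject₁ i) ⟩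
        a (toℕ i) * x ^ toℕ i * y ^ (suc r ℕ.∸ toℕ i)
          ≡⟨ cong (λ t → a (toℕ i) * x ^ toℕ i * y ^ t) (ℕ.+-∸-assoc 1 (Fin.toℕ≤pred[n] i)) ⟩
        a (toℕ i) * x ^ toℕ i * (y * y ^ (r ℕ.∸ toℕ i)) ≈⟨ x∙yz≈y∙xz _ _ _ ⟩
        y * term r (toℕ i) ∎

      last : term (suc r) (suc r) ≈ a (suc r) * x ^ suc r
      last = ≈-trans (*-congˡ (reflexive (cong (y ^_) (ℕ.n∸n≡0 r)))) (*-identityʳ _)

    homogeneous-0 : ∀ r → homogeneous (λ _ → 0#) r ≈ 0#
    homogeneous-0 zero    = ≈-refl
    homogeneous-0 (suc r) = ≈-trans (+-cong (≈-trans (*-congˡ (homogeneous-0 r)) (zeroʳ y)) (zeroˡ _)) (+-identityˡ 0#)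

    homogeneous-+ : (a b : ℕ → Carrier) → ∀ r → homogeneous (λ i → a i + b i) r ≈ homogeneous a r + homogeneous b r
    homogeneous-+ a b zero    = ≈-refl
    homogeneous-+ a b (suc r) = begin
      y * homogeneous (λ i → a i + b i) r + (a (suc r) + b (suc r)) * x ^ suc r
        ≈⟨ +-cong (≈-trans (*-congˡ (homogeneous-+ a b r)) (distribˡ _ _ _)) (distribʳ _ _ _) ⟩
      (y * homogeneous a r + y * homogeneous b r) + (a (suc r) * x ^ suc r + b (suc r) * x ^ suc r)
        ≈⟨ interchange _ _ _ _ ⟩
      homogeneous a (suc r) + homogeneous b (suc r) ∎

    homogeneous-∑ : (xs : List A) (f : A → ℕ → Carrier) → ∀ r →
      homogeneous (λ i → ∑ xs (λ u → f u i)) r ≈ ∑ xs (λ u → homogeneous (f u) r)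
    homogeneous-∑ []       f r = homogeneous-0 r
    homogeneous-∑ (u ∷ us) f r = ≈-trans (homogeneous-+ (f u) _ r) (+-congˡ (homogeneous-∑ us f r))

    -- An indicator sequence selects a single monomial. The bound `k ≤ r` keeps the selected index
    -- in range and makes `r ∸ k` a genuine difference.
    homogeneous-δ : ∀ k r → k ℕ.≤ r → homogeneous (λ i → ind (k ℕ.≟ i)) r ≈ x ^ k * y ^ (r ℕ.∸ k)
    homogeneous-δ zero zero _ = ≈-sym (*-identityʳ _)
    homogeneous-δ k (suc r) k≤ with ℕ.m≤n⇒m<n∨m≡n k≤
    ... | inj₁ (s≤s k≤r) = begin
      y * homogeneous (λ i → ind (k ℕ.≟ i)) r + ind (k ℕ.≟ suc r) * x ^ suc r
        ≈⟨ +-cong (*-congˡ (homogeneous-δ k r k≤r))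
                  (≈-trans (*-congʳ (ind-no (k ℕ.≟ suc r) (ℕ.<⇒≢ (s≤s k≤r)))) (zeroˡ _)) ⟩
      y * (x ^ k * y ^ (r ℕ.∸ k)) + 0# ≈⟨ +-identityʳ _ ⟩
      y * (x ^ k * y ^ (r ℕ.∸ k))      ≈⟨ x∙yz≈y∙xz _ _ _ ⟩
      x ^ k * y ^ suc (r ℕ.∸ k)        ≡⟨ cong (λ t → x ^ k * y ^ t) (ℕ.+-∸-assoc 1 k≤r) ⟨
      x ^ k * y ^ (suc r ℕ.∸ k)        ∎
    ... | inj₂ refl = begin
      y * homogeneous (λ i → ind (k ℕ.≟ i)) r + ind (k ℕ.≟ k) * x ^ k
        ≈⟨ +-cong (≈-trans (*-congˡ (≈-trans (homogeneous-cong r λ i i≤r → ind-no (k ℕ.≟ i) (ℕ.<⇒≢ (s≤s i≤r) ∘ sym))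
                                             (homogeneous-0 r))) (zeroʳ y))
                  (≈-trans (*-congʳ (ind-yes (k ℕ.≟ k) refl)) (*-identityˡ _)) ⟩
      0# + x ^ k            ≈⟨ +-identityˡ _ ⟩
      x ^ k                 ≈⟨ *-identityʳ _ ⟨
      x ^ k * 1#            ≡⟨ cong (λ t → x ^ k * y ^ t) (ℕ.n∸n≡0 k) ⟨
      x ^ k * y ^ (k ℕ.∸ k) ∎

    -- Trades a count by size for a sum over the objects. It is applied to the faces twice: at -1
    -- and q, where the sum is Whitney's, and at z and 1 - z, where it is the Hilbert series with
    -- its denominator cleared.
    homogeneous-count : (xs : List A) (size : A → ℕ) → ∀ r → (∀ {u} → u ∈ xs → size u ℕ.≤ r) →
      homogeneous (λ i → ∑ xs (λ u → ind (size u ℕ.≟ i))) r ≈ ∑ xs (λ u → x ^ size u * y ^ (r ℕ.∸ size u))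
    homogeneous-count xs size r size≤r =
      ≈-trans (homogeneous-∑ xs _ r) (∑-cong xs λ u∈ → homogeneous-δ _ r (size≤r u∈))

    module _ {a b : ℕ → Carrier} {c : Carrier} (b₀ : b 0 ≈ a 0) (b₊ : ∀ i → b (suc i) ≈ a (suc i) + c * a i) where

      -- The hypotheses say that the generating polynomial of `b` is 1 + c t times that of `a`. In
      -- the homogeneous form the shift of the index by one costs a factor `x`.
      homogeneous-linear-factor : ∀ s → homogeneous b (suc s) ≈ homogeneous a (suc s) + c * x * homogeneous a s
      homogeneous-linear-factor zero = begin
        y * b 0 + b 1 * x ^ 1                     ≈⟨ +-cong (*-congˡ b₀) (≈-trans (*-congʳ (b₊ 0)) (distribʳ _ _ _)) ⟩
        y * a 0 + (a 1 * x ^ 1 + c * a 0 * x ^ 1) ≈⟨ +-assoc _ _ _ ⟨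
        y * a 0 + a 1 * x ^ 1 + c * a 0 * x ^ 1
          ≈⟨ +-congˡ (≈-trans (*-congˡ (*-identityʳ x)) (xy∙z≈xz∙y c (a 0) x)) ⟩
        y * a 0 + a 1 * x ^ 1 + c * x * a 0       ∎
      homogeneous-linear-factor (suc s) = begin
        y * homogeneous b (suc s) + b (2 ℕ.+ s) * x ^ (2 ℕ.+ s)
          ≈⟨ +-cong (≈-trans (*-congˡ (homogeneous-linear-factor s)) (distribˡ _ _ _))
                    (≈-trans (*-congʳ (b₊ (suc s))) (distribʳ _ _ _)) ⟩
        (y * homogeneous a (suc s) + y * (c * x * homogeneous a s))
          + (a (2 ℕ.+ s) * x ^ (2 ℕ.+ s) + c * a (suc s) * x ^ (2 ℕ.+ s))
          ≈⟨ interchange _ _ _ _ ⟩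
        homogeneous a (2 ℕ.+ s) + (y * (c * x * homogeneous a s) + c * a (suc s) * (x * x ^ suc s))
          ≈⟨ +-congˡ (+-cong (x∙yz≈y∙xz _ _ _) rearrange) ⟩
        homogeneous a (2 ℕ.+ s) + (c * x * (y * homogeneous a s) + c * x * (a (suc s) * x ^ suc s))
          ≈⟨ +-congˡ (distribˡ _ _ _) ⟨
        homogeneous a (2 ℕ.+ s) + c * x * homogeneous a (suc s) ∎
        where
        rearrange : c * a (suc s) * (x * x ^ suc s) ≈ c * x * (a (suc s) * x ^ suc s)
        rearrange = ≈-trans (*-assoc _ _ _) (≈-trans (*-congˡ (x∙yz≈y∙xz _ _ _)) (≈-sym (*-assoc _ _ _)))

    -- Iterating gives the product of the y + j x over 1 ≤ j ≤ r.
    homogeneous-elementary : (ι : ℕ → Carrier) → ι 0 ≈ 0# →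
      (∀ m n → ι (m ℕ.+ n) ≈ ι m + ι n) → (∀ m n → ι (m ℕ.* n) ≈ ι m * ι n) → ∀ r →
      homogeneous (ι ∘ elementary (suc r)) (suc r) ≈ (y + ι (suc r) * x) * homogeneous (ι ∘ elementary r) r
    homogeneous-elementary ι ι-0 ι-+ ι-* r = begin
      homogeneous (ι ∘ elementary (suc r)) (suc r)
        ≈⟨ homogeneous-linear-factor ≈-refl (λ i → ≈-trans (ι-+ (elementary r (suc i)) _) (+-congˡ (ι-* (suc r) _))) r ⟩
      y * homogeneous e r + e (suc r) * x ^ suc r + ι (suc r) * x * homogeneous e r
        ≈⟨ +-congʳ (≈-trans (+-congˡ (≈-trans (*-congʳ e-top) (zeroˡ _))) (+-identityʳ _)) ⟩
      y * homogeneous e r + ι (suc r) * x * homogeneous e r ≈⟨ distribʳ _ _ _ ⟨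
      (y + ι (suc r) * x) * homogeneous e r ∎
      where
      e = ι ∘ elementary r
      -- Only `r` numbers are available, so there is no elementary symmetric polynomial of degree
      -- `suc r`, and raising the degree of the form just multiplies it by `y`.
      e-top : e (suc r) ≈ 0#
      e-top = ≈-trans (reflexive (cong ι (elementary-vanishes r (suc r) ℕ.≤-refl))) ι-0

open ListSum ℤ.+-*-commutativeRing
module Hℤ = Homogeneous ℤ.+-*-commutativeRing
open Hℤ hiding (_^_; sum)

-- Whitney's theorem

∈-allVecs : {xs : List A} → (∀ x → x ∈ xs) → (v : Vec A n) → v ∈ allVecs xs n
∈-allVecs all []      = here refl
∈-allVecs all (x ∷ v) = ∈-cartesianProductWith⁺ _∷_ (all x) (∈-allVecs all v)

allVecs-unique : {xs : List A} → Unique xs → ∀ n → Unique (allVecs xs n)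
allVecs-unique u zero    = [] ∷ []
allVecs-unique u (suc n) = Unique.cartesianProductWith⁺ _∷_ Vec.∷-injective u (allVecs-unique u n)

∈-bools : ∀ b → b ∈ (true ∷ false ∷ [])
∈-bools true  = here refl
∈-bools false = there (here refl)

∈-allSubsets : (F : Subset n) → F ∈ allSubsets n
∈-allSubsets = ∈-allVecs ∈-bools

allSubsets-unique : ∀ n → Unique (allSubsets n)
allSubsets-unique = allVecs-unique (((λ ()) ∷ []) ∷ [] ∷ [])

count≡∑ : {P : Pred A ρ} (P? : Decidable P) (xs : List A) → + count P? xs ≡ ∑ xs (λ x → ind (P? x))
count≡∑ P? []       = refl
count≡∑ P? (x ∷ xs) with P? x
... | yes _ = cong (ℤ._+_ 1ℤ) (count≡∑ P? xs)
... | no _  = trans (count≡∑ P? xs) (sym (ℤ.+-identityˡ _))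

∈-entries⁺ : (xs : Vec (Fin n) k) (i : Fin k) → lookup xs i Subset.∈ entries xs
∈-entries⁺ (x ∷ xs) zero    = x∈p∪q⁺ (inj₁ (x∈⁅x⁆ x))
∈-entries⁺ (x ∷ xs) (suc i) = x∈p∪q⁺ (inj₂ (∈-entries⁺ xs i))

∈-entries⁻ : (xs : Vec (Fin n) k) {x : Fin n} → x Subset.∈ entries xs → ∃ λ i → lookup xs i ≡ x
∈-entries⁻ []       x∈ = contradiction x∈ ∉⊥
∈-entries⁻ (y ∷ xs) x∈ with x∈p∪q⁻ ⁅ y ⁆ (entries xs) x∈
... | inj₁ x∈y = zero , sym (x∈⁅y⁆⇒x≡y y x∈y)
... | inj₂ x∈xs = let i , eq = ∈-entries⁻ xs x∈xs in suc i , eq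

∉p-x : (C : Subset n) (e : Fin n) → ¬ (e Subset.∈ C Subset.- e)
∉p-x C e e∈ = Subset.x∈p⇒x∉∁p (x∈⁅x⁆ e) (helper C ⁅ e ⁆ e e∈)
  where
  helper : (p q : Subset n) (x : Fin n) → x Subset.∈ p Subset.─ q → x Subset.∈ Subset.∁ q
  helper (s ∷ p) (outside ∷ q) zero    _ = Vec.here
  helper (s ∷ p) (outside ∷ q) (suc x) (Vec.there x∈) = Vec.there (helper p q x x∈)
  helper (s ∷ p) (inside ∷ q)  (suc x) (Vec.there x∈) = Vec.there (helper p q x x∈)

sgn : Subset n → ℤ
sgn F = -1ℤ Hℤ.^ ∣ F ∣

toggle : Fin n → Subset n → Subset n
toggle e F = F [ e ]%= not

sgn-toggle : (e : Fin n) (F : Subset n) → sgn (toggle e F) ≡ ℤ.- sgn F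
sgn-toggle zero    (true ∷ F)  = sym (trans (cong ℤ.-_ (ℤ.-1*i≡-i (sgn F))) (ℤ.neg-involutive (sgn F)))
sgn-toggle zero    (false ∷ F) = ℤ.-1*i≡-i (sgn F)
sgn-toggle (suc e) (true ∷ F)  = trans (cong (-1ℤ ℤ.*_) (sgn-toggle e F)) (sym (ℤ.neg-distribʳ-* -1ℤ (sgn F)))
sgn-toggle (suc e) (false ∷ F) = sgn-toggle e F

toggle-involutive : (e : Fin n) (F : Subset n) → toggle e (toggle e F) ≡ F
toggle-involutive zero    (x ∷ F) = cong (_∷ F) (Bool.not-involutive x)
toggle-involutive (suc e) (x ∷ F) = cong (x ∷_) (toggle-involutive e F)

∈-toggle : (e : Fin n) (F : Subset n) {x : Fin n} → x Subset.∈ toggle e F → x ≢ e → x Subset.∈ F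
∈-toggle e F {x} x∈ x≢e = Vec.lookup⇒[]= x F
  (trans (sym (Vec.lookup∘updateAt′ x e x≢e F)) (Vec.[]=⇒lookup x∈))

-- Closes the sign-reversing involution, which shows a sum to be its own negative. For every other
-- integer the two sides have different constructors.
i≡-i⇒i≡0 : ∀ i → i ≡ ℤ.- i → i ≡ 0ℤ
i≡-i⇒i≡0 (+ zero) _ = refl

module _ {_≤_ : Rel (Fin m) ℓ} (isTotal : IsTotalOrder _≡_ _≤_) {P : Pred (Fin m) ρ} (P? : Decidable P) where

  private module ≤ = IsTotalOrder isTotal

  -- Applied to the monochromatic edges, the two outcomes are the proper colourings and the cones;
  -- applied to a cycle, it finds the edge whose deletion leaves a broken circuit.
  maximum : (∀ e → ¬ P e) ⊎ ∃ λ e → P e × (∀ f → P f → f ≤ e)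
  maximum with go (allFin m)
    where
    go : ∀ xs → (∀ {e} → e ∈ xs → ¬ P e) ⊎ ∃ λ e → P e × (∀ {f} → f ∈ xs → P f → f ≤ e)
    go [] = inj₁ λ ()
    go (x ∷ xs) with P? x | go xs
    ... | no ¬px | inj₁ none = inj₁ λ { (here refl) → ¬px ; (there e∈) → none e∈ }
    ... | no ¬px | inj₂ (e , pe , max) =
      inj₂ (e , pe , λ { (here refl) px → contradiction px ¬px ; (there f∈) → max f∈ })
    ... | yes px | inj₁ none =
      inj₂ (x , px , λ { (here refl) _ → ≤.refl ; (there f∈) pf → contradiction pf (none f∈) })
    ... | yes px | inj₂ (e , pe , max) with ≤.total x e
    ... | inj₁ x≤e = inj₂ (e , pe , λ { (here refl) _ → x≤e ; (there f∈) → max f∈ })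
    ... | inj₂ e≤x = inj₂ (x , px , λ { (here refl) _ → ≤.refl ; (there f∈) pf → ≤.trans (max f∈ pf) e≤x })
  ... | inj₁ none           = inj₁ λ e → none (∈-allFin e)
  ... | inj₂ (e , pe , max) = inj₂ (e , pe , λ f → max (∈-allFin f))

-- Go round the other way: from `j` down to 0, across the wrap to `suc k`, and down to `suc j`. None
-- of these steps is the one at `j`.
cyclic-constant : (g : Fin (suc k) → A) (j : Fin (suc k)) →
  (∀ i → i ≢ j → g i ≡ g (suc (toℕ i) mod suc k)) → g j ≡ g (suc (toℕ j) mod suc k)
cyclic-constant {k = k} {A = A} g j step = begin
  g j             ≡⟨ cong g (sym (mod-toℕ j)) ⟩
  h (toℕ j)       ≡⟨ chain 0 (toℕ j) (λ t _ t<j → h-step t (ℕ.<-trans t<j (Fin.toℕ<n j)) (ℕ.<⇒≢ t<j)) ℕ.z≤n ⟨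
  h 0             ≡⟨ cong g (Fin.toℕ-injective (trans (Fin.toℕ-fromℕ< (m%n<n (suc k) (suc k))) (n%n≡0 (suc k)))) ⟨
  h (suc k)       ≡⟨ chain (suc (toℕ j)) (suc k) (λ t j<t t<k → h-step t t<k (λ t≡j → ℕ.<⇒≢ j<t (sym t≡j))) (Fin.toℕ<n j) ⟨
  h (suc (toℕ j)) ∎
  where
  open ≡-Reasoning
  h : ℕ → A
  h t = g (t mod suc k)

  mod-toℕ : ∀ i → toℕ i mod suc k ≡ i
  mod-toℕ i = Fin.toℕ-injective (trans (Fin.toℕ-fromℕ< _) (m<n⇒m%n≡m (Fin.toℕ<n i)))

  h-step : ∀ t → t ℕ.< suc k → t ≢ toℕ j → h t ≡ h (suc t)
  h-step t t<k t≢j = begin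
    h t                            ≡⟨ step _ (λ eq → t≢j (trans (sym toℕ-t) (cong toℕ eq))) ⟩
    h (suc (toℕ (t mod suc k)))    ≡⟨ cong (h ∘ suc) toℕ-t ⟩
    h (suc t)                      ∎
    where
    toℕ-t : toℕ (t mod suc k) ≡ t
    toℕ-t = trans (Fin.toℕ-fromℕ< _) (m<n⇒m%n≡m t<k)

  chain : ∀ s t → (∀ u → s ℕ.≤ u → u ℕ.< t → h u ≡ h (suc u)) → s ℕ.≤ t → h s ≡ h t
  chain s t st s≤t with ℕ.m≤n⇒m<n∨m≡n s≤t
  ... | inj₂ refl = refl
  chain s (suc t) st s≤t | inj₁ (s≤s s≤t′) =
    trans (chain s t (λ u s≤u u<t → st u s≤u (ℕ.m<n⇒m<1+n u<t)) s≤t′) (st t s≤t′ ℕ.≤-refl)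

module _ (G : Graph) where

  open Graph G using (Joins; ends; IsCycle; Vertex)

  Monochromatic : Vec (Fin q) (∣V∣ G) → Edge G → Set
  Monochromatic κ e = lookup κ (proj₁ (ends e)) ≡ lookup κ (proj₂ (ends e))

  monochromatic? : (κ : Vec (Fin q) (∣V∣ G)) → Decidable (Monochromatic κ)
  monochromatic? κ e = _ Fin.≟ _

  MonochromaticOn : Vec (Fin q) (∣V∣ G) → Subset (∣E∣ G) → Set
  MonochromaticOn κ F = ∀ e → e Subset.∈ F → Monochromatic κ e

  monochromaticOn? : (κ : Vec (Fin q) (∣V∣ G)) → Decidable (MonochromaticOn κ)
  monochromaticOn? κ F = Fin.all? λ e → (e ∈? F) →-dec monochromatic? κ e

  joins-mono : {κ : Vec (Fin q) (∣V∣ G)} {e : Edge G} {u v : Vertex} →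
    Joins e u v → Monochromatic κ e → lookup κ u ≡ lookup κ v
  joins-mono (inj₁ eq) mono rewrite eq = mono
  joins-mono (inj₂ eq) mono rewrite eq = sym mono

  mono-joins : {κ : Vec (Fin q) (∣V∣ G)} {e : Edge G} {u v : Vertex} →
    Joins e u v → lookup κ u ≡ lookup κ v → Monochromatic κ e
  mono-joins (inj₁ eq) mono rewrite eq = mono
  mono-joins (inj₂ eq) mono rewrite eq = sym mono

  monochromatic-closed : {κ : Vec (Fin q) (∣V∣ G)} {C : Subset (∣E∣ G)} {e : Edge G} →
    IsCycle C → e Subset.∈ C → MonochromaticOn κ (C Subset.- e) → Monochromatic κ e
  monochromatic-closed {κ = κ} (k , vs , es , _ , es-inj , walk , refl) e∈ mono
    with j , refl ← ∈-entries⁻ es e∈ =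
    mono-joins {κ = κ} (walk j) (cyclic-constant (λ i → lookup κ (lookup vs i)) j λ i i≢j →
      joins-mono {κ = κ} (walk i)
        -- As the edges of a cycle are distinct, every position other than `j` carries an edge
        -- different from `e`, hence an edge of C - e.
        (mono _ (x∈p∧x≢y⇒x∈p-y (∈-entries⁺ es i) (i≢j ∘ es-inj))))

  Proper : Vec (Fin q) (∣V∣ G) → Set
  Proper κ = ∀ e → ¬ Monochromatic κ e

  proper? : (κ : Vec (Fin q) (∣V∣ G)) → Dec (Proper κ)
  proper? κ = Fin.all? λ e → monochromatic? κ e →-dec no λ ()

  module _ {_≤_ : Rel (Edge G) ℓ} (isTotal : IsTotalOrder _≡_ _≤_) where

    private module ≤ = IsTotalOrder isTotal

    Face : Subset (∣E∣ G) → Set ℓ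
    Face = IsFace G isTotal

    faces : List (Subset (∣E∣ G))
    faces = filter (isFace? G isTotal) (allSubsets (∣E∣ G))

    -- No broken circuit C - e inside toggle e₀ F contains e₀: otherwise e is monochromatic
    -- as well, whence e ≤ e₀ ≤ e.
    toggle-face : (κ : Vec (Fin q) (∣V∣ G)) {e₀ : Edge G} →
      Monochromatic κ e₀ → (∀ f → Monochromatic κ f → f ≤ e₀) →
      {F : Subset (∣E∣ G)} → Face F → MonochromaticOn κ F →
      Face (toggle e₀ F) × MonochromaticOn κ (toggle e₀ F)
    toggle-face κ {e₀} mono₀ max {F} face mono = face′ , mono′
      where
      mono′ : MonochromaticOn κ (toggle e₀ F)
      mono′ e e∈ with e Fin.≟ e₀
      ... | yes refl = mono₀
      ... | no e≢e₀  = mono e (∈-toggle e₀ F e∈ e≢e₀)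

      face′ : Face (toggle e₀ F)
      face′ (_ , (C , e , cyc , (e∈ , e-max) , refl) , B⊆) =
        face (_ , (C , e , cyc , (e∈ , e-max) , refl) , λ x∈ →
          ∈-toggle e₀ F (B⊆ x∈) λ { refl → ∉p-x C e (subst (Subset._∈ C Subset.- e) (e₀≡e x∈) x∈) })
        where
        e₀≡e : e₀ Subset.∈ C Subset.- e → e₀ ≡ e
        e₀≡e e₀∈ = ≤.antisym (e-max e₀ (p─q⊆p C ⁅ e ⁆ e₀∈))
          (max e (monochromatic-closed {κ = κ} cyc e∈ (λ f f∈ → mono′ f (B⊆ f∈))))

    private
      monochromaticFaces : Vec (Fin q) (∣V∣ G) → List (Subset (∣E∣ G))
      monochromaticFaces κ = filter (monochromaticOn? κ) faces

      ∈-monochromaticFaces⁺ : (κ : Vec (Fin q) (∣V∣ G)) {F : Subset (∣E∣ G)} →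
        Face F → MonochromaticOn κ F → F ∈ monochromaticFaces κ
      ∈-monochromaticFaces⁺ κ face mono =
        ∈-filter⁺ (monochromaticOn? κ) (∈-filter⁺ (isFace? G isTotal) (∈-allSubsets _) face) mono

      ∈-monochromaticFaces⁻ : (κ : Vec (Fin q) (∣V∣ G)) {F : Subset (∣E∣ G)} →
        F ∈ monochromaticFaces κ → Face F × MonochromaticOn κ F
      ∈-monochromaticFaces⁻ κ F∈ =
        let F∈′ , mono = ∈-filter⁻ (monochromaticOn? κ) {xs = faces} F∈ in
        proj₂ (∈-filter⁻ (isFace? G isTotal) {xs = allSubsets (∣E∣ G)} F∈′) , mono

      monochromaticFaces-unique : (κ : Vec (Fin q) (∣V∣ G)) → Unique (monochromaticFaces κ)
      monochromaticFaces-unique κ =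
        Unique.filter⁺ (monochromaticOn? κ) (Unique.filter⁺ (isFace? G isTotal) (allSubsets-unique _))

      ∑-sgn-cone : (κ : Vec (Fin q) (∣V∣ G)) {e₀ : Edge G} →
        Monochromatic κ e₀ → (∀ f → Monochromatic κ f → f ≤ e₀) → ∑ (monochromaticFaces κ) sgn ≡ 0ℤ
      ∑-sgn-cone κ {e₀} mono₀ max = i≡-i⇒i≡0 _ (begin
        ∑ (monochromaticFaces κ) sgn
          ≡⟨ ∑-bijection (toggle e₀) (toggle e₀) sgn unique unique toggled toggled ⟨
        ∑ (monochromaticFaces κ) (λ F → sgn (toggle e₀ F))
          ≡⟨ ∑-cong (monochromaticFaces κ) (λ {F} _ → sgn-toggle e₀ F) ⟩
        ∑ (monochromaticFaces κ) (λ F → ℤ.- sgn F)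
          ≡⟨ ∑-neg (monochromaticFaces κ) sgn ⟩
        ℤ.- ∑ (monochromaticFaces κ) sgn ∎)
        where
        open ≡-Reasoning
        unique = monochromaticFaces-unique κ

        toggled : ∀ {F} → F ∈ monochromaticFaces κ →
          toggle e₀ F ∈ monochromaticFaces κ × toggle e₀ (toggle e₀ F) ≡ F
        toggled {F} F∈ =
          let face  , mono  = ∈-monochromaticFaces⁻ κ F∈
              face′ , mono′ = toggle-face κ mono₀ max face mono
          in ∈-monochromaticFaces⁺ κ face′ mono′ , toggle-involutive e₀ F

      ∑-sgn-proper : (κ : Vec (Fin q) (∣V∣ G)) → Proper κ → ∑ (monochromaticFaces κ) sgn ≡ 1ℤ
      ∑-sgn-proper κ proper = begin
        ∑ (monochromaticFaces κ) sgn
          ≡⟨ ∑-bijection (λ _ → ∅) (λ _ → ∅) sgn ([] ∷ []) (monochromaticFaces-unique κ)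
               (λ { (here refl) → ∅∈ , refl })
               (λ F∈ → here refl , sym (≡∅ (proj₂ (∈-monochromaticFaces⁻ κ F∈)))) ⟨
        ∑ (∅ ∷ []) (λ _ → sgn ∅) ≡⟨ ℤ.+-identityʳ _ ⟩
        sgn ∅                    ≡⟨ cong (-1ℤ Hℤ.^_) (Subset.∣⊥∣≡0 (∣E∣ G)) ⟩
        1ℤ                       ∎
        where
        open ≡-Reasoning

        ∅ : Subset (∣E∣ G)
        ∅ = Subset.⊥

        ≡∅ : ∀ {F} → MonochromaticOn κ F → F ≡ ∅
        ≡∅ mono = Subset.Empty-unique λ (e , e∈) → proper e (mono e e∈)

        -- If the broken circuit C - e were empty, it would be monochromatic vacuously, which would
        -- force `e` to be monochromatic too.
        face-∅ : Face ∅
        face-∅ (_ , (C , e , cyc , (e∈ , _) , refl) , B⊆) =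
          proper e (monochromatic-closed {κ = κ} cyc e∈ λ f f∈ → contradiction (B⊆ f∈) ∉⊥)

        ∅∈ : ∅ ∈ monochromaticFaces κ
        ∅∈ = ∈-monochromaticFaces⁺ κ face-∅ λ e e∈ → contradiction e∈ ∉⊥

    ∑-sgn-monochromatic : (κ : Vec (Fin q) (∣V∣ G)) →
      ∑ (filter (monochromaticOn? κ) faces) sgn ≡ ind (proper? κ)
    ∑-sgn-monochromatic κ = Sum.[
        (λ proper → trans (∑-sgn-proper κ proper) (sym (ind-yes (proper? κ) proper))) ,
        (λ (e₀ , mono₀ , max) →
          trans (∑-sgn-cone κ mono₀ max) (sym (ind-no (proper? κ) λ proper → proper e₀ mono₀)))
      ]′ (maximum isTotal (monochromatic? κ))

    whitney : ∀ q → let κs = allVecs (allFin q) (∣V∣ G) in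
      ∑ faces (λ F → sgn F ℤ.* ∑ κs (λ κ → ind (monochromaticOn? κ F))) ≡ ∑ κs (λ κ → ind (proper? κ))
    whitney q = begin
      ∑ faces (λ F → sgn F ℤ.* ∑ κs (λ κ → on κ F))   ≡⟨ ∑-cong faces (λ {F} _ → sym (∑-*ˡ κs (sgn F) (λ κ → on κ F))) ⟩
      ∑ faces (λ F → ∑ κs (λ κ → sgn F ℤ.* on κ F))   ≡⟨ ∑-swap faces κs (λ F κ → sgn F ℤ.* on κ F) ⟩
      ∑ κs (λ κ → ∑ faces (λ F → sgn F ℤ.* on κ F))   ≡⟨ ∑-cong κs (λ {κ} _ → inner κ) ⟩
      ∑ κs (λ κ → ind (proper? κ))                    ∎
      where
      open ≡-Reasoning
      κs = allVecs (allFin q) (∣V∣ G)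

      on : Vec (Fin q) (∣V∣ G) → Subset (∣E∣ G) → ℤ
      on κ F = ind (monochromaticOn? κ F)

      inner : ∀ κ → ∑ faces (λ F → sgn F ℤ.* on κ F) ≡ ind (proper? κ)
      inner κ = begin
        ∑ faces (λ F → sgn F ℤ.* on κ F)               ≡⟨ ∑-cong faces (λ {F} _ → ℤ.*-comm (sgn F) (on κ F)) ⟩
        ∑ faces (λ F → on κ F ℤ.* sgn F)               ≡⟨ ∑-filter (monochromaticOn? κ) faces sgn ⟨
        ∑ (filter (monochromaticOn? κ) faces) sgn      ≡⟨ ∑-sgn-monochromatic κ ⟩
        ind (proper? κ)                                ∎

-- Forests and the colourings constant on their components

elements : Subset n → List (Fin n)
elements []          = []
elements (true ∷ F)  = zero ∷ List.map suc (elements F)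
elements (false ∷ F) = List.map suc (elements F)

length-elements : (F : Subset n) → length (elements F) ≡ ∣ F ∣
length-elements []          = refl
length-elements (true ∷ F)  = cong suc (trans (List.length-map suc (elements F)) (length-elements F))
length-elements (false ∷ F) = trans (List.length-map suc (elements F)) (length-elements F)

∈-elements⁺ : (F : Subset n) {x : Fin n} → x Subset.∈ F → x ∈ elements F
∈-elements⁺ (true ∷ F)  Vec.here       = here refl
∈-elements⁺ (true ∷ F)  (Vec.there x∈) = there (∈-map⁺ suc (∈-elements⁺ F x∈))
∈-elements⁺ (false ∷ F) (Vec.there x∈) = ∈-map⁺ suc (∈-elements⁺ F x∈)

∈-elements⁻ : (F : Subset n) {x : Fin n} → x ∈ elements F → x Subset.∈ F
∈-elements⁻ (true ∷ F)  (here refl) = Vec.here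
∈-elements⁻ (true ∷ F)  (there x∈) with _ , y∈ , refl ← ∈-map⁻ suc x∈ = Vec.there (∈-elements⁻ F y∈)
∈-elements⁻ (false ∷ F) x∈         with _ , y∈ , refl ← ∈-map⁻ suc x∈ = Vec.there (∈-elements⁻ F y∈)

elements-unique : (F : Subset n) → Unique (elements F)
elements-unique []          = []
elements-unique (true ∷ F)  =
  All.tabulate (λ y∈ 0≡y → let _ , _ , eq = ∈-map⁻ suc y∈ in Fin.0≢1+n (trans 0≡y eq))
  ∷ Unique.map⁺ Fin.suc-injective (elements-unique F)
elements-unique (false ∷ F) = Unique.map⁺ Fin.suc-injective (elements-unique F)

∑-const : (xs : List A) (r : ℤ) → ∑ xs (λ _ → r) ≡ + length xs ℤ.* r
∑-const []       r = sym (ℤ.*-zeroˡ r)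
∑-const (x ∷ xs) r = begin
  r ℤ.+ ∑ xs (λ _ → r)                  ≡⟨ cong₂ ℤ._+_ (sym (ℤ.*-identityˡ r)) (∑-const xs r) ⟩
  1ℤ ℤ.* r ℤ.+ + length xs ℤ.* r        ≡⟨ ℤ.*-distribʳ-+ r 1ℤ (+ length xs) ⟨
  + length (x ∷ xs) ℤ.* r               ∎
  where open ≡-Reasoning

length-allFin : ∀ n → length (allFin n) ≡ n
length-allFin n = List.length-tabulate {n = n} id

∑-allVecs-1 : ∀ q m → ∑ (allVecs (allFin q) m) (λ _ → 1ℤ) ≡ (+ q) Hℤ.^ m
∑-allVecs-1 q zero    = refl
∑-allVecs-1 q (suc m) = begin
  ∑ (allVecs (allFin q) (suc m)) (λ _ → 1ℤ)                   ≡⟨ ∑-cartesianProductWith _∷_ (allFin q) (allVecs (allFin q) m) _ ⟩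
  ∑ (allFin q) (λ _ → ∑ (allVecs (allFin q) m) (λ _ → 1ℤ))    ≡⟨ ∑-const (allFin q) _ ⟩
  + length (allFin q) ℤ.* ∑ (allVecs (allFin q) m) (λ _ → 1ℤ) ≡⟨ cong₂ ℤ._*_ (cong +_ (length-allFin q)) (∑-allVecs-1 q m) ⟩
  + q ℤ.* (+ q) Hℤ.^ m                                         ∎
  where open ≡-Reasoning

lookup-∷ʳ : (xs : Vec A k) (x : A) (i : Fin (suc k)) →
  (i ≡ fromℕ k × lookup (xs ∷ʳ x) i ≡ x) ⊎ (∃ λ j → i ≡ inject₁ j × lookup (xs ∷ʳ x) i ≡ lookup xs j)
lookup-∷ʳ []       x zero    = inj₁ (refl , refl)
lookup-∷ʳ (y ∷ xs) x zero    = inj₂ (zero , refl , refl)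
lookup-∷ʳ (y ∷ xs) x (suc i) with lookup-∷ʳ xs x i
... | inj₁ (refl , eq)     = inj₁ (refl , eq)
... | inj₂ (j , refl , eq) = inj₂ (suc j , refl , eq)

lookup-∷ʳ-injective : {xs : Vec A k} {x : A} → Injective _≡_ _≡_ (lookup xs) → (∀ i → lookup xs i ≢ x) →
  Injective _≡_ _≡_ (lookup (xs ∷ʳ x))
lookup-∷ʳ-injective {xs = xs} {x} inj x∉ {i} {j} eq with lookup-∷ʳ xs x i | lookup-∷ʳ xs x j
... | inj₁ (refl , _)       | inj₁ (refl , _)       = refl
... | inj₁ (_ , eqᵢ)        | inj₂ (j′ , _ , eqⱼ)   = contradiction (trans (sym eqⱼ) (trans (sym eq) eqᵢ)) (x∉ j′)
... | inj₂ (i′ , _ , eqᵢ)   | inj₁ (_ , eqⱼ)        = contradiction (trans (sym eqᵢ) (trans eq eqⱼ)) (x∉ i′)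
... | inj₂ (_ , refl , eqᵢ) | inj₂ (_ , refl , eqⱼ) = cong inject₁ (inj (trans (sym eqᵢ) (trans eq eqⱼ)))

lookup-∷-injective : {x : A} {xs : Vec A k} → (∀ i → lookup xs i ≢ x) → Injective _≡_ _≡_ (lookup xs) →
  Injective _≡_ _≡_ (lookup (x ∷ xs))
lookup-∷-injective x∉ inj {zero}  {zero}  eq = refl
lookup-∷-injective x∉ inj {zero}  {suc j} eq = contradiction (sym eq) (x∉ j)
lookup-∷-injective x∉ inj {suc i} {zero}  eq = contradiction eq (x∉ i)
lookup-∷-injective x∉ inj {suc i} {suc j} eq = cong suc (inj eq)

module _ {a b : Fin (suc m)} (a≢b : a ≢ b) where

  -- The label `a` is deleted from the range and its points take over the label of `b`, which is
  -- `punchOut a≢b` after the deletion.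
  merge : Fin (suc m) → Fin m
  merge x with a Fin.≟ x
  ... | yes _  = punchOut a≢b
  ... | no a≢x = punchOut a≢x

  merge-a≡merge-b : merge a ≡ merge b
  merge-a≡merge-b with a Fin.≟ a | a Fin.≟ b
  ... | no a≢a | _       = contradiction refl a≢a
  ... | yes _  | yes a≡b = contradiction a≡b a≢b
  ... | yes _  | no _    = Fin.punchOut-cong a refl

  merge-punchIn : ∀ i → merge (punchIn a i) ≡ i
  merge-punchIn i with a Fin.≟ punchIn a i
  ... | yes eq = contradiction (sym eq) (Fin.punchInᵢ≢i a i)
  ... | no _   = trans (Fin.punchOut-cong a refl) (Fin.punchOut-punchIn a)

  merge-≡ : ∀ x y → merge x ≡ merge y → x ≡ y ⊎ (x ≡ a × y ≡ b) ⊎ (x ≡ b × y ≡ a)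
  merge-≡ x y eq with a Fin.≟ x | a Fin.≟ y
  ... | yes refl | yes refl = inj₁ refl
  ... | yes refl | no a≢y   = inj₂ (inj₁ (refl , sym (Fin.punchOut-injective a≢b a≢y eq)))
  ... | no a≢x   | yes refl = inj₂ (inj₂ (Fin.punchOut-injective a≢x a≢b eq , refl))
  ... | no a≢x   | no a≢y   = inj₁ (Fin.punchOut-injective a≢x a≢y eq)

module _ (G : Graph) where

  open Graph G using (Joins; ends; IsCycle; Vertex; CyclicWalk)

  private
    variable
      e f : Edge G
      u v w x y : Vertex
      es : List (Edge G)

  joins-sym : Joins e u v → Joins e v u
  joins-sym (inj₁ eq) = inj₂ eq
  joins-sym (inj₂ eq) = inj₁ eq

  joins-end : Joins e u w → Joins e x y → x ≡ u ⊎ y ≡ u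
  joins-end (inj₁ p) (inj₁ q) = inj₁ (cong proj₁ (trans (sym q) p))
  joins-end (inj₁ p) (inj₂ q) = inj₂ (cong proj₁ (trans (sym q) p))
  joins-end (inj₂ p) (inj₁ q) = inj₂ (cong proj₂ (trans (sym q) p))
  joins-end (inj₂ p) (inj₂ q) = inj₁ (cong proj₂ (trans (sym q) p))

  -- The vectors of vertices and edges are indices, so that appending one closing edge to the second
  -- yields the very data that `IsCycle` asks for: as many edges as vertices.
  data SimplePath (es : List (Edge G)) : Vertex → Vertex → Vec Vertex (suc k) → Vec (Edge G) k → Set where
    []  : SimplePath es u u (u ∷ []) []
    via : {vs : Vec Vertex (suc k)} {fs : Vec (Edge G) k} →
      e ∈ es → Joins e u w → (∀ i → lookup vs i ≢ u) → SimplePath es w v vs fs →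
      SimplePath es u v (u ∷ vs) (e ∷ fs)

  Connected : List (Edge G) → Rel Vertex _
  Connected es = Star (λ x y → ∃ λ e → e ∈ es × Joins e x y)

  module _ {es : List (Edge G)} where

    path-tail : {vs : Vec Vertex (suc k)} {fs : Vec (Edge G) k} → SimplePath es u v vs fs →
      ∀ i → ∃ λ k → Σ (Vec Vertex (suc k)) λ vs′ → ∃ λ fs′ → SimplePath es (lookup vs i) v vs′ fs′
    path-tail []                  zero    = _ , _ , _ , []
    path-tail path@(via _ _ _ _)  zero    = _ , _ , _ , path
    path-tail (via _ _ _ path)    (suc i) = path-tail path i

    -- Loop erasure: if the new start `u` already lies on the path, the part of the path before it
    -- is dropped; otherwise the edge is prepended.
    connected⇒path : Connected es u v → ∃ λ k → Σ (Vec Vertex (suc k)) λ vs → ∃ λ fs → SimplePath es u v vs fs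
    connected⇒path ε = _ , _ , _ , []
    connected⇒path {u = u} ((e , e∈ , joins) ◅ walk) with _ , vs , fs , path ← connected⇒path walk
      with Fin.any? (λ i → lookup vs i Fin.≟ u)
    ... | yes (i , refl) = path-tail path i
    ... | no ∄i          = _ , _ , _ , via e∈ joins (λ i eq → ∄i (i , eq)) path

    path-start : {vs : Vec Vertex (suc k)} {fs : Vec (Edge G) k} → SimplePath es u v vs fs → lookup vs zero ≡ u
    path-start []            = refl
    path-start (via _ _ _ _) = refl

    path-end : {vs : Vec Vertex (suc k)} {fs : Vec (Edge G) k} → SimplePath es u v vs fs → lookup vs (fromℕ k) ≡ v
    path-end []               = refl
    path-end (via _ _ _ path) = path-end path

    path-edges : {vs : Vec Vertex (suc k)} {fs : Vec (Edge G) k} → SimplePath es u v vs fs → ∀ i → lookup fs i ∈ es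
    path-edges (via e∈ _ _ _) zero    = e∈
    path-edges (via _ _ _ path)     (suc i) = path-edges path i

    path-joins : {vs : Vec Vertex (suc k)} {fs : Vec (Edge G) k} → SimplePath es u v vs fs →
      ∀ i → Joins (lookup fs i) (lookup vs (inject₁ i)) (lookup vs (suc i))
    path-joins (via _ joins _ path) zero    = subst (Joins _ _) (sym (path-start path)) joins
    path-joins (via _ _ _ path)           (suc i) = path-joins path i

    path-vertices-injective : {vs : Vec Vertex (suc k)} {fs : Vec (Edge G) k} → SimplePath es u v vs fs →
      Injective _≡_ _≡_ (lookup vs)
    path-vertices-injective []                {zero} {zero} _ = refl
    path-vertices-injective (via _ _ u∉ path) = lookup-∷-injective u∉ (path-vertices-injective path)

    -- If the first edge occurred again, its end `u` would be among the later vertices.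
    path-edges-injective : {vs : Vec Vertex (suc k)} {fs : Vec (Edge G) k} → SimplePath es u v vs fs →
      Injective _≡_ _≡_ (lookup fs)
    path-edges-injective {fs = e ∷ fs} (via _ joins u∉ path) = lookup-∷-injective e∉ (path-edges-injective path)
      where
      e∉ : ∀ i → lookup fs i ≢ e
      e∉ i refl with joins-end joins (path-joins path i)
      ... | inj₁ eq = u∉ (inject₁ i) eq
      ... | inj₂ eq = u∉ (suc i) eq

    -- The path has `suc k` distinct vertices and `k` distinct edges, and `e` is new because it lies
    -- outside `es`. It takes the last position, from which the cyclic walk wraps to vertex 0.
    close-path : {vs : Vec Vertex (suc k)} {fs : Vec (Edge G) k} → SimplePath es u v vs fs →
      e ∉ es → Joins e u v → IsCycle (entries (fs ∷ʳ e))
    close-path {k = k} {u = u} {e = e} {vs = vs} {fs} path e∉ joins =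
      k , vs , fs ∷ʳ e , path-vertices-injective path ,
      lookup-∷ʳ-injective {xs = fs} (path-edges-injective path) (λ i eq → e∉ (subst (_∈ es) eq (path-edges path i))) ,
      walk , refl
      where
      walk : CyclicWalk vs (fs ∷ʳ e)
      walk i with lookup-∷ʳ fs e i
      ... | inj₁ (refl , eq) = subst₂ (λ e w → Joins e (lookup vs (fromℕ k)) (lookup vs w)) (sym eq) (sym next)
              (subst₂ (Joins e) (sym (path-end path)) (sym (path-start path)) (joins-sym joins))
        where
        next : suc (toℕ (fromℕ k)) mod suc k ≡ zero
        next = Fin.toℕ-injective (trans (Fin.toℕ-fromℕ< (m%n<n (suc (toℕ (fromℕ k))) (suc k)))
          (subst (λ t → suc t ℕ.% suc k ≡ 0) (sym (Fin.toℕ-fromℕ k)) (n%n≡0 (suc k))))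
      ... | inj₂ (j , refl , eq) =
              subst₂ (λ e w → Joins e (lookup vs (inject₁ j)) (lookup vs w)) (sym eq) (sym next) (path-joins path j)
        where
        next : suc (toℕ (inject₁ j)) mod suc k ≡ suc j
        next = Fin.toℕ-injective (trans (Fin.toℕ-fromℕ< (m%n<n (suc (toℕ (inject₁ j))) (suc k)))
          (subst (λ t → suc t ℕ.% suc k ≡ suc (toℕ j)) (sym (Fin.toℕ-inject₁ j)) (m<n⇒m%n≡m (s≤s (Fin.toℕ<n j)))))

  Acyclic : List (Edge G) → Set
  Acyclic es = ∀ C → IsCycle C → ¬ (∀ e → e Subset.∈ C → e ∈ es)

  acyclic⇒disconnected : e ∉ es → Acyclic (e ∷ es) → ¬ Connected es (proj₁ (ends e)) (proj₂ (ends e))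
  acyclic⇒disconnected {e} {es} e∉ acyclic conn with _ , vs , fs , path ← connected⇒path conn =
    acyclic _ (close-path path e∉ (inj₁ refl)) contained
    where
    contained : ∀ f → f Subset.∈ entries (fs ∷ʳ e) → f ∈ e ∷ es
    contained f f∈ with i , refl ← ∈-entries⁻ (fs ∷ʳ e) f∈ with lookup-∷ʳ fs e i
    ... | inj₁ (_ , eq)     = here eq
    ... | inj₂ (j , _ , eq) = there (subst (_∈ es) (sym eq) (path-edges path j))

  -- The components of a forest, labelled by `Fin classes`; each edge lowers their number by one.
  -- The section `rep` picks the vertex from which the colour of a component is read. Together
  -- `class-sound` and `class-exact` say that the fibres of `class` are the components.
  record Contraction (es : List (Edge G)) : Set where
    field
      classes      : ℕ
      classes+     : classes ℕ.+ length es ≡ ∣V∣ G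
      class        : Vertex → Fin classes
      rep          : Fin classes → Vertex
      class-rep    : ∀ i → class (rep i) ≡ i
      class-sound  : e ∈ es → class (proj₁ (ends e)) ≡ class (proj₂ (ends e))
      class-exact  : class u ≡ class v → Connected es u v

  -- Edges are added one at a time. If the ends of the new edge were in one class, a path between
  -- them would close to a cycle; so they are in two classes, which are merged.
  contract : Unique es → Acyclic es → Contraction es
  contract {[]} _ _ = record
    { classes     = ∣V∣ G
    ; classes+    = ℕ.+-identityʳ _
    ; class       = id
    ; rep         = id
    ; class-rep   = λ _ → refl
    ; class-sound = λ ()
    ; class-exact = λ { refl → ε }
    }
  contract {e ∷ es} (e∉ ∷ unique) acyclic = go (contract unique acyclic′)
    where
    acyclic′ : Acyclic es
    acyclic′ C cyc C⊆ = acyclic C cyc λ f f∈ → there (C⊆ f f∈)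

    weaken : Connected es u v → Connected (e ∷ es) u v
    weaken = Star.map λ (f , f∈ , joins) → f , there f∈ , joins

    go : Contraction es → Contraction (e ∷ es)
    go record { classes = zero ; class = class } with () ← class (proj₁ (ends e))
    go record { classes = suc m ; classes+ = classes+ ; class = class ; rep = rep ; class-rep = class-rep
              ; class-sound = class-sound ; class-exact = class-exact } = record
      { classes     = m
      ; classes+    = trans (ℕ.+-suc m (length es)) classes+
      ; class       = merge a≢b ∘ class
      ; rep         = rep ∘ punchIn _
      ; class-rep   = λ i → trans (cong (merge a≢b) (class-rep _)) (merge-punchIn a≢b i)
      ; class-sound = λ { (here refl) → merge-a≡merge-b a≢b ; (there f∈) → cong (merge a≢b) (class-sound f∈) }
      ; class-exact = exact
      }
      where
      a≢b : class (proj₁ (ends e)) ≢ class (proj₂ (ends e))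
      a≢b eq = acyclic⇒disconnected (λ e∈ → All.lookup e∉ e∈ refl) acyclic (class-exact eq)

      exact : merge a≢b (class u) ≡ merge a≢b (class v) → Connected (e ∷ es) u v
      exact {u} {v} eq with merge-≡ a≢b (class u) (class v) eq
      ... | inj₁ u≡v               = weaken (class-exact u≡v)
      ... | inj₂ (inj₁ (u≡ , v≡)) =
        weaken (class-exact u≡) ◅◅ (e , here refl , inj₁ refl) ◅ weaken (class-exact (sym v≡))
      ... | inj₂ (inj₂ (u≡ , v≡)) =
        weaken (class-exact u≡) ◅◅ (e , here refl , inj₂ refl) ◅ weaken (class-exact (sym v≡))

  module _ {F : Subset (∣E∣ G)} (contraction : Contraction (elements F)) where

    open Contraction contraction

    connected-mono : {κ : Vec (Fin q) (∣V∣ G)} → MonochromaticOn G κ F → Connected (elements F) u v →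
      lookup κ u ≡ lookup κ v
    connected-mono mono ε = refl
    connected-mono {κ = κ} mono ((e , e∈ , joins) ◅ walk) =
      trans (joins-mono G {κ = κ} joins (mono e (∈-elements⁻ F e∈))) (connected-mono {κ = κ} mono walk)

    ∑-monochromaticOn : ∀ q →
      ∑ (allVecs (allFin q) (∣V∣ G)) (λ κ → ind (monochromaticOn? G κ F)) ≡ (+ q) Hℤ.^ classes
    ∑-monochromaticOn q = begin
      ∑ κs (λ κ → ind (monochromaticOn? G κ F))        ≡⟨ ∑-cong κs (λ _ → sym (ℤ.*-identityʳ _)) ⟩
      ∑ κs (λ κ → ind (monochromaticOn? G κ F) ℤ.* 1ℤ) ≡⟨ ∑-filter (λ κ → monochromaticOn? G κ F) κs _ ⟨
      ∑ (filter (λ κ → monochromaticOn? G κ F) κs) (λ _ → 1ℤ)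
        ≡⟨ ∑-bijection restrict extend _ (Unique.filter⁺ (λ κ → monochromaticOn? G κ F) (allVecs-unique (Unique.allFin⁺ q) _))
             (allVecs-unique (Unique.allFin⁺ q) _)
             (λ κ∈ → ∈-allVecs ∈-allFin _ , extend-restrict _ (proj₂ (∈-filter⁻ (λ κ → monochromaticOn? G κ F) {xs = κs} κ∈)))
             (λ {κ} _ → ∈-filter⁺ (λ κ → monochromaticOn? G κ F) (∈-allVecs ∈-allFin _) (extend-mono κ) , restrict-extend κ) ⟩
      ∑ (allVecs (allFin q) classes) (λ _ → 1ℤ)        ≡⟨ ∑-allVecs-1 q classes ⟩
      (+ q) Hℤ.^ classes                                ∎
      where
      open ≡-Reasoning
      κs = allVecs (allFin q) (∣V∣ G)

      restrict : Vec (Fin q) (∣V∣ G) → Vec (Fin q) classes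
      restrict κ = tabulate (lookup κ ∘ rep)

      extend : Vec (Fin q) classes → Vec (Fin q) (∣V∣ G)
      extend κ = tabulate (lookup κ ∘ class)

      -- A vertex and the representative of its class are connected within F, so a colouring
      -- monochromatic on F agrees on them.
      extend-restrict : ∀ κ → MonochromaticOn G κ F → extend (restrict κ) ≡ κ
      extend-restrict κ mono = trans
        (Vec.tabulate-cong λ x → trans (Vec.lookup∘tabulate (lookup κ ∘ rep) (class x))
                                       (connected-mono {κ = κ} mono (class-exact (class-rep (class x)))))
        (Vec.tabulate∘lookup κ)

      restrict-extend : ∀ κ → restrict (extend κ) ≡ κ
      restrict-extend κ = trans
        (Vec.tabulate-cong λ i → trans (Vec.lookup∘tabulate (lookup κ ∘ class) (rep i)) (cong (lookup κ) (class-rep i)))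
        (Vec.tabulate∘lookup κ)

      extend-mono : ∀ κ → MonochromaticOn G (extend κ) F
      extend-mono κ e e∈ = begin
        lookup (extend κ) (proj₁ (ends e)) ≡⟨ Vec.lookup∘tabulate (lookup κ ∘ class) (proj₁ (ends e)) ⟩
        lookup κ (class (proj₁ (ends e)))  ≡⟨ cong (lookup κ) (class-sound (∈-elements⁺ F e∈)) ⟩
        lookup κ (class (proj₂ (ends e)))  ≡⟨ Vec.lookup∘tabulate (lookup κ ∘ class) (proj₂ (ends e)) ⟨
        lookup (extend κ) (proj₂ (ends e)) ∎

  module _ {_≤_ : Rel (Edge G) ℓ} (isTotal : IsTotalOrder _≡_ _≤_) where

    -- A cycle inside F contains the broken circuit left by deleting its largest edge. That edge
    -- exists because a cycle has at least its edge at position 0.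
    face⇒acyclic : {F : Subset (∣E∣ G)} → IsFace G isTotal F → Acyclic (elements F)
    face⇒acyclic {F} face C cyc@(k , vs , es , _ , _ , _ , refl) C⊆ with maximum isTotal (_∈? C)
    ... | inj₁ none             = none (lookup es zero) (∈-entries⁺ es zero)
    ... | inj₂ (e , e∈ , e-max) =
      face (_ , (C , e , cyc , (e∈ , e-max) , refl) , λ x∈ → ∈-elements⁻ F (C⊆ _ (p─q⊆p C ⁅ e ⁆ x∈)))

    face⇒contraction : {F : Subset (∣E∣ G)} → IsFace G isTotal F → Contraction (elements F)
    face⇒contraction {F} face = contract (elements-unique F) (face⇒acyclic face)

-- Counting the proper colourings of a complete graph

falling : ℤ → ℕ → ℤ
falling x zero    = 1ℤ
falling x (suc n) = falling x n ℤ.* (x ℤ.- + n)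

-- With -1 and `x` as the two arguments of the form, its j-th linear factor is x - j. The factor `x`
-- in front belongs to j = 0.
falling≡homogeneous : ∀ x r → falling x (suc r) ≡ x ℤ.* homogeneous -1ℤ x (+_ ∘ elementary r) r
falling≡homogeneous x zero    = ring x
  where
  ring : ∀ x → 1ℤ ℤ.* (x ℤ.- 0ℤ) ≡ x ℤ.* 1ℤ
  ring = solve-∀
falling≡homogeneous x (suc r) = begin
  falling x (suc r) ℤ.* (x ℤ.- + suc r)     ≡⟨ cong (ℤ._* (x ℤ.- + suc r)) (falling≡homogeneous x r) ⟩
  x ℤ.* H ℤ.* (x ℤ.- + suc r)               ≡⟨ ring x H (+ suc r) ⟩
  x ℤ.* ((x ℤ.+ + suc r ℤ.* -1ℤ) ℤ.* H)
    ≡⟨ cong (x ℤ.*_) (homogeneous-elementary -1ℤ x +_ refl ℤ.pos-+ ℤ.pos-* r) ⟨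
  x ℤ.* homogeneous -1ℤ x (+_ ∘ elementary (suc r)) (suc r) ∎
  where
  open ≡-Reasoning
  H = homogeneous -1ℤ x (+_ ∘ elementary r) r
  ring : ∀ x h s → x ℤ.* h ℤ.* (x ℤ.- s) ≡ x ℤ.* ((x ℤ.+ s ℤ.* -1ℤ) ℤ.* h)
  ring = solve-∀

module _ {n q : ℕ} where

  avoids? : (κ : Vec (Fin q) n) (x : Fin q) → Dec (∀ i → lookup κ i ≢ x)
  avoids? κ x = Fin.all? λ i → ¬? (lookup κ i Fin.≟ x)

∷-injective⁻ : {x : A} {xs : Vec A n} → Injective _≡_ _≡_ (lookup (x ∷ xs)) →
  (∀ i → lookup xs i ≢ x) × Injective _≡_ _≡_ (lookup xs)
∷-injective⁻ inj = (λ i eq → contradiction (inj {suc i} {zero} eq) λ ()) , λ eq → Fin.suc-injective (inj eq)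

∑-avoids : (κ : Vec (Fin q) n) → Injective _≡_ _≡_ (lookup κ) →
  ∑ (allFin q) (λ x → ind (avoids? κ x)) ≡ + q ℤ.- + n
∑-avoids {q} [] _ = begin
  ∑ (allFin q) (λ x → ind (avoids? [] x)) ≡⟨ ∑-cong (allFin q) (λ {x} _ → ind-yes (avoids? [] x) λ ()) ⟩
  ∑ (allFin q) (λ _ → 1ℤ)                 ≡⟨ ∑-const (allFin q) 1ℤ ⟩
  + length (allFin q) ℤ.* 1ℤ              ≡⟨ ℤ.*-identityʳ _ ⟩
  + length (allFin q)                     ≡⟨ cong +_ (length-allFin q) ⟩
  + q                                     ≡⟨ ℤ.+-identityʳ (+ q) ⟨
  + q ℤ.- 0ℤ                              ∎
  where open ≡-Reasoning
∑-avoids {q} {suc n} (y ∷ κ) inj with y∉ , inj′ ← ∷-injective⁻ {x = y} {κ} inj = begin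
  ∑ (allFin q) (λ x → ind (avoids? (y ∷ κ) x)) ≡⟨ ∑-cong (allFin q) (λ {x} _ → split (y Fin.≟ x)) ⟩
  ∑ (allFin q) (λ x → ind (avoids? κ x) ℤ.+ ℤ.- (ind (y Fin.≟ x) ℤ.* 1ℤ))
    ≡⟨ trans (∑-+ (allFin q) (λ x → ind (avoids? κ x)) _)
         (cong (ℤ._+_ (∑ (allFin q) (λ x → ind (avoids? κ x))))
               (∑-neg (allFin q) (λ x → ind (y Fin.≟ x) ℤ.* 1ℤ))) ⟩
  ∑ (allFin q) (λ x → ind (avoids? κ x)) ℤ.- ∑ (allFin q) (λ x → ind (y Fin.≟ x) ℤ.* 1ℤ)
    ≡⟨ cong₂ ℤ._-_ (∑-avoids κ inj′) (∑-δ Fin._≟_ (λ _ → 1ℤ) (Unique.allFin⁺ q) (∈-allFin y)) ⟩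
  + q ℤ.- + n ℤ.- 1ℤ                           ≡⟨ ring (+ q) (+ n) ⟩
  + q ℤ.- (1ℤ ℤ.+ + n)                         ∎
  where
  open ≡-Reasoning
  ring : ∀ q n → q ℤ.- n ℤ.- 1ℤ ≡ q ℤ.- (1ℤ ℤ.+ n)
  ring = solve-∀

  -- Prepending `y` forbids one more colour. At `x` = `y` the right-hand side is 1 - 1, because
  -- injectivity makes `y` avoid `κ`.
  split : ∀ {x} (y≟x : Dec (y ≡ x)) →
    ind (avoids? (y ∷ κ) x) ≡ ind (avoids? κ x) ℤ.+ ℤ.- (ind y≟x ℤ.* 1ℤ)
  split (yes refl)   = trans (ind-no (avoids? (y ∷ κ) y) (λ av → av zero refl))
                             (sym (cong (ℤ._+ -1ℤ) (ind-yes (avoids? κ y) y∉)))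
  split {x} (no y≢x) = trans (ind-cong (avoids? (y ∷ κ) x) (avoids? κ x) (λ av i → av (suc i))
                               (λ { av zero → y≢x ; av (suc i) → av i }))
                             (sym (ℤ.+-identityʳ _))

∑-injective : ∀ q n → ∑ (allVecs (allFin q) n) (λ κ → ind (injective? (lookup κ))) ≡ falling (+ q) n
∑-injective q zero    = trans (ℤ.+-identityʳ _) (ind-yes (injective? {n = q} (lookup [])) λ { {()} })
∑-injective q (suc n) = begin
  ∑ (allVecs (allFin q) (suc n)) (λ κ → ind (injective? (lookup κ)))
    ≡⟨ ∑-cartesianProductWith _∷_ (allFin q) κs _ ⟩
  ∑ (allFin q) (λ x → ∑ κs (λ κ → ind (injective? (lookup (x ∷ κ)))))
    ≡⟨ ∑-swap (allFin q) κs (λ x κ → ind (injective? (lookup (x ∷ κ)))) ⟩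
  ∑ κs (λ κ → ∑ (allFin q) (λ x → ind (injective? (lookup (x ∷ κ)))))
    ≡⟨ ∑-cong κs (λ {κ} _ → trans (∑-cong (allFin q) λ {x} _ → split x κ)
         (∑-*ˡ (allFin q) (ind (injective? (lookup κ))) (λ x → ind (avoids? κ x)))) ⟩
  ∑ κs (λ κ → ind (injective? (lookup κ)) ℤ.* ∑ (allFin q) (λ x → ind (avoids? κ x)))
    -- The number of free colours is known for injective `κ` only; for the others the indicator in
    -- front kills the term.
    ≡⟨ ∑-cong κs (λ {κ} _ → ind-*-cong (injective? (lookup κ)) (∑-avoids κ)) ⟩
  ∑ κs (λ κ → ind (injective? (lookup κ)) ℤ.* (+ q ℤ.- + n))
    ≡⟨ ∑-*ʳ κs (+ q ℤ.- + n) (λ κ → ind (injective? (lookup κ))) ⟩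
  ∑ κs (λ κ → ind (injective? (lookup κ))) ℤ.* (+ q ℤ.- + n)
    ≡⟨ cong (ℤ._* (+ q ℤ.- + n)) (∑-injective q n) ⟩
  falling (+ q) n ℤ.* (+ q ℤ.- + n) ∎
  where
  open ≡-Reasoning
  κs = allVecs (allFin q) n

  split : ∀ x κ → ind (injective? (lookup (x ∷ κ))) ≡ ind (injective? (lookup κ)) ℤ.* ind (avoids? κ x)
  split x κ = trans
    (ind-cong (injective? (lookup (x ∷ κ))) (injective? (lookup κ) ×-dec avoids? κ x)
      (λ inj → let x∉ , inj′ = ∷-injective⁻ {x = x} {κ} inj in inj′ , x∉)
      (λ (inj′ , x∉) → lookup-∷-injective x∉ inj′))
    (ind-× (injective? (lookup κ)) (avoids? κ x))

-- Comparing coefficients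

-1^n≢0 : ∀ n → -1ℤ Hℤ.^ n ≢ 0ℤ
-1^n≢0 (suc n) eq = Sum.[ (λ ()) , -1^n≢0 n ]′ (ℤ.i*j≡0⇒i≡0∨j≡0 -1ℤ eq)

-- The equation makes `c` a multiple of `q`, and 0 is the only one of absolute value below `q`.
small-multiple≡0 : ∀ q b c → + q ℤ.* b ℤ.+ c ≡ 0ℤ → ℤ.∣ c ∣ ℕ.< q → c ≡ 0ℤ
small-multiple≡0 q b c eq ∣c∣<q = ℤ.∣i∣≡0⇒i≡0 (vanishes ℤ.∣ b ∣ ∣c∣≡)
  where
  open ≡-Reasoning
  ring : ∀ u c → c ≡ (u ℤ.+ c) ℤ.- u
  ring = solve-∀

  ∣c∣≡ : ℤ.∣ c ∣ ≡ q ℕ.* ℤ.∣ b ∣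
  ∣c∣≡ = begin
    ℤ.∣ c ∣                                         ≡⟨ cong ℤ.∣_∣ (ring (+ q ℤ.* b) c) ⟩
    ℤ.∣ (+ q ℤ.* b ℤ.+ c) ℤ.- + q ℤ.* b ∣           ≡⟨ cong (λ t → ℤ.∣ t ℤ.- + q ℤ.* b ∣) eq ⟩
    ℤ.∣ 0ℤ ℤ.- + q ℤ.* b ∣                          ≡⟨ cong ℤ.∣_∣ (ℤ.+-identityˡ (ℤ.- (+ q ℤ.* b))) ⟩
    ℤ.∣ ℤ.- (+ q ℤ.* b) ∣                           ≡⟨ ℤ.∣-i∣≡∣i∣ (+ q ℤ.* b) ⟩
    ℤ.∣ + q ℤ.* b ∣                                 ≡⟨ ℤ.abs-* (+ q) b ⟩
    q ℕ.* ℤ.∣ b ∣                                   ∎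

  vanishes : ∀ k → ℤ.∣ c ∣ ≡ q ℕ.* k → ℤ.∣ c ∣ ≡ 0
  vanishes zero    eq = trans eq (ℕ.*-zeroʳ q)
  vanishes (suc k) eq = contradiction (subst (q ℕ.≤_) (sym eq) (ℕ.m≤m*n q (suc k))) (ℕ.<⇒≱ ∣c∣<q)

-- The value at q is q times the form of lower degree plus a term `c` free of q. A single large q
-- shows that `c` is 0; then q cancels and the lower form vanishes at the same integers.
homogeneous-vanishes : ∀ (a : ℕ → ℤ) r N → (∀ q → N ℕ.< q → homogeneous -1ℤ (+ q) a r ≡ 0ℤ) →
  ∀ i → i ℕ.≤ r → a i ≡ 0ℤ
homogeneous-vanishes a zero    N eq zero _ = eq (suc N) ℕ.≤-refl
homogeneous-vanishes a (suc r) N eq i i≤ = Sum.[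
    (λ i<1+r → homogeneous-vanishes a r N rest i (ℕ.s≤s⁻¹ i<1+r)) ,
    (λ i≡1+r → subst (λ i → a i ≡ 0ℤ) (sym i≡1+r) top)
  ]′ (ℕ.m≤n⇒m<n∨m≡n i≤)
  where
  open ≡-Reasoning
  c = a (suc r) ℤ.* -1ℤ Hℤ.^ suc r
  H : ℕ → ℤ
  H q = homogeneous -1ℤ (+ q) a r

  c≡0 : c ≡ 0ℤ
  -- This q exceeds both `N`, as the hypothesis requires, and the absolute value of `c`.
  c≡0 = small-multiple≡0 (suc (N ℕ.+ ℤ.∣ c ∣)) (H (suc (N ℕ.+ ℤ.∣ c ∣))) c (eq _ (s≤s (ℕ.m≤m+n N _))) (s≤s (ℕ.m≤n+m _ N))

  top : a (suc r) ≡ 0ℤ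
  top = Sum.[ id , (λ s≡0 → contradiction s≡0 (-1^n≢0 (suc r))) ]′ (ℤ.i*j≡0⇒i≡0∨j≡0 (a (suc r)) c≡0)

  rest : ∀ q → N ℕ.< q → H q ≡ 0ℤ
  rest q N<q = Sum.[ (λ q≡0 → contradiction (ℤ.+-injective q≡0) (ℕ.m<n⇒n≢0 N<q)) , id ]′
    (ℤ.i*j≡0⇒i≡0∨j≡0 (+ q) (begin
      + q ℤ.* H q         ≡⟨ ℤ.+-identityʳ _ ⟨
      + q ℤ.* H q ℤ.+ 0ℤ  ≡⟨ cong (ℤ._+_ (+ q ℤ.* H q)) c≡0 ⟨
      + q ℤ.* H q ℤ.+ c   ≡⟨ eq q N<q ⟩
      0ℤ                  ∎))

homogeneous-injective : ∀ (a b : ℕ → ℤ) r →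
  (∀ q → homogeneous -1ℤ (+ suc q) a r ≡ homogeneous -1ℤ (+ suc q) b r) →
  ∀ i → i ℕ.≤ r → a i ≡ b i
homogeneous-injective a b r eq i i≤r = ℤ.i-j≡0⇒i≡j (a i) (b i)
  (homogeneous-vanishes (λ i → a i ℤ.- b i) r 0 difference i i≤r)
  where
  open ≡-Reasoning
  difference : ∀ q → 0 ℕ.< q → homogeneous -1ℤ (+ q) (λ i → a i ℤ.- b i) r ≡ 0ℤ
  difference (suc q) _ = begin
    H (λ i → a i ℤ.- b i)            ≡⟨ ring (H (λ i → a i ℤ.- b i)) (H b) ⟩
    H (λ i → a i ℤ.- b i) ℤ.+ H b ℤ.- H b
      ≡⟨ cong (ℤ._- H b) (homogeneous-+ -1ℤ (+ suc q) (λ i → a i ℤ.- b i) b r) ⟨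
    H (λ i → a i ℤ.- b i ℤ.+ b i) ℤ.- H b
      ≡⟨ cong (ℤ._- H b) (homogeneous-cong -1ℤ (+ suc q) r (λ i _ → sym (ring′ (a i) (b i)))) ⟩
    H a ℤ.- H b                      ≡⟨ ℤ.i≡j⇒i-j≡0 (eq q) ⟩
    0ℤ                               ∎
    where
    H : (ℕ → ℤ) → ℤ
    H a = homogeneous -1ℤ (+ suc q) a r
    ring : ∀ u v → u ≡ u ℤ.+ v ℤ.- v
    ring = solve-∀
    ring′ : ∀ u v → u ≡ u ℤ.- v ℤ.+ v
    ring′ = solve-∀

-- Face numbers of the complete graph

faceCount≡∑ : (G : Graph) {_≤_ : Rel (Edge G) ℓ} (isTotal : IsTotalOrder _≡_ _≤_) → ∀ i →
  + faceCount G isTotal i ≡ ∑ (faces G isTotal) (λ F → ind (∣ F ∣ ℕ.≟ i))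
faceCount≡∑ G isTotal i = begin
  + faceCount G isTotal i
    ≡⟨ count≡∑ (λ F → isFace? G isTotal F ×-dec (∣ F ∣ ℕ.≟ i)) (allSubsets (∣E∣ G)) ⟩
  ∑ (allSubsets (∣E∣ G)) (λ F → ind (isFace? G isTotal F ×-dec (∣ F ∣ ℕ.≟ i)))
    ≡⟨ ∑-cong (allSubsets (∣E∣ G)) (λ {F} _ → ind-× (isFace? G isTotal F) (∣ F ∣ ℕ.≟ i)) ⟩
  ∑ (allSubsets (∣E∣ G)) (λ F → ind (isFace? G isTotal F) ℤ.* ind (∣ F ∣ ℕ.≟ i))
    ≡⟨ ∑-filter (isFace? G isTotal) (allSubsets (∣E∣ G)) (λ F → ind (∣ F ∣ ℕ.≟ i)) ⟨
  ∑ (faces G isTotal) (λ F → ind (∣ F ∣ ℕ.≟ i)) ∎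
  where open ≡-Reasoning

module _ {r : ℕ} {_≤_ : Rel (Edge (K (suc r))) ℓ} (isTotal : IsTotalOrder _≡_ _≤_) where

  private
    G = K (suc r)

  ∈-faces⁻ : {F : Subset (∣E∣ G)} → F ∈ faces G isTotal → IsFace G isTotal F
  ∈-faces⁻ F∈ = proj₂ (∈-filter⁻ (isFace? G isTotal) {xs = allSubsets (∣E∣ G)} F∈)

  private
    -- There is a vertex, hence at least one class. Splitting it off bounds the size of a face by
    -- `r` and isolates the factor q that is cancelled in the comparison with the falling factorial.
    classes≡ : (F : Subset (∣E∣ G)) (c : Contraction G (elements F)) →
      ∃ λ m → Contraction.classes c ≡ suc m × m ℕ.+ ∣ F ∣ ≡ r
    classes≡ F record { classes = zero ; class = class } with () ← class zero
    classes≡ F record { classes = suc m ; classes+ = classes+ } =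
      m , refl , trans (cong (m ℕ.+_) (sym (length-elements F))) (ℕ.suc-injective classes+)

  face-size : {F : Subset (∣E∣ G)} → IsFace G isTotal F → ∣ F ∣ ℕ.≤ r
  face-size {F} face = let m , _ , m+∣F∣≡r = classes≡ F (face⇒contraction G isTotal {F} face) in
    subst (∣ F ∣ ℕ.≤_) m+∣F∣≡r (ℕ.m≤n+m ∣ F ∣ m)

  face-colourings : {F : Subset (∣E∣ G)} → IsFace G isTotal F → ∀ q →
    ∑ (allVecs (allFin q) (suc r)) (λ κ → ind (monochromaticOn? G κ F)) ≡ + q ℤ.* (+ q) Hℤ.^ (r ℕ.∸ ∣ F ∣)
  face-colourings {F} face q = begin
    ∑ (allVecs (allFin q) (suc r)) (λ κ → ind (monochromaticOn? G κ F)) ≡⟨ ∑-monochromaticOn G c q ⟩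
    (+ q) Hℤ.^ Contraction.classes c ≡⟨ cong ((+ q) Hℤ.^_) classes≡1+m ⟩
    + q ℤ.* (+ q) Hℤ.^ m′              ≡⟨ cong (λ t → + q ℤ.* (+ q) Hℤ.^ t) m≡ ⟩
    + q ℤ.* (+ q) Hℤ.^ (r ℕ.∸ ∣ F ∣)   ∎
    where
    open ≡-Reasoning
    c = face⇒contraction G isTotal {F} face
    m′ = proj₁ (classes≡ F c)
    classes≡1+m = proj₁ (proj₂ (classes≡ F c))

    m≡ : m′ ≡ r ℕ.∸ ∣ F ∣
    m≡ = trans (sym (ℕ.m+n∸n≡m m′ ∣ F ∣)) (cong (ℕ._∸ ∣ F ∣) (proj₂ (proj₂ (classes≡ F c))))

  proper⇒injective : (κ : Vec (Fin q) (suc r)) → Proper G κ → Injective _≡_ _≡_ (lookup κ)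
  proper⇒injective κ proper {u} {v} eq with Fin.<-cmp u v
  ... | tri≈ _ u≡v _ = u≡v
  ... | tri< u<v _ _ = let e , ends≡ = edge (suc r) u<v in
    contradiction (mono-joins G {κ = κ} (inj₁ ends≡) eq) (proper e)
  ... | tri> _ _ v<u = let e , ends≡ = edge (suc r) v<u in
    contradiction (mono-joins G {κ = κ} (inj₁ ends≡) (sym eq)) (proper e)

  injective⇒proper : (κ : Vec (Fin q) (suc r)) → Injective _≡_ _≡_ (lookup κ) → Proper G κ
  injective⇒proper κ inj e mono = Graph.loopless G e (inj mono)

  faceCount-K : ∀ i → i ℕ.≤ r → faceCount G isTotal i ≡ elementary r i
  faceCount-K i i≤r = ℤ.+-injective (trans (faceCount≡∑ G isTotal i) (homogeneous-injective b e r equal i i≤r))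
    where
    open ≡-Reasoning
    b e : ℕ → ℤ
    b i = ∑ (faces G isTotal) (λ F → ind (∣ F ∣ ℕ.≟ i))
    e i = + elementary r i

    equal′ : ∀ q → + q ℤ.* homogeneous -1ℤ (+ q) b r ≡ + q ℤ.* homogeneous -1ℤ (+ q) e r
    equal′ q = begin
      + q ℤ.* homogeneous -1ℤ (+ q) b r
        ≡⟨ cong (+ q ℤ.*_) (homogeneous-count -1ℤ (+ q) (faces G isTotal) ∣_∣ r (λ F∈ → face-size (∈-faces⁻ F∈))) ⟩
      + q ℤ.* ∑ (faces G isTotal) (λ F → -1ℤ Hℤ.^ ∣ F ∣ ℤ.* (+ q) Hℤ.^ (r ℕ.∸ ∣ F ∣))
        ≡⟨ ∑-*ˡ (faces G isTotal) (+ q) (λ F → -1ℤ Hℤ.^ ∣ F ∣ ℤ.* (+ q) Hℤ.^ (r ℕ.∸ ∣ F ∣)) ⟨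
      ∑ (faces G isTotal) (λ F → + q ℤ.* (-1ℤ Hℤ.^ ∣ F ∣ ℤ.* (+ q) Hℤ.^ (r ℕ.∸ ∣ F ∣)))
        ≡⟨ ∑-cong (faces G isTotal) (λ {F} F∈ → term (∈-faces⁻ F∈)) ⟩
      ∑ (faces G isTotal) (λ F → sgn F ℤ.* ∑ κs (λ κ → ind (monochromaticOn? G κ F)))
        ≡⟨ whitney G isTotal q ⟩
      ∑ κs (λ κ → ind (proper? G κ))
        ≡⟨ ∑-cong κs (λ {κ} _ → ind-cong (proper? G κ) (injective? (lookup κ)) (proper⇒injective κ) (injective⇒proper κ)) ⟩
      ∑ κs (λ κ → ind (injective? (lookup κ)))
        ≡⟨ ∑-injective q (suc r) ⟩
      falling (+ q) (suc r)
        ≡⟨ falling≡homogeneous (+ q) r ⟩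
      + q ℤ.* homogeneous -1ℤ (+ q) e r ∎
      where
      κs = allVecs (allFin q) (suc r)
      ring : ∀ x y z → x ℤ.* (y ℤ.* z) ≡ y ℤ.* (x ℤ.* z)
      ring = solve-∀

      term : {F : Subset (∣E∣ G)} → IsFace G isTotal F →
        + q ℤ.* (-1ℤ Hℤ.^ ∣ F ∣ ℤ.* (+ q) Hℤ.^ (r ℕ.∸ ∣ F ∣)) ≡ sgn F ℤ.* ∑ κs (λ κ → ind (monochromaticOn? G κ F))
      term {F} face = begin
        + q ℤ.* (-1ℤ Hℤ.^ ∣ F ∣ ℤ.* (+ q) Hℤ.^ (r ℕ.∸ ∣ F ∣)) ≡⟨ ring (+ q) (-1ℤ Hℤ.^ ∣ F ∣) ((+ q) Hℤ.^ (r ℕ.∸ ∣ F ∣)) ⟩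
        -1ℤ Hℤ.^ ∣ F ∣ ℤ.* (+ q ℤ.* (+ q) Hℤ.^ (r ℕ.∸ ∣ F ∣))
          ≡⟨ cong (sgn F ℤ.*_) (sym (face-colourings face q)) ⟩
        sgn F ℤ.* ∑ κs (λ κ → ind (monochromaticOn? G κ F)) ∎

    -- Both sides of `equal′` carry a factor q, so it is used at positive q, where this factor
    -- cancels.
    equal : ∀ q → homogeneous -1ℤ (+ suc q) b r ≡ homogeneous -1ℤ (+ suc q) e r
    equal q = ℤ.*-cancelˡ-≡ (+ suc q) _ _ (equal′ (suc q))

-- Stirling numbers

module _ {A : Set α} (_≟_ : DecidableEquality A) where

  length-filter-≢ : {x : A} {xs : List A} → Unique xs → x ∈ xs → suc (length (filter (¬? ∘ (x ≟_)) xs)) ≡ length xs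
  length-filter-≢ {x} {_ ∷ xs} (x∉ ∷ _) (here refl) = cong (suc ∘ length)
    (trans (List.filter-reject (¬? ∘ (x ≟_)) (λ x≢x → x≢x refl)) (List.filter-all (¬? ∘ (x ≟_)) x∉))
  length-filter-≢ {x} {y ∷ xs} (y∉ ∷ unique) (there x∈) = trans
    (cong (suc ∘ length) (List.filter-accept (¬? ∘ (x ≟_)) {xs = xs} (λ x≡y → All.lookup y∉ x∈ (sym x≡y))))
    (cong suc (length-filter-≢ unique x∈))

  -- `deduplicate` keeps the head and filters its copies out of the deduplicated tail. There is
  -- exactly one such copy, so one is gained and one lost.
  length-deduplicate-∈ : {x : A} {xs : List A} → x ∈ xs →
    length (deduplicate _≟_ (x ∷ xs)) ≡ length (deduplicate _≟_ xs)
  length-deduplicate-∈ {xs = xs} x∈ =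
    length-filter-≢ (DecUnique.deduplicate-! _≟_ xs) (∈-deduplicate⁺ _≟_ x∈)

  length-deduplicate-∉ : {x : A} {xs : List A} → x ∉ xs →
    length (deduplicate _≟_ (x ∷ xs)) ≡ suc (length (deduplicate _≟_ xs))
  length-deduplicate-∉ {x} {xs} x∉ = cong (suc ∘ length) (List.filter-all (¬? ∘ (x ≟_))
    (All.tabulate λ y∈ x≡y → x∉ (subst (_∈ xs) (sym x≡y) (∈-deduplicate⁻ _≟_ xs y∈))))

  distinct : (Fin n → A) → ℕ
  distinct f = length (deduplicate _≟_ (List.tabulate f))

  distinct-old : (f : Fin (suc n) → A) (j : Fin n) → f zero ≡ f (suc j) → distinct f ≡ distinct (f ∘ suc)
  distinct-old f j eq =
    length-deduplicate-∈ (subst (_∈ List.tabulate (f ∘ suc)) (sym eq) (∈-tabulate⁺ {f = f ∘ suc} j))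

  distinct-new : (f : Fin (suc n) → A) → (∀ j → f zero ≢ f (suc j)) → distinct f ≡ suc (distinct (f ∘ suc))
  distinct-new f ≢ = length-deduplicate-∉ λ f0∈ → let j , eq = ∈-tabulate⁻ {f = f ∘ suc} f0∈ in ≢ j eq

module _ {A : Set α} {B : Set β} (_≟ᴬ_ : DecidableEquality A) (_≟ᴮ_ : DecidableEquality B) where

  -- The number of values depends only on which arguments share a value. This permits comparing
  -- cycles of permutations of different sets, which are subsets of different types.
  distinct-cong : (f : Fin n → A) (g : Fin n → B) →
    (∀ i j → f i ≡ f j → g i ≡ g j) → (∀ i j → g i ≡ g j → f i ≡ f j) → distinct _≟ᴬ_ f ≡ distinct _≟ᴮ_ g
  distinct-cong {zero}  f g to from = refl
  distinct-cong {suc n} f g to from with Fin.any? (λ j → f zero ≟ᴬ f (suc j))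
  ... | yes (j , eq) = begin
    distinct _≟ᴬ_ f         ≡⟨ distinct-old _≟ᴬ_ f j eq ⟩
    distinct _≟ᴬ_ (f ∘ suc) ≡⟨ distinct-cong (f ∘ suc) (g ∘ suc) (λ i j → to _ _) (λ i j → from _ _) ⟩
    distinct _≟ᴮ_ (g ∘ suc) ≡⟨ distinct-old _≟ᴮ_ g j (to _ _ eq) ⟨
    distinct _≟ᴮ_ g         ∎
    where open ≡-Reasoning
  ... | no ∄j = begin
    distinct _≟ᴬ_ f               ≡⟨ distinct-new _≟ᴬ_ f (λ j eq → ∄j (j , eq)) ⟩
    suc (distinct _≟ᴬ_ (f ∘ suc)) ≡⟨ cong suc (distinct-cong (f ∘ suc) (g ∘ suc) (λ i j → to _ _) (λ i j → from _ _)) ⟩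
    suc (distinct _≟ᴮ_ (g ∘ suc)) ≡⟨ distinct-new _≟ᴮ_ g (λ j eq → ∄j (j , from _ _ eq)) ⟨
    distinct _≟ᴮ_ g               ∎
    where open ≡-Reasoning

_≟ˢ_ : DecidableEquality (Subset n)
_≟ˢ_ = Vec.≡-dec Bool._≟_

cycleCount≡distinct : (π : Vec (Fin n) n) → cycleCount π ≡ distinct _≟ˢ_ (cycleThrough π)
cycleCount≡distinct π = cong (length ∘ deduplicate _≟ˢ_) (List.map-tabulate id (cycleThrough π))

Reaches : (A → A) → Rel A _
Reaches f = Star (λ x y → f x ≡ y)

iterate-suc : (f : A → A) (x : A) (k : ℕ) → iterate f x (suc k) ≡ f (iterate f x k)
iterate-suc f x zero    = refl
iterate-suc f x (suc k) = iterate-suc f (f x) k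

iterate-+ : (f : A → A) (x : A) (k l : ℕ) → iterate f x (k ℕ.+ l) ≡ iterate f (iterate f x k) l
iterate-+ f x zero    l = refl
iterate-+ f x (suc k) l = iterate-+ f (f x) k l

lookup-iterate : (f : A → A) (x : A) (i : Fin n) → lookup (Vec.iterate f x n) i ≡ iterate f x (toℕ i)
lookup-iterate f x zero    = refl
lookup-iterate f x (suc i) = lookup-iterate f (f x) i

reaches-iterate : (f : A → A) (x : A) (k : ℕ) → Reaches f x (iterate f x k)
reaches-iterate f x zero    = ε
reaches-iterate f x (suc k) = refl ◅ reaches-iterate f (f x) k

module _ (f : Fin n → Fin n) where

  iterate-repeats : ∀ x → ∃ λ i → ∃ λ j → i ℕ.< j × j ℕ.≤ n × iterate f x i ≡ iterate f x j
  iterate-repeats x = let i , j , i<j , eq = Fin.pigeonhole ℕ.≤-refl (λ (i : Fin (suc n)) → iterate f x (toℕ i)) in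
    toℕ i , toℕ j , i<j , Fin.toℕ≤pred[n] j , eq

  -- `cycleThrough` lists just the first `n` iterates. They are closed under `f`, because the `n`-th
  -- iterate is again one of them.
  reaches⇒iterate : ∀ {x y} → Reaches f x y → ∃ λ k → k ℕ.< n × iterate f x k ≡ y
  reaches⇒iterate {x} = closed (0 , ℕ.≤-trans (s≤s z≤n) (Fin.toℕ<n x) , refl)
    where
    -- Of the iterates with exponents 0, ..., `n` two agree, at i < j say. Applying the remaining n
    -- - j steps to both brings the `n`-th iterate back to exponent i + (n - j).
    wrap : ∃ λ k → k ℕ.< n × iterate f x k ≡ iterate f x n
    wrap with i , j , i<j , j≤n , eq ← iterate-repeats x =
      i ℕ.+ (n ℕ.∸ j) ,
      subst (i ℕ.+ (n ℕ.∸ j) ℕ.<_) (ℕ.m+[n∸m]≡n j≤n) (ℕ.+-monoˡ-< (n ℕ.∸ j) i<j) ,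
      (begin
        iterate f x (i ℕ.+ (n ℕ.∸ j))         ≡⟨ iterate-+ f x i (n ℕ.∸ j) ⟩
        iterate f (iterate f x i) (n ℕ.∸ j)   ≡⟨ cong (λ y → iterate f y (n ℕ.∸ j)) eq ⟩
        iterate f (iterate f x j) (n ℕ.∸ j)   ≡⟨ iterate-+ f x j (n ℕ.∸ j) ⟨
        iterate f x (j ℕ.+ (n ℕ.∸ j))         ≡⟨ cong (iterate f x) (ℕ.m+[n∸m]≡n j≤n) ⟩
        iterate f x n                         ∎)
      where open ≡-Reasoning

    closed : ∀ {y z} → (∃ λ k → k ℕ.< n × iterate f x k ≡ y) → Reaches f y z → ∃ λ k → k ℕ.< n × iterate f x k ≡ z
    closed y∈ ε = y∈
    closed (k , k<n , refl) (refl ◅ walk) with ℕ.m≤n⇒m<n∨m≡n k<n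
    ... | inj₁ 1+k<n = closed (suc k , 1+k<n , iterate-suc f x k) walk
    ... | inj₂ refl  = let i , i<n , eq = wrap in closed (i , i<n , trans eq (iterate-suc f x k)) walk

  module _ (f-injective : Injective _≡_ _≡_ f) where

    iterate-cancel : ∀ x i d → iterate f x i ≡ iterate f x (i ℕ.+ d) → x ≡ iterate f x d
    iterate-cancel x zero    d eq = eq
    iterate-cancel x (suc i) d eq = iterate-cancel x i d
      (f-injective (trans (sym (iterate-suc f x i)) (trans eq (iterate-suc f x (i ℕ.+ d)))))

    reaches-back : ∀ x → Reaches f (f x) x
    reaches-back x with i , j , i<j , _ , eq ← iterate-repeats x = 
      subst (Reaches f (f x)) (sym (iterate-cancel x i (suc e) (trans eq (cong (iterate f x) (sym i+1+e≡j)))))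
            (reaches-iterate f (f x) e)
      where
      -- Cancelling the first `i` steps shows that `x` returns to itself after j - i = e + 1 steps,
      -- one of which has already led to `f x`.
      e = j ℕ.∸ suc i
      i+1+e≡j : i ℕ.+ suc e ≡ j
      i+1+e≡j = trans (ℕ.+-suc i e) (ℕ.m+[n∸m]≡n i<j)

    reaches-sym : ∀ {x y} → Reaches f x y → Reaches f y x
    reaches-sym ε                  = ε
    reaches-sym {x} (refl ◅ walk) = reaches-sym walk ◅◅ reaches-back x

module _ (π : Vec (Fin n) n) where

  ∈-cycleThrough⁺ : ∀ {x y} → Reaches (lookup π) x y → y Subset.∈ cycleThrough π x
  ∈-cycleThrough⁺ {x} walk with k , k<n , refl ← reaches⇒iterate (lookup π) walk =
    subst (Subset._∈ cycleThrough π x)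
      (trans (lookup-iterate (lookup π) x (fromℕ< k<n)) (cong (iterate (lookup π) x) (Fin.toℕ-fromℕ< k<n)))
      (∈-entries⁺ (Vec.iterate (lookup π) x n) (fromℕ< k<n))

  ∈-cycleThrough⁻ : ∀ {x y} → y Subset.∈ cycleThrough π x → Reaches (lookup π) x y
  ∈-cycleThrough⁻ {x} y∈ with i , refl ← ∈-entries⁻ (Vec.iterate (lookup π) x n) y∈ =
    subst (Reaches (lookup π) x) (sym (lookup-iterate (lookup π) x i)) (reaches-iterate (lookup π) x (toℕ i))

  cycleThrough-≡⁻ : ∀ {x y} → cycleThrough π x ≡ cycleThrough π y → Reaches (lookup π) x y
  cycleThrough-≡⁻ {x} {y} eq = ∈-cycleThrough⁻ (subst (y Subset.∈_) (sym eq) (∈-cycleThrough⁺ ε))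

  cycleThrough-≡⁺ : IsPermutation π → ∀ {x y} → Reaches (lookup π) x y → cycleThrough π x ≡ cycleThrough π y
  cycleThrough-≡⁺ perm walk = Subset.⊆-antisym
    (λ z∈ → ∈-cycleThrough⁺ (reaches-sym (lookup π) perm walk ◅◅ ∈-cycleThrough⁻ z∈))
    (λ z∈ → ∈-cycleThrough⁺ (walk ◅◅ ∈-cycleThrough⁻ z∈))

-- How inserting the point 0 changes a value of the old permutation: an arrow into `p` now ends at
-- 0, and every other arrow keeps its target, shifted by `suc`. For `p` = 0 it is `suc` throughout.
redirect : Fin (suc n) → Fin n → Fin (suc n)
redirect p y with suc y Fin.≟ p
... | yes _ = zero
... | no _  = suc y

redirect-≡ : ∀ {p : Fin (suc n)} {y} → suc y ≡ p → redirect p y ≡ zero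
redirect-≡ {p = p} {y} eq with suc y Fin.≟ p
... | yes _  = refl
... | no ≢p  = contradiction eq ≢p

redirect-≢ : ∀ {p : Fin (suc n)} {y} → suc y ≢ p → redirect p y ≡ suc y
redirect-≢ {p = p} {y} ≢p with suc y Fin.≟ p
... | yes eq = contradiction eq ≢p
... | no _   = refl

redirect-avoids : ∀ (p : Fin (suc n)) y → redirect p y ≢ p
redirect-avoids p y with suc y Fin.≟ p
... | yes refl = λ ()
... | no ≢p    = ≢p

-- Inverse to redirect p on Fin (suc n) ∖ {p}; the value at p is irrelevant.
unredirect : Fin (suc n) → Fin n → Fin (suc n) → Fin n
unredirect p       x (suc y) = y
unredirect zero    x zero    = x
unredirect (suc j) x zero    = j

redirect-unredirect : ∀ (p : Fin (suc n)) x y → y ≢ p → redirect p (unredirect p x y) ≡ y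
redirect-unredirect p       x (suc y) y≢p = redirect-≢ y≢p
redirect-unredirect zero    x zero    y≢p = contradiction refl y≢p
redirect-unredirect (suc j) x zero    y≢p = redirect-≡ refl

unredirect-redirect : ∀ (p : Fin (suc n)) x y → unredirect p x (redirect p y) ≡ y
unredirect-redirect p x y with suc y Fin.≟ p
... | yes refl = refl
... | no _     = refl

-- The point 0 is put just before p in the cycle of p, or becomes a fixed point if p = 0.
insert : Fin (suc n) → Vec (Fin n) n → Vec (Fin (suc n)) (suc n)
insert p π = p ∷ Vec.map (redirect p) π

remove : Vec (Fin (suc n)) (suc n) → Vec (Fin n) n
remove (p ∷ σ) = tabulate λ x → unredirect p x (lookup σ x)

insert-permutation : ∀ p {π : Vec (Fin n) n} → IsPermutation π → IsPermutation (insert p π)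
insert-permutation p {π} perm = lookup-∷-injective
  (λ i eq → redirect-avoids p (lookup π i) (trans (sym (Vec.lookup-map i (redirect p) π)) eq))
  (λ {i} {j} eq → perm (begin
    lookup π i                                     ≡⟨ unredirect-redirect p i (lookup π i) ⟨
    unredirect p i (redirect p (lookup π i))       ≡⟨ cong (unredirect p i) (Vec.lookup-map i (redirect p) π) ⟨
    unredirect p i (lookup (Vec.map (redirect p) π) i) ≡⟨ cong (unredirect p i) eq ⟩
    unredirect p i (lookup (Vec.map (redirect p) π) j) ≡⟨ cong (unredirect p i) (Vec.lookup-map j (redirect p) π) ⟩
    unredirect p i (redirect p (lookup π j))       ≡⟨ unredirect-redirect p i (lookup π j) ⟩
    lookup π j                                     ∎))
  where open ≡-Reasoning

remove-insert : ∀ p (π : Vec (Fin n) n) → remove (insert p π) ≡ π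
remove-insert p π = trans
  (Vec.tabulate-cong λ x → trans (cong (unredirect p x) (Vec.lookup-map x (redirect p) π)) (unredirect-redirect p x (lookup π x)))
  (Vec.tabulate∘lookup π)

module _ (p : Fin (suc n)) (σ : Vec (Fin (suc n)) n) (perm : IsPermutation (p ∷ σ)) where

  private
    restored : ∀ x → redirect p (lookup (remove (p ∷ σ)) x) ≡ lookup σ x
    restored x = trans (cong (redirect p) (Vec.lookup∘tabulate (λ x → unredirect p x (lookup σ x)) x))
      (redirect-unredirect p x (lookup σ x) (proj₁ (∷-injective⁻ {x = p} {σ} perm) x))

  insert-remove : insert p (remove (p ∷ σ)) ≡ p ∷ σ
  insert-remove = cong (p ∷_) (trans (sym (Vec.tabulate∘lookup _)) (trans
    (Vec.tabulate-cong λ x → trans (Vec.lookup-map x (redirect p) (remove (p ∷ σ))) (restored x))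
    (Vec.tabulate∘lookup σ)))

  remove-permutation : IsPermutation (remove (p ∷ σ))
  remove-permutation {i} {j} eq = proj₂ (∷-injective⁻ {x = p} {σ} perm)
    (trans (sym (restored i)) (trans (cong (redirect p) eq) (restored j)))

module _ {p : Fin (suc n)} {π : Vec (Fin n) n} where

  private
    f = lookup (insert p π)
    g = lookup π

    f-suc : ∀ x → f (suc x) ≡ redirect p (g x)
    f-suc x = Vec.lookup-map x (redirect p) π

  reaches-insert⁺ : ∀ {x y} → Reaches g x y → Reaches f (suc x) (suc y)
  reaches-insert⁺ ε = ε
  reaches-insert⁺ {x} (refl ◅ walk) with suc (g x) Fin.≟ p
  ... | yes eq = trans (f-suc x) (redirect-≡ eq) ◅ sym eq ◅ reaches-insert⁺ walk
  ... | no ≢p  = trans (f-suc x) (redirect-≢ ≢p) ◅ reaches-insert⁺ walk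

  reaches-insert⁻ : ∀ {x y} → Reaches f (suc x) (suc y) → Reaches g x y
  reaches-insert⁻ walk = proj₁ (go walk) _ refl
    where
    -- The walk may pass through 0, so walks starting there are treated along with the others. In
    -- that second statement `x` is the old point named by `p`, at which the next step arrives.
    go : ∀ {u y} → Reaches f u (suc y) →
      (∀ x → u ≡ suc x → Reaches g x y) × (∀ x → u ≡ zero → p ≡ suc x → Reaches g x y)
    go ε = (λ { _ refl → ε }) , λ _ ()
    go {u} {y} (step ◅ walk) = from-suc , λ { x refl p≡ → proj₁ (go walk) x (trans (sym step) p≡) }
      where
      from-suc : ∀ x → u ≡ suc x → Reaches g x y
      from-suc x refl with suc (g x) Fin.≟ p
      ... | yes eq = refl ◅ proj₂ (go walk) (g x) (trans (sym step) (trans (f-suc x) (redirect-≡ eq))) (sym eq)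
      ... | no ≢p  = refl ◅ proj₁ (go walk) (g x) (trans (sym step) (trans (f-suc x) (redirect-≢ ≢p)))

  module _ (perm : IsPermutation π) where

    private
      perm′ : IsPermutation (insert p π)
      perm′ = insert-permutation p perm

    -- Old points share a cycle after the insertion exactly if they did before. What remains is
    -- whether 0 opens a cycle of its own.
    distinct-insert : distinct _≟ˢ_ (cycleThrough (insert p π) ∘ suc) ≡ cycleCount π
    distinct-insert = trans
      (distinct-cong _≟ˢ_ _≟ˢ_ (cycleThrough (insert p π) ∘ suc) (cycleThrough π)
        (λ i j eq → cycleThrough-≡⁺ π perm (reaches-insert⁻ (cycleThrough-≡⁻ (insert p π) eq)))
        (λ i j eq → cycleThrough-≡⁺ (insert p π) perm′ (reaches-insert⁺ (cycleThrough-≡⁻ π eq))))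
      (sym (cycleCount≡distinct π))

cycleCount-insert-zero : {π : Vec (Fin n) n} → IsPermutation π → cycleCount (insert zero π) ≡ suc (cycleCount π)
cycleCount-insert-zero {π = π} perm = begin
  cycleCount (insert zero π)                                   ≡⟨ cycleCount≡distinct (insert zero π) ⟩
  distinct _≟ˢ_ (cycleThrough (insert zero π))                 ≡⟨ distinct-new _≟ˢ_ (cycleThrough (insert zero π)) new ⟩
  suc (distinct _≟ˢ_ (cycleThrough (insert zero π) ∘ suc))     ≡⟨ cong suc (distinct-insert perm) ⟩
  suc (cycleCount π)                                           ∎
  where
  open ≡-Reasoning
  fixed : ∀ {y} → Reaches (lookup (insert zero π)) zero y → y ≡ zero
  fixed ε             = refl
  fixed (refl ◅ walk) = fixed walk

  new : ∀ j → cycleThrough (insert zero π) zero ≢ cycleThrough (insert zero π) (suc j)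
  new j eq = Fin.0≢1+n (sym (fixed (cycleThrough-≡⁻ (insert zero π) eq)))

cycleCount-insert-suc : ∀ j {π : Vec (Fin n) n} → IsPermutation π → cycleCount (insert (suc j) π) ≡ cycleCount π
cycleCount-insert-suc j {π} perm = begin
  cycleCount (insert (suc j) π)                                ≡⟨ cycleCount≡distinct (insert (suc j) π) ⟩
  distinct _≟ˢ_ (cycleThrough (insert (suc j) π))              ≡⟨ distinct-old _≟ˢ_ (cycleThrough (insert (suc j) π)) j old ⟩
  distinct _≟ˢ_ (cycleThrough (insert (suc j) π) ∘ suc)        ≡⟨ distinct-insert perm ⟩
  cycleCount π                                                 ∎
  where
  open ≡-Reasoning
  old : cycleThrough (insert (suc j) π) zero ≡ cycleThrough (insert (suc j) π) (suc j)
  old = cycleThrough-≡⁺ (insert (suc j) π) (insert-permutation (suc j) perm) {zero} {suc j} (refl ◅ ε)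

permutations : ∀ n → List (Vec (Fin n) n)
permutations n = filter (λ π → injective? (lookup π)) (allVecs (allFin n) n)

permutations-unique : ∀ n → Unique (permutations n)
permutations-unique n = Unique.filter⁺ (λ π → injective? (lookup π)) (allVecs-unique (Unique.allFin⁺ n) n)

∈-permutations⁺ : {π : Vec (Fin n) n} → IsPermutation π → π ∈ permutations n
∈-permutations⁺ {π = π} perm = ∈-filter⁺ (λ π → injective? (lookup π)) (∈-allVecs ∈-allFin π) perm

∈-permutations⁻ : {π : Vec (Fin n) n} → π ∈ permutations n → IsPermutation π
∈-permutations⁻ {n = n} π∈ = proj₂ (∈-filter⁻ (λ π → injective? (lookup π)) {xs = allVecs (allFin n) n} π∈)

stirling₁≡∑ : ∀ a b → + stirling₁ a b ≡ ∑ (permutations a) (λ π → ind (cycleCount π ℕ.≟ b))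
stirling₁≡∑ a b = begin
  + stirling₁ a b
    ≡⟨ count≡∑ (λ π → injective? (lookup π) ×-dec (cycleCount π ℕ.≟ b)) (allVecs (allFin a) a) ⟩
  ∑ (allVecs (allFin a) a) (λ π → ind (injective? (lookup π) ×-dec (cycleCount π ℕ.≟ b)))
    ≡⟨ ∑-cong (allVecs (allFin a) a) (λ {π} _ → ind-× (injective? (lookup π)) (cycleCount π ℕ.≟ b)) ⟩
  ∑ (allVecs (allFin a) a) (λ π → ind (injective? (lookup π)) ℤ.* ind (cycleCount π ℕ.≟ b))
    ≡⟨ ∑-filter (λ π → injective? (lookup π)) (allVecs (allFin a) a) (λ π → ind (cycleCount π ℕ.≟ b)) ⟨
  ∑ (permutations a) (λ π → ind (cycleCount π ℕ.≟ b)) ∎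
  where open ≡-Reasoning

∑-permutations-suc : ∀ a (f : Vec (Fin (suc a)) (suc a) → ℤ) →
  ∑ (permutations (suc a)) f ≡ ∑ (allFin (suc a)) (λ p → ∑ (permutations a) (λ π → f (insert p π)))
∑-permutations-suc a f = begin
  ∑ (permutations (suc a)) f
    ≡⟨ ∑-bijection (uncurry insert) (λ σ → Vec.head σ , remove σ) f
         (Unique.cartesianProduct⁺ (Unique.allFin⁺ (suc a)) (permutations-unique a)) (permutations-unique (suc a))
         (λ {(p , π)} pπ∈ →
           ∈-permutations⁺ (insert-permutation p (∈-permutations⁻
             (proj₂ (∈-cartesianProduct⁻ (allFin (suc a)) (permutations a) pπ∈)))) ,
           cong (p ,_) (remove-insert p π))
         (λ { {p ∷ σ} σ∈ →
           ∈-cartesianProduct⁺ (∈-allFin p) (∈-permutations⁺ (remove-permutation p σ (∈-permutations⁻ σ∈))) ,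
           insert-remove p σ (∈-permutations⁻ σ∈) }) ⟨
  ∑ (cartesianProduct (allFin (suc a)) (permutations a)) (f ∘ uncurry insert)
    ≡⟨ ∑-cartesianProductWith _,_ (allFin (suc a)) (permutations a) (f ∘ uncurry insert) ⟩
  ∑ (allFin (suc a)) (λ p → ∑ (permutations a) (λ π → f (insert p π))) ∎
  where open ≡-Reasoning

-- The new point is fixed, or goes before one of the `a` old points. The first case is left as a sum
-- of indicators so that `b` = 0 and `b` > 0 are covered together.
stirling₁-recurrence : ∀ a b →
  + stirling₁ (suc a) b ≡ ∑ (permutations a) (λ π → ind (suc (cycleCount π) ℕ.≟ b)) ℤ.+ + a ℤ.* + stirling₁ a b
stirling₁-recurrence a b = begin
  + stirling₁ (suc a) b                                         ≡⟨ stirling₁≡∑ (suc a) b ⟩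
  ∑ (permutations (suc a)) (λ σ → ind (cycleCount σ ℕ.≟ b))     ≡⟨ ∑-permutations-suc a (λ σ → ind (cycleCount σ ℕ.≟ b)) ⟩
  row zero ℤ.+ ∑ (List.tabulate suc) row                        ≡⟨ cong₂ ℤ._+_ row-zero
         (trans (∑-cong (List.tabulate suc) row-suc) rows) ⟩
  ∑ (permutations a) (λ π → ind (suc (cycleCount π) ℕ.≟ b)) ℤ.+ + a ℤ.* + stirling₁ a b ∎
  where
  open ≡-Reasoning
  row : Fin (suc a) → ℤ
  row p = ∑ (permutations a) (λ π → ind (cycleCount (insert p π) ℕ.≟ b))

  row-zero : row zero ≡ ∑ (permutations a) (λ π → ind (suc (cycleCount π) ℕ.≟ b))
  row-zero = ∑-cong (permutations a) λ π∈ →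
    cong (λ c → ind (c ℕ.≟ b)) (cycleCount-insert-zero (∈-permutations⁻ π∈))

  row-suc : ∀ {p} → p ∈ List.tabulate {n = a} suc → row p ≡ + stirling₁ a b
  row-suc p∈ with j , refl ← ∈-tabulate⁻ p∈ = trans
    (∑-cong (permutations a) λ π∈ → cong (λ c → ind (c ℕ.≟ b)) (cycleCount-insert-suc j (∈-permutations⁻ π∈)))
    (sym (stirling₁≡∑ a b))

  rows : ∑ (List.tabulate {n = a} suc) (λ _ → + stirling₁ a b) ≡ + a ℤ.* + stirling₁ a b
  rows = trans (∑-const (List.tabulate {n = a} suc) (+ stirling₁ a b))
               (cong (λ l → + l ℤ.* + stirling₁ a b) (List.length-tabulate {n = a} suc))

stirling₁-suc-suc : ∀ a b → stirling₁ (suc a) (suc b) ≡ stirling₁ a b ℕ.+ a ℕ.* stirling₁ a (suc b)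
stirling₁-suc-suc a b = ℤ.+-injective (begin
  + stirling₁ (suc a) (suc b)
    ≡⟨ stirling₁-recurrence a (suc b) ⟩
  ∑ (permutations a) (λ π → ind (suc (cycleCount π) ℕ.≟ suc b)) ℤ.+ + a ℤ.* + stirling₁ a (suc b)
    ≡⟨ cong (ℤ._+ + a ℤ.* + stirling₁ a (suc b)) (trans
         (∑-cong (permutations a) (λ {π} _ →
           ind-cong (suc (cycleCount π) ℕ.≟ suc b) (cycleCount π ℕ.≟ b) ℕ.suc-injective (cong suc)))
         (sym (stirling₁≡∑ a b))) ⟩
  + stirling₁ a b ℤ.+ + a ℤ.* + stirling₁ a (suc b)
    ≡⟨ cong (ℤ._+_ (+ stirling₁ a b)) (ℤ.pos-* a (stirling₁ a (suc b))) ⟨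
  + (stirling₁ a b ℕ.+ a ℕ.* stirling₁ a (suc b)) ∎)
  where open ≡-Reasoning

stirling₁-suc-zero : ∀ a → stirling₁ (suc a) 0 ≡ a ℕ.* stirling₁ a 0
stirling₁-suc-zero a = ℤ.+-injective (begin
  + stirling₁ (suc a) 0
    ≡⟨ stirling₁-recurrence a 0 ⟩
  ∑ (permutations a) (λ π → ind (suc (cycleCount π) ℕ.≟ 0)) ℤ.+ + a ℤ.* + stirling₁ a 0
    ≡⟨ cong (ℤ._+ + a ℤ.* + stirling₁ a 0) (∑-0 (permutations a)) ⟩
  0ℤ ℤ.+ + a ℤ.* + stirling₁ a 0        ≡⟨ ℤ.+-identityˡ _ ⟩
  + a ℤ.* + stirling₁ a 0               ≡⟨ ℤ.pos-* a (stirling₁ a 0) ⟨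
  + (a ℕ.* stirling₁ a 0)               ∎)
  where open ≡-Reasoning

stirling₁-zeroʳ : ∀ a → stirling₁ (suc a) 0 ≡ 0
stirling₁-zeroʳ zero    = stirling₁-suc-zero 0
stirling₁-zeroʳ (suc a) = trans (stirling₁-suc-zero (suc a))
  (trans (cong (suc a ℕ.*_) (stirling₁-zeroʳ a)) (ℕ.*-zeroʳ (suc a)))

stirling₁-vanishes : ∀ a b → a ℕ.< b → stirling₁ a b ≡ 0
stirling₁-vanishes zero    (suc b) _         = refl
stirling₁-vanishes (suc a) (suc b) (s≤s a<b) = trans (stirling₁-suc-suc a b) (trans
  (cong₂ (λ s t → s ℕ.+ a ℕ.* t) (stirling₁-vanishes a b a<b) (stirling₁-vanishes a (suc b) (ℕ.m<n⇒m<1+n a<b)))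
  (ℕ.*-zeroʳ a))

-- With k + i = s the two recurrences agree term by term. At the borders i = 0 and k = 0 the terms
-- outside the triangle vanish; the corner is the one permutation of the empty set.
stirling₁≡elementary : ∀ s k i → k ℕ.+ i ≡ s → stirling₁ (suc s) (suc k) ≡ elementary s i
stirling₁≡elementary zero    zero    zero    _  = stirling₁-suc-suc 0 0
stirling₁≡elementary (suc s) k       zero    eq = begin
  stirling₁ (2 ℕ.+ s) (suc k)
    ≡⟨ cong (λ k → stirling₁ (2 ℕ.+ s) (suc k)) k≡ ⟩
  stirling₁ (2 ℕ.+ s) (2 ℕ.+ s)
    ≡⟨ stirling₁-suc-suc (suc s) (suc s) ⟩
  stirling₁ (suc s) (suc s) ℕ.+ suc s ℕ.* stirling₁ (suc s) (2 ℕ.+ s)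
    ≡⟨ cong₂ (λ u v → u ℕ.+ suc s ℕ.* v) (stirling₁≡elementary s s 0 (ℕ.+-identityʳ s))
             (stirling₁-vanishes (suc s) (2 ℕ.+ s) ℕ.≤-refl) ⟩
  1 ℕ.+ suc s ℕ.* 0
    ≡⟨ cong suc (ℕ.*-zeroʳ (suc s)) ⟩
  1 ∎
  where
  open ≡-Reasoning
  k≡ : k ≡ suc s
  k≡ = trans (sym (ℕ.+-identityʳ k)) eq
stirling₁≡elementary (suc s) zero    (suc i) eq = begin
  stirling₁ (2 ℕ.+ s) 1
    ≡⟨ stirling₁-suc-suc (suc s) 0 ⟩
  stirling₁ (suc s) 0 ℕ.+ suc s ℕ.* stirling₁ (suc s) 1
    ≡⟨ cong₂ (λ u v → u ℕ.+ suc s ℕ.* v) (stirling₁-zeroʳ s) (stirling₁≡elementary s 0 i (ℕ.suc-injective eq)) ⟩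
  suc s ℕ.* elementary s i
    ≡⟨ cong (ℕ._+ suc s ℕ.* elementary s i) (elementary-vanishes s (suc i) (ℕ.≤-reflexive (sym eq))) ⟨
  elementary s (suc i) ℕ.+ suc s ℕ.* elementary s i ∎
  where open ≡-Reasoning
stirling₁≡elementary (suc s) (suc k) (suc i) eq = begin
  stirling₁ (2 ℕ.+ s) (2 ℕ.+ k)
    ≡⟨ stirling₁-suc-suc (suc s) (suc k) ⟩
  stirling₁ (suc s) (suc k) ℕ.+ suc s ℕ.* stirling₁ (suc s) (2 ℕ.+ k)
    ≡⟨ cong₂ (λ u v → u ℕ.+ suc s ℕ.* v) (stirling₁≡elementary s k (suc i) (ℕ.suc-injective eq))
             (stirling₁≡elementary s (suc k) i (trans (sym (ℕ.+-suc k i)) (ℕ.suc-injective eq))) ⟩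
  elementary s (suc i) ℕ.+ suc s ℕ.* elementary s i ∎
  where open ≡-Reasoning

-- The Stanley–Reisner ring

isPositive : ℕ → Bool
isPositive zero    = false
isPositive (suc _) = true

support : Vec ℕ m → Subset m
support = Vec.map isPositive

exponent : Subset m → Vec ℕ m
exponent = Vec.map (λ s → if s then 1 else 0)

_⊕_ : Vec ℕ m → Vec ℕ m → Vec ℕ m
_⊕_ = zipWith ℕ._+_

_≟ᵛ_ : DecidableEquality (Vec ℕ m)
_≟ᵛ_ = Vec.≡-dec ℕ._≟_

support-exponent : (S : Subset m) → support (exponent S) ≡ S
support-exponent []          = refl
support-exponent (true ∷ S)  = cong (true ∷_) (support-exponent S)
support-exponent (false ∷ S) = cong (false ∷_) (support-exponent S)

support-⊕ : (ν λ′ : Vec ℕ m) → support λ′ ⊆ support (ν ⊕ λ′)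
support-⊕ (k ∷ ν)     (l ∷ λ′)     (Vec.there x∈) = Vec.there (support-⊕ ν λ′ x∈)
support-⊕ (zero ∷ ν)  (suc l ∷ λ′) Vec.here       = Vec.here
support-⊕ (suc k ∷ ν) (suc l ∷ λ′) Vec.here       = Vec.here

⊕-cancelˡ : (ν : Vec ℕ m) {λ₁ λ₂ : Vec ℕ m} → ν ⊕ λ₁ ≡ ν ⊕ λ₂ → λ₁ ≡ λ₂
⊕-cancelˡ []      {[]}     {[]}     _  = refl
⊕-cancelˡ (k ∷ ν) {l ∷ λ₁} {l′ ∷ λ₂} eq =
  cong₂ _∷_ (ℕ.+-cancelˡ-≡ k l l′ (Vec.∷-injectiveˡ eq)) (⊕-cancelˡ ν (Vec.∷-injectiveʳ eq))

_⊖_ : Vec ℕ m → Vec ℕ m → Vec ℕ m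
_⊖_ = zipWith ℕ._∸_

⊕-⊖ : (ν λ′ : Vec ℕ m) → (ν ⊕ λ′) ⊖ ν ≡ λ′
⊕-⊖ []      []       = refl
⊕-⊖ (k ∷ ν) (l ∷ λ′) = cong₂ _∷_ (ℕ.m+n∸m≡n k l) (⊕-⊖ ν λ′)

⊖-⊕-exponent : (ν : Vec ℕ m) (S : Subset m) → S ⊆ support ν → (ν ⊖ exponent S) ⊕ exponent S ≡ ν
⊖-⊕-exponent []          []          _  = refl
⊖-⊕-exponent (k ∷ ν)     (false ∷ S) S⊆ = cong₂ _∷_ (ℕ.+-identityʳ k) (⊖-⊕-exponent ν S (Subset.drop-∷-⊆ S⊆))
⊖-⊕-exponent (suc k ∷ ν) (true ∷ S)  S⊆ = cong₂ _∷_ (ℕ.+-comm k 1) (⊖-⊕-exponent ν S (Subset.drop-∷-⊆ S⊆))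
⊖-⊕-exponent (zero ∷ ν)  (true ∷ S)  S⊆ with () ← S⊆ Vec.here

-- If `ν` divides `μ`, the quotient must be `μ ⊖ ν`, so testing this candidate decides.
quotient? : (ν μ : Vec ℕ m) → Dec (∃ λ λ′ → ν ⊕ λ′ ≡ μ)
quotient? ν μ with (ν ⊕ (μ ⊖ ν)) ≟ᵛ μ
... | yes eq = yes (_ , eq)
... | no ≢μ  = no λ { (λ′ , refl) → ≢μ (cong (ν ⊕_) (⊕-⊖ ν λ′)) }

raise : Vec ℕ (suc m) → Vec ℕ (suc m)
raise (k ∷ μ) = suc k ∷ μ

monomialsOn : Subset m → ℕ → List (Vec ℕ m)
monomialsOn []          zero    = [] ∷ []
monomialsOn []          (suc d) = []
monomialsOn (false ∷ S) d       = List.map (0 ∷_) (monomialsOn S d)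
monomialsOn (true ∷ S)  zero    = []
-- the first variable occurs exactly once, or more often
monomialsOn (true ∷ S)  (suc d) = List.map (1 ∷_) (monomialsOn S d) ++ List.map raise (monomialsOn (true ∷ S) d)

∈-monomialsOn⁻ : (S : Subset m) (d : ℕ) {μ : Vec ℕ m} → μ ∈ monomialsOn S d → support μ ≡ S × Vec.sum μ ≡ d
∈-monomialsOn⁻ []          zero    (here refl) = refl , refl
∈-monomialsOn⁻ (false ∷ S) d       μ∈ with ν , ν∈ , refl ← ∈-map⁻ (0 ∷_) μ∈ =
  let supp , deg = ∈-monomialsOn⁻ S d ν∈ in cong (false ∷_) supp , deg
∈-monomialsOn⁻ (true ∷ S)  (suc d) μ∈ with ∈-++⁻ (List.map (1 ∷_) (monomialsOn S d)) μ∈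
... | inj₁ μ∈′ with ν , ν∈ , refl ← ∈-map⁻ (1 ∷_) μ∈′ =
  let supp , deg = ∈-monomialsOn⁻ S d ν∈ in cong (true ∷_) supp , cong suc deg
... | inj₂ μ∈′ with k ∷ ν , ν∈ , refl ← ∈-map⁻ raise μ∈′ =
  let supp , deg = ∈-monomialsOn⁻ (true ∷ S) d ν∈ in cong (true ∷_) (Vec.∷-injectiveʳ supp) , cong suc deg

∈-monomialsOn⁺ : (μ : Vec ℕ m) → μ ∈ monomialsOn (support μ) (Vec.sum μ)
∈-monomialsOn⁺ []                = here refl
∈-monomialsOn⁺ (zero ∷ μ)        = ∈-map⁺ (0 ∷_) (∈-monomialsOn⁺ μ)
∈-monomialsOn⁺ (suc zero ∷ μ)    = ∈-++⁺ˡ (∈-map⁺ (1 ∷_) (∈-monomialsOn⁺ μ))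
∈-monomialsOn⁺ (suc (suc k) ∷ μ) = ∈-++⁺ʳ (List.map (1 ∷_) (monomialsOn (support μ) (suc k ℕ.+ Vec.sum μ)))
  (∈-map⁺ raise (∈-monomialsOn⁺ (suc k ∷ μ)))

monomialsOn-unique : (S : Subset m) (d : ℕ) → Unique (monomialsOn S d)
monomialsOn-unique []          zero    = [] ∷ []
monomialsOn-unique []          (suc d) = []
monomialsOn-unique (false ∷ S) d       = Unique.map⁺ Vec.∷-injectiveʳ (monomialsOn-unique S d)
monomialsOn-unique (true ∷ S)  zero    = []
monomialsOn-unique (true ∷ S)  (suc d) = Unique.++⁺
  (Unique.map⁺ Vec.∷-injectiveʳ (monomialsOn-unique S d))
  (Unique.map⁺ raise-injective (monomialsOn-unique (true ∷ S) d))
  disjoint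
  where
  raise-injective : {μ ν : Vec ℕ (suc m)} → raise μ ≡ raise ν → μ ≡ ν
  raise-injective {μ = _ ∷ _} {_ ∷ _} refl = refl

  -- The first exponent is 1 in the left list. In the right list it is at least 2, since before
  -- `raise` the first variable was already in the support.
  disjoint : ∀ {μ} → μ ∈ List.map (1 ∷_) (monomialsOn S d) × μ ∈ List.map raise (monomialsOn (true ∷ S) d) → _
  disjoint (μ∈₁ , μ∈₂) with _ , _ , refl ← ∈-map⁻ (1 ∷_) μ∈₁ with zero ∷ ν , ν∈ , refl ← ∈-map⁻ raise μ∈₂
    with () ← proj₁ (∈-monomialsOn⁻ (true ∷ S) d ν∈)

∈-concatMap-find : (g : A → List B) (xs : List A) {y : B} → y ∈ concatMap g xs → ∃ λ x → x ∈ xs × y ∈ g x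
∈-concatMap-find g xs y∈ = find (∈-concatMap⁻ g {xs} y∈)

-- The `key` tells from which block an element comes, so blocks of different `x` are disjoint. For
-- monomials it is the support.
concatMap-unique : (g : A → List B) (key : B → A) → (∀ x {y} → y ∈ g x → key y ≡ x) → (∀ x → Unique (g x)) →
  {xs : List A} → Unique xs → Unique (concatMap g xs)
concatMap-unique g key key-g unique-g []                    = []
concatMap-unique g key key-g unique-g {x ∷ xs} (x∉ ∷ unique) =
  Unique.++⁺ (unique-g x) (concatMap-unique g key key-g unique-g unique) λ (y∈x , y∈xs) →
    let x′ , x′∈ , y∈x′ = ∈-concatMap-find g xs y∈xs in
    All.lookup x∉ x′∈ (trans (sym (key-g x y∈x)) (key-g x′ y∈x′))

module _ (G : Graph) {_≤_ : Rel (Edge G) ℓ} (isTotal : IsTotalOrder _≡_ _≤_) where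

  Standard : Vec ℕ (∣E∣ G) → Set ℓ
  Standard μ = IsFace G isTotal (support μ)

  standard? : (μ : Vec ℕ (∣E∣ G)) → Dec (Standard μ)
  standard? μ = isFace? G isTotal (support μ)

  -- Grouped by support, so that the Hilbert series splits into one series for each face.
  standardMonomials : ℕ → List (Vec ℕ (∣E∣ G))
  standardMonomials d = concatMap (λ F → monomialsOn F d) (faces G isTotal)

  standardMonomials-unique : ∀ d → Unique (standardMonomials d)
  standardMonomials-unique d = concatMap-unique (λ F → monomialsOn F d) support
    (λ F μ∈ → proj₁ (∈-monomialsOn⁻ F d μ∈)) (λ F → monomialsOn-unique F d)
    (Unique.filter⁺ (isFace? G isTotal) (allSubsets-unique (∣E∣ G)))

  ∈-standardMonomials⁻ : ∀ d {μ} → μ ∈ standardMonomials d → Standard μ × Vec.sum μ ≡ d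
  ∈-standardMonomials⁻ d {μ} μ∈ =
    let F , F∈ , μ∈F = ∈-concatMap-find (λ F → monomialsOn F d) (faces G isTotal) μ∈
        supp , deg  = ∈-monomialsOn⁻ F d μ∈F
    in subst (IsFace G isTotal) (sym supp) (proj₂ (∈-filter⁻ (isFace? G isTotal) {xs = allSubsets (∣E∣ G)} F∈)) , deg

  ∈-standardMonomials⁺ : ∀ {d μ} → Standard μ → Vec.sum μ ≡ d → μ ∈ standardMonomials d
  ∈-standardMonomials⁺ {μ = μ} standard refl = ∈-concatMap⁺ (λ F → monomialsOn F (Vec.sum μ)) {faces G isTotal}
    (lose (∈-filter⁺ (isFace? G isTotal) (∈-allSubsets (support μ)) standard) (∈-monomialsOn⁺ μ))

module _ (𝕜 : HeytingField γ ℓ₁ ℓ₂) where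

  open CommutativeRing (HeytingCommutativeRing.commutativeRing (HeytingField.heytingCommutativeRing 𝕜))
    renaming (refl to ≈-refl; sym to ≈-sym; trans to ≈-trans) hiding (zero)
  open import Algebra.Properties.Ring ring using (-0#≈0#; -‿distribˡ-*)
  open import Relation.Binary.Reasoning.Setoid setoid

  private
    Polynomial : ℕ → Set γ
    Polynomial = Poly 𝕜

    _[_] : Polynomial m → Vec ℕ m → Carrier
    _[_] = coeff 𝕜

    _∙_ : Carrier × Vec ℕ m → Polynomial m → Polynomial m
    (b , ν) ∙ p = List.map (λ (a , μ) → b * a , ν ⊕ μ) p

  coeff-∷-≡ : ∀ a {ν μ : Vec ℕ m} p → ν ≡ μ → ((a , ν) ∷ p) [ μ ] ≈ a + p [ μ ]
  coeff-∷-≡ a {ν} {μ} p eq with ν ≟ᵛ μ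
  ... | yes _ = ≈-refl
  ... | no ≢μ = contradiction eq ≢μ

  coeff-∷-≢ : ∀ a {ν μ : Vec ℕ m} p → ν ≢ μ → ((a , ν) ∷ p) [ μ ] ≈ p [ μ ]
  coeff-∷-≢ a {ν} {μ} p ≢μ with ν ≟ᵛ μ
  ... | yes eq = contradiction eq ≢μ
  ... | no _   = ≈-refl

  coeff-neg : (p : Polynomial m) (μ : Vec ℕ m) → (-ₚ_ 𝕜 p) [ μ ] ≈ - p [ μ ]
  coeff-neg p μ = begin
    (-ₚ_ 𝕜 p) [ μ ]       ≈⟨ coeff-· 𝕜 (- 1#) p μ ⟩
    - 1# * p [ μ ]        ≈⟨ -‿distribˡ-* 1# (p [ μ ]) ⟨
    - (1# * p [ μ ])      ≈⟨ -‿cong (*-identityˡ (p [ μ ])) ⟩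
    - p [ μ ]             ∎

  -- Together with `coeff-∙-∤` this determines every coefficient of the product of a single term
  -- with `p`, according to whether `ν` divides the exponent.
  coeff-∙-⊕ : ∀ b (ν μ : Vec ℕ m) p → ((b , ν) ∙ p) [ ν ⊕ μ ] ≈ b * p [ μ ]
  coeff-∙-⊕ b ν μ []            = ≈-sym (zeroʳ b)
  coeff-∙-⊕ b ν μ ((a , λ′) ∷ p) with λ′ ≟ᵛ μ
  ... | yes eq = ≈-trans (coeff-∷-≡ (b * a) ((b , ν) ∙ p) (cong (ν ⊕_) eq))
                       (≈-trans (+-congˡ (coeff-∙-⊕ b ν μ p)) (≈-sym (distribˡ b a _)))
  ... | no ≢μ  = ≈-trans (coeff-∷-≢ (b * a) ((b , ν) ∙ p) (≢μ ∘ ⊕-cancelˡ ν)) (coeff-∙-⊕ b ν μ p)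

  coeff-∙-∤ : ∀ b (ν μ : Vec ℕ m) p → ¬ (∃ λ λ′ → ν ⊕ λ′ ≡ μ) → ((b , ν) ∙ p) [ μ ] ≈ 0#
  coeff-∙-∤ b ν μ []            ∤ = ≈-refl
  coeff-∙-∤ b ν μ ((a , λ′) ∷ p) ∤ =
    ≈-trans (coeff-∷-≢ (b * a) ((b , ν) ∙ p) (λ eq → ∤ (λ′ , eq))) (coeff-∙-∤ b ν μ p ∤)

  module _ (G : Graph) {_≤_ : Rel (Edge G) ℓ} (isTotal : IsTotalOrder _≡_ _≤_) where

    private
      E : ℕ
      E = ∣E∣ G

      I : Polynomial E → Set _
      I = Ideal 𝕜 (BrokenCircuitMonomial 𝕜 G isTotal)

      Standard′ = Standard G isTotal
      standard?′ = standard? G isTotal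

      Vanishing : Polynomial E → Set _
      Vanishing p = ∀ μ → Standard′ μ → p [ μ ] ≈ 0#

    -- Generators have non-standard exponents. Multiples stay in the class because a divisor of a
    -- standard monomial has smaller support and so is standard itself.
    ideal⇒vanishing : ∀ {p} → I p → Vanishing p
    ideal⇒vanishing (gen (B , broken , refl)) μ standard = coeff-∷-≢ 1# [] λ eq →
      standard (B , broken , λ {x} x∈ →
        subst (x Subset.∈_) (trans (sym (support-exponent B)) (cong support eq)) x∈)
    ideal⇒vanishing zero μ standard = ≈-refl
    ideal⇒vanishing (add {p} {q} p∈ q∈) μ standard = begin
      (_+ₚ_ 𝕜 p q) [ μ ]  ≈⟨ coeff-+ 𝕜 p q μ ⟩
      p [ μ ] + q [ μ ]   ≈⟨ +-cong (ideal⇒vanishing p∈ μ standard) (ideal⇒vanishing q∈ μ standard) ⟩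
      0# + 0#             ≈⟨ +-identityˡ 0# ⟩
      0#                  ∎
    ideal⇒vanishing (resp p≈q p∈) μ standard = ≈-trans (≈-sym (p≈q μ)) (ideal⇒vanishing p∈ μ standard)
    ideal⇒vanishing (mul q {p} p∈) μ standard = multiple q
      where
      term : ∀ b ν → ((b , ν) ∙ p) [ μ ] ≈ 0#
      term b ν with quotient? ν μ
      ... | no ∤             = coeff-∙-∤ b ν μ p ∤
      ... | yes (λ′ , refl) = begin
        ((b , ν) ∙ p) [ ν ⊕ λ′ ] ≈⟨ coeff-∙-⊕ b ν λ′ p ⟩
        b * p [ λ′ ]
          ≈⟨ *-congˡ (ideal⇒vanishing p∈ λ′ λ (B , broken , B⊆) → standard (B , broken , support-⊕ ν λ′ ∘ B⊆)) ⟩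
        b * 0#                   ≈⟨ zeroʳ b ⟩
        0#                       ∎

      multiple : ∀ q → (_*ₚ_ 𝕜 q p) [ μ ] ≈ 0#
      multiple []            = ≈-refl
      multiple ((b , ν) ∷ q) = begin
        (((b , ν) ∙ p) ++ _*ₚ_ 𝕜 q p) [ μ ]           ≈⟨ coeff-+ 𝕜 ((b , ν) ∙ p) (_*ₚ_ 𝕜 q p) μ ⟩
        ((b , ν) ∙ p) [ μ ] + (_*ₚ_ 𝕜 q p) [ μ ]      ≈⟨ +-cong (term b ν) (multiple q) ⟩
        0# + 0#                                       ≈⟨ +-identityˡ 0# ⟩
        0#                                            ∎

    -- `IsFace` is a negation, so the witness comes from a search through the finitely many subsets.
    brokenCircuit⊆ : ∀ {F} → ¬ IsFace G isTotal F → ∃ λ B → IsBrokenCircuit G isTotal B × B ⊆ F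
    brokenCircuit⊆ {F} = decidable-stable
      (Subset.anySubset? λ B → isBrokenCircuit? G isTotal B ×-dec (B Subset.⊆? F))

    nonStandard : Polynomial E → Polynomial E
    nonStandard [] = []
    nonStandard ((a , ν) ∷ p) with standard?′ ν
    ... | yes _ = nonStandard p
    ... | no _  = (a , ν) ∷ nonStandard p

    -- The support of a non-standard monomial contains a broken circuit, whose squarefree monomial
    -- divides it.
    nonStandard∈ideal : ∀ p → I (nonStandard p)
    nonStandard∈ideal [] = zero
    nonStandard∈ideal ((a , ν) ∷ p) with standard?′ ν
    ... | yes _ = nonStandard∈ideal p
    ... | no ¬standard = add {p = (a , ν) ∷ []} (term (brokenCircuit⊆ ¬standard)) (nonStandard∈ideal p)
      where
      term : (∃ λ B → IsBrokenCircuit G isTotal B × B ⊆ support ν) → I ((a , ν) ∷ [])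
      term (B , broken , B⊆) = resp same (mul ((a , ν ⊖ exponent B) ∷ []) (gen (B , broken , refl)))
        where
        same : ∀ μ → ((a * 1# , (ν ⊖ exponent B) ⊕ exponent B) ∷ []) [ μ ] ≈ ((a , ν) ∷ []) [ μ ]
        same μ rewrite ⊖-⊕-exponent ν B B⊆ with ν ≟ᵛ μ
        ... | yes _ = +-congʳ (*-identityʳ a)
        ... | no _  = ≈-refl

    coeff-nonStandard-standard : ∀ p {μ} → Standard′ μ → nonStandard p [ μ ] ≈ 0#
    coeff-nonStandard-standard [] standard = ≈-refl
    coeff-nonStandard-standard ((a , ν) ∷ p) standard with standard?′ ν
    ... | yes _ = coeff-nonStandard-standard p standard
    ... | no ¬standard = ≈-trans (coeff-∷-≢ a {ν} (nonStandard p) λ { refl → ¬standard standard })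
                               (coeff-nonStandard-standard p standard)

    coeff-nonStandard-¬standard : ∀ p {μ} → ¬ Standard′ μ → nonStandard p [ μ ] ≈ p [ μ ]
    coeff-nonStandard-¬standard [] ¬standard = ≈-refl
    coeff-nonStandard-¬standard ((a , ν) ∷ p) {μ} ¬standard with standard?′ ν
    ... | yes standard = ≈-trans (coeff-nonStandard-¬standard p ¬standard)
                               (≈-sym (coeff-∷-≢ a {ν} p λ { refl → ¬standard standard }))
    ... | no _ with ν ≟ᵛ μ
    ... | yes _ = +-congˡ (coeff-nonStandard-¬standard p ¬standard)
    ... | no _  = coeff-nonStandard-¬standard p ¬standard

    -- Terms are discarded by exponent and not by coefficient, as equality in a Heyting field need
    -- not be decidable. At a standard exponent the discarded terms add up to 0.
    vanishing⇒ideal : ∀ {p} → Vanishing p → I p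
    vanishing⇒ideal {p} vanishing = resp same (nonStandard∈ideal p)
      where
      same : ∀ μ → nonStandard p [ μ ] ≈ p [ μ ]
      same μ with standard?′ μ
      ... | yes standard = ≈-trans (coeff-nonStandard-standard p standard) (≈-sym (vanishing μ standard))
      ... | no ¬standard = coeff-nonStandard-¬standard p ¬standard

    private
      M : ℕ → _
      M = 𝕜[BC]-part 𝕜 G isTotal

    module _ {d : ℕ} where

      monomial : (μ : Vec ℕ E) → Vec.sum μ ≡ d → ∃ (Homogeneous 𝕜 {E} d)
      monomial μ deg = ((1# , μ) ∷ []) , λ ν ≢d → coeff-∷-≢ 1# {μ} [] λ { refl → ≢d deg }

      monomials : (L : List (Vec ℕ E)) → (∀ {μ} → μ ∈ L → Vec.sum μ ≡ d) → Vector (∃ (Homogeneous 𝕜 {E} d)) (length L)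
      monomials L deg i = monomial (List.lookup L i) (deg (∈-lookup {xs = L} i))

      combine : (L : List (Vec ℕ E)) (deg : ∀ {μ} → μ ∈ L → Vec.sum μ ≡ d) → Vector Carrier (length L) → Polynomial E
      combine L deg a = proj₁ (combination 𝕜 (M d) a (monomials L deg))

      coeff-combine-∉ : ∀ L (deg : ∀ {μ} → μ ∈ L → Vec.sum μ ≡ d) a {μ} → μ ∉ L → combine L deg a [ μ ] ≈ 0#
      coeff-combine-∉ []      deg a μ∉ = ≈-refl
      coeff-combine-∉ (ν ∷ L) deg a μ∉ =
        ≈-trans (coeff-∷-≢ (a zero * 1#) {ν} (combine L (deg ∘ there) (a ∘ suc)) λ { refl → μ∉ (here refl) })
              (coeff-combine-∉ L (deg ∘ there) (a ∘ suc) (μ∉ ∘ there))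

      coeff-combine-lookup : ∀ {L} (deg : ∀ {μ} → μ ∈ L → Vec.sum μ ≡ d) a → Unique L →
        ∀ i → combine L deg a [ List.lookup L i ] ≈ a i
      coeff-combine-lookup {ν ∷ L} deg a (ν∉ ∷ unique) zero = begin
        combine (ν ∷ L) deg a [ ν ]  ≈⟨ coeff-∷-≡ (a zero * 1#) (combine L (deg ∘ there) (a ∘ suc)) refl ⟩
        a zero * 1# + combine L (deg ∘ there) (a ∘ suc) [ ν ]
          ≈⟨ +-cong (*-identityʳ (a zero)) (coeff-combine-∉ L (deg ∘ there) (a ∘ suc) λ ν∈ → All.lookup ν∉ ν∈ refl) ⟩
        a zero + 0#                  ≈⟨ +-identityʳ (a zero) ⟩
        a zero                       ∎
      coeff-combine-lookup {ν ∷ L} deg a (ν∉ ∷ unique) (suc i) =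
        ≈-trans (coeff-∷-≢ (a zero * 1#) (combine L (deg ∘ there) (a ∘ suc)) (All.lookup ν∉ (∈-lookup {xs = L} i)))
              (coeff-combine-lookup (deg ∘ there) (a ∘ suc) unique i)

      -- Modulo the ideal a polynomial is determined by its coefficients at standard monomials, and
      -- in a combination these are the given scalars. A homogeneous polynomial is thus spanned with
      -- its own coefficients.
      monomials-basis : ∀ {L} (deg : ∀ {μ} → μ ∈ L → Vec.sum μ ≡ d) → Unique L →
        (∀ {μ} → μ ∈ L → Standard′ μ) → (∀ {μ} → Standard′ μ → Vec.sum μ ≡ d → μ ∈ L) →
        IsBasis 𝕜 (M d) (monomials L deg)
      monomials-basis {L} deg unique sound complete = independent , spanning
        where
        -- Equality with 0 in the quotient means that the difference with the zero polynomial is in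
        -- the ideal; that difference appends an empty list.
        independent : ∀ a → I (combine L deg a ++ []) → ∀ i → a i ≈ 0#
        independent a a∈I i = begin
          a i                                     ≈⟨ coeff-combine-lookup deg a unique i ⟨
          combine L deg a [ List.lookup L i ]     ≡⟨ cong (_[ List.lookup L i ]) (List.++-identityʳ (combine L deg a)) ⟨
          (combine L deg a ++ []) [ List.lookup L i ]
            ≈⟨ ideal⇒vanishing a∈I (List.lookup L i) (sound (∈-lookup {xs = L} i)) ⟩
          0#                                      ∎

        spanning : ∀ (f : ∃ (Homogeneous 𝕜 {E} d)) → ∃ λ a → I (proj₁ f ++ (-ₚ_ 𝕜 (combine L deg a)))
        spanning (p , homogeneous) = a , vanishing⇒ideal λ μ standard → begin
          (p ++ (-ₚ_ 𝕜 x)) [ μ ]       ≈⟨ coeff-+ 𝕜 p (-ₚ_ 𝕜 x) μ ⟩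
          p [ μ ] + (-ₚ_ 𝕜 x) [ μ ]    ≈⟨ +-cong (agree μ standard) (coeff-neg x μ) ⟩
          x [ μ ] + - (x [ μ ])        ≈⟨ -‿inverseʳ (x [ μ ]) ⟩
          0#                           ∎
          where
          a : Vector Carrier (length L)
          a i = p [ List.lookup L i ]

          x : Polynomial E
          x = combine L deg a

          agree : ∀ μ → Standard′ μ → p [ μ ] ≈ x [ μ ]
          agree μ standard with Vec.sum μ ℕ.≟ d
          ... | no ≢d   = ≈-trans (homogeneous μ ≢d) (≈-sym (coeff-combine-∉ L deg a (≢d ∘ deg)))
          ... | yes deg≡ = begin
            p [ μ ]                          ≡⟨ cong (p [_]) (lookup-index μ∈) ⟩
            p [ List.lookup L (index μ∈) ]   ≈⟨ coeff-combine-lookup deg a unique (index μ∈) ⟨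
            x [ List.lookup L (index μ∈) ]   ≡⟨ cong (x [_]) (lookup-index μ∈) ⟨
            x [ μ ]                          ∎
            where μ∈ = complete standard deg≡

    dimension : ∀ d → HasDimension 𝕜 (M d) (length (standardMonomials G isTotal d))
    dimension d = monomials (standardMonomials G isTotal d) (proj₂ ∘ ∈-standardMonomials⁻ G isTotal d) ,
      monomials-basis (proj₂ ∘ ∈-standardMonomials⁻ G isTotal d) (standardMonomials-unique G isTotal d)
        (proj₁ ∘ ∈-standardMonomials⁻ G isTotal d) (∈-standardMonomials⁺ G isTotal)

-- Formal power series

open import Defs using (_≈_; _+_; _*_; -_; _-_; 0#; 1#; _^_; sum; product)

private
  tail : Series → Series
  tail f d = f (suc d)

  *-head : ∀ f g → (f * g) 0 ≡ f 0 ℤ.* g 0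
  *-head f g = ℤ.+-identityʳ _

  *-cong : ∀ {f f′ g g′} → f ≈ f′ → g ≈ g′ → f * g ≈ f′ * g′
  *-cong {f} {f′} {g} {g′} f≈ g≈ zero    = cong₂ (λ s t → s ℤ.* t ℤ.+ 0ℤ) (f≈ 0) (g≈ 0)
  *-cong {f} {f′} {g} {g′} f≈ g≈ (suc d) =
    cong₂ ℤ._+_ (cong₂ ℤ._*_ (f≈ 0) (g≈ (suc d))) (*-cong {tail f} {tail f′} {g} {g′} (f≈ ∘ suc) g≈ d)

  -- By definition the Cauchy product splits off the constant coefficient of the left factor.
  -- Splitting off that of the right one is what commutativity needs.
  *-tailʳ : ∀ f g d → (f * g) (suc d) ≡ (f * tail g) d ℤ.+ f (suc d) ℤ.* g 0
  *-tailʳ f g zero    = ring (f 0) (f 1) (g 0) (g 1)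
    where
    ring : ∀ f₀ f₁ g₀ g₁ → f₀ ℤ.* g₁ ℤ.+ (f₁ ℤ.* g₀ ℤ.+ 0ℤ) ≡ f₀ ℤ.* g₁ ℤ.+ 0ℤ ℤ.+ f₁ ℤ.* g₀
    ring = solve-∀
  *-tailʳ f g (suc d) =
    trans (cong (ℤ._+_ (f 0 ℤ.* g (2 ℕ.+ d))) (*-tailʳ (tail f) g d)) (sym (ℤ.+-assoc (f 0 ℤ.* g (2 ℕ.+ d)) _ _))

  *-comm : ∀ f g → f * g ≈ g * f
  *-comm f g zero    = cong (ℤ._+ 0ℤ) (ℤ.*-comm (f 0) (g 0))
  *-comm f g (suc d) = begin
    f 0 ℤ.* g (suc d) ℤ.+ (tail f * g) d ≡⟨ cong₂ ℤ._+_ (ℤ.*-comm (f 0) (g (suc d))) (*-comm (tail f) g d) ⟩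
    g (suc d) ℤ.* f 0 ℤ.+ (g * tail f) d ≡⟨ ℤ.+-comm (g (suc d) ℤ.* f 0) ((g * tail f) d) ⟩
    (g * tail f) d ℤ.+ g (suc d) ℤ.* f 0 ≡⟨ *-tailʳ g f d ⟨
    (g * f) (suc d)                      ∎
    where open ≡-Reasoning

  *-distribʳ-+ : ∀ h f g → (f + g) * h ≈ f * h + g * h
  *-distribʳ-+ h f g zero    = ring (f 0) (g 0) (h 0)
    where
    ring : ∀ f g h → (f ℤ.+ g) ℤ.* h ℤ.+ 0ℤ ≡ f ℤ.* h ℤ.+ 0ℤ ℤ.+ (g ℤ.* h ℤ.+ 0ℤ)
    ring = solve-∀
  *-distribʳ-+ h f g (suc d) =
    trans (cong (ℤ._+_ ((f 0 ℤ.+ g 0) ℤ.* h (suc d))) (*-distribʳ-+ h (tail f) (tail g) d))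
          (ring (f 0) (g 0) (h (suc d)) ((tail f * h) d) ((tail g * h) d))
    where
    ring : ∀ f g h u v → (f ℤ.+ g) ℤ.* h ℤ.+ (u ℤ.+ v) ≡ f ℤ.* h ℤ.+ u ℤ.+ (g ℤ.* h ℤ.+ v)
    ring = solve-∀

  scale : ℤ → Series → Series
  scale c f d = c ℤ.* f d

  scale-* : ∀ c f g → scale c f * g ≈ scale c (f * g)
  scale-* c f g zero    = ring c (f 0) (g 0)
    where
    ring : ∀ c f g → c ℤ.* f ℤ.* g ℤ.+ 0ℤ ≡ c ℤ.* (f ℤ.* g ℤ.+ 0ℤ)
    ring = solve-∀
  scale-* c f g (suc d) =
    trans (cong (ℤ._+_ (c ℤ.* f 0 ℤ.* g (suc d))) (scale-* c (tail f) g d)) (ring c (f 0) (g (suc d)) ((tail f * g) d))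
    where
    ring : ∀ c f g u → c ℤ.* f ℤ.* g ℤ.+ c ℤ.* u ≡ c ℤ.* (f ℤ.* g ℤ.+ u)
    ring = solve-∀

  *-assoc : ∀ f g h → (f * g) * h ≈ f * (g * h)
  *-assoc f g h zero    = ring (f 0) (g 0) (h 0)
    where
    ring : ∀ f g h → (f ℤ.* g ℤ.+ 0ℤ) ℤ.* h ℤ.+ 0ℤ ≡ f ℤ.* (g ℤ.* h ℤ.+ 0ℤ) ℤ.+ 0ℤ
    ring = solve-∀
  *-assoc f g h (suc d) = begin
    -- The tail of `f * g` unfolds by computation to a multiple of `tail g` plus `tail f * g`.
    (f * g) 0 ℤ.* h (suc d) ℤ.+ ((scale (f 0) (tail g) + tail f * g) * h) d
      ≡⟨ cong₂ (λ s t → s ℤ.* h (suc d) ℤ.+ t) (*-head f g)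
           (trans (*-distribʳ-+ h (scale (f 0) (tail g)) (tail f * g) d)
                  (cong₂ ℤ._+_ (scale-* (f 0) (tail g) h d) (*-assoc (tail f) g h d))) ⟩
    f 0 ℤ.* g 0 ℤ.* h (suc d) ℤ.+ (f 0 ℤ.* (tail g * h) d ℤ.+ (tail f * (g * h)) d)
      ≡⟨ ring (f 0) (g 0) (h (suc d)) ((tail g * h) d) ((tail f * (g * h)) d) ⟩
    f 0 ℤ.* (g 0 ℤ.* h (suc d) ℤ.+ (tail g * h) d) ℤ.+ (tail f * (g * h)) d ∎
    where
    open ≡-Reasoning
    ring : ∀ f g h u v → f ℤ.* g ℤ.* h ℤ.+ (f ℤ.* u ℤ.+ v) ≡ f ℤ.* (g ℤ.* h ℤ.+ u) ℤ.+ v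
    ring = solve-∀

  0*f : ∀ f → 0# * f ≈ 0#
  0*f f zero    = refl
  0*f f (suc d) = trans (ℤ.+-identityˡ _) (0*f f d)

  const-* : ∀ c f d → (const c * f) d ≡ c ℤ.* f d
  const-* c f zero    = ℤ.+-identityʳ _
  const-* c f (suc d) = trans (cong (ℤ._+_ (c ℤ.* f (suc d))) (0*f f d)) (ℤ.+-identityʳ _)

  1*f : ∀ f → 1# * f ≈ f
  1*f f d = trans (*-cong {1#} {const 1ℤ} {f} {f} (λ { zero → refl ; (suc _) → refl }) (λ _ → refl) d)
                  (trans (const-* 1ℤ f d) (ℤ.*-identityˡ (f d)))

z*-tail : ∀ f d → (z * f) (suc d) ≡ f d
z*-tail f d = trans (ℤ.+-identityˡ _) (trans
  (*-cong {tail z} {1#} {f} {f} (λ { zero → refl ; (suc _) → refl }) (λ _ → refl) d) (1*f f d))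

seriesRing : CommutativeRing 0ℓ 0ℓ
seriesRing = record
  { isCommutativeRing = record
    { isRing = record
      { +-isAbelianGroup = record
        { isGroup = record
          { isMonoid = record
            { isSemigroup = record
              { isMagma = record
                { isEquivalence = record
                  { refl = λ _ → refl ; sym = λ eq d → sym (eq d) ; trans = λ p q d → trans (p d) (q d) }
                ; ∙-cong = λ p q d → cong₂ ℤ._+_ (p d) (q d)
                }
              ; assoc = λ f g h d → ℤ.+-assoc (f d) (g d) (h d)
              }
            ; identity = (λ f d → ℤ.+-identityˡ (f d)) , λ f d → ℤ.+-identityʳ (f d)
            }
          ; inverse = (λ f d → ℤ.+-inverseˡ (f d)) , λ f d → ℤ.+-inverseʳ (f d)
          ; ⁻¹-cong = λ p d → cong ℤ.-_ (p d)
          }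
        ; comm = λ f g d → ℤ.+-comm (f d) (g d)
        }
      ; *-cong     = λ {f} {f′} {g} {g′} → *-cong {f} {f′} {g} {g′}
      ; *-assoc    = *-assoc
      ; *-identity = 1*f , λ f d → trans (*-comm f 1# d) (1*f f d)
      ; distrib    = (λ f g h d → trans (*-comm f (g + h) d) (trans (*-distribʳ-+ f g h d)
                        (cong₂ ℤ._+_ (*-comm g f d) (*-comm h f d))))
                     , *-distribʳ-+
      }
    ; *-comm = *-comm
    }
  }

module 𝕊 = CommutativeRing seriesRing
module H𝕊 = Homogeneous seriesRing
module L𝕊 = ListSum seriesRing
open import Algebra.Properties.Semiring.Exp 𝕊.semiring using (^-homo-*)
open import Algebra.Properties.CommutativeMonoid.Sum 𝕊.*-commutativeMonoid using ()
  renaming (sum-init-last to product-init-last; sum-cong-≗ to product-cong-≗)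

-- Linear factors and the h-polynomial

private
  ι : ℕ → Series
  ι k = const (+ k)

linearFactor : ℕ → Series
linearFactor j = 1# + ι (suc j) * z

∏linear : ℕ → Series
∏linear s = product {s} (linearFactor ∘ toℕ)

-- `product` unfolds at its first factor, whereas the recursion of `elementary` adjoins the largest
-- number, which sits in the last one.
∏linear-suc : ∀ s → ∏linear (suc s) ≈ ∏linear s * linearFactor s
∏linear-suc s = begin
  product {suc s} (linearFactor ∘ toℕ) ≈⟨ product-init-last (linearFactor ∘ toℕ {suc s}) ⟩
  product {s} (λ i → linearFactor (toℕ (inject₁ i))) * linearFactor (toℕ (fromℕ s))
    ≡⟨ cong₂ _*_ (product-cong-≗ {s} (λ i → cong linearFactor (Fin.toℕ-inject₁ i)))
                 (cong linearFactor (Fin.toℕ-fromℕ s)) ⟩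
  ∏linear s * linearFactor s ∎
  where open import Relation.Binary.Reasoning.Setoid 𝕊.setoid

∏linear-coefficient : ∀ s i → ∏linear s i ≡ + elementary s i
∏linear-coefficient zero zero    = refl
∏linear-coefficient zero (suc i) = refl
∏linear-coefficient (suc s) i = trans (∏linear-suc s i) (trans (expand i) (step i))
  where
  open ≡-Reasoning
  p = ∏linear s
  c = + suc s
  expand : p * linearFactor s ≈ p + ι (suc s) * (z * p)
  expand i = begin
    (p * (1# + ι (suc s) * z)) i            ≡⟨ 𝕊.distribˡ p 1# (ι (suc s) * z) i ⟩
    (p * 1#) i ℤ.+ (p * (ι (suc s) * z)) i
      ≡⟨ cong₂ ℤ._+_ (𝕊.*-identityʳ p i) (trans (*-comm p (ι (suc s) * z) i) (*-assoc (ι (suc s)) z p i)) ⟩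
    p i ℤ.+ (ι (suc s) * (z * p)) i         ∎

  step : ∀ i → p i ℤ.+ (ι (suc s) * (z * p)) i ≡ + elementary (suc s) i
  step zero = begin
    p 0 ℤ.+ (ι (suc s) * (z * p)) 0 ≡⟨ cong₂ ℤ._+_ (∏linear-coefficient s 0) (const-* c (z * p) 0) ⟩
    1ℤ ℤ.+ c ℤ.* 0ℤ                 ≡⟨ cong (ℤ._+_ 1ℤ) (ℤ.*-zeroʳ c) ⟩
    1ℤ                              ∎
  step (suc i) = begin
    p (suc i) ℤ.+ (ι (suc s) * (z * p)) (suc i)
      ≡⟨ cong (ℤ._+_ (p (suc i))) (trans (const-* c (z * p) (suc i)) (cong (c ℤ.*_) (z*-tail p i))) ⟩
    p (suc i) ℤ.+ c ℤ.* p i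
      ≡⟨ cong₂ (λ u v → u ℤ.+ c ℤ.* v) (∏linear-coefficient s (suc i)) (∏linear-coefficient s i) ⟩
    + elementary s (suc i) ℤ.+ c ℤ.* + elementary s i
      ≡⟨ cong (ℤ._+_ (+ elementary s (suc i))) (ℤ.pos-* (suc s) (elementary s i)) ⟨
    + elementary (suc s) (suc i) ∎

1-z : Series
1-z = 1# - z

module _ where
  private
    H : ℕ → Series
    H s = H𝕊.homogeneous z 1-z (ι ∘ elementary s) s

    H-suc : ∀ s → H (suc s) ≈ (1-z + ι (suc s) * z) * H s
    H-suc = H𝕊.homogeneous-elementary z 1-z ι (λ { zero → refl ; (suc _) → refl })
      (λ { m n zero → ℤ.pos-+ m n ; m n (suc _) → refl })
      (λ { m n d → trans (ι-* m n d) (sym (const-* (+ m) (ι n) d)) })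
      where
      ι-* : ∀ m n d → ι (m ℕ.* n) d ≡ + m ℤ.* ι n d
      ι-* m n zero    = ℤ.pos-* m n
      ι-* m n (suc _) = sym (ℤ.*-zeroʳ (+ m))

    -- The shift by one that removes the first factor and lets the product end at n - 2.
    factor : ∀ s → 1-z + ι (suc s) * z ≈ 1# + ι s * z
    factor s d = begin
      1# d ℤ.+ ℤ.- z d ℤ.+ (ι (suc s) * z) d   ≡⟨ cong (ℤ._+_ (1# d ℤ.+ ℤ.- z d)) (const-* (+ suc s) z d) ⟩
      1# d ℤ.+ ℤ.- z d ℤ.+ (1ℤ ℤ.+ + s) ℤ.* z d ≡⟨ ring (1# d) (z d) (+ s) ⟩
      1# d ℤ.+ + s ℤ.* z d                     ≡⟨ cong (ℤ._+_ (1# d)) (const-* (+ s) z d) ⟨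
      1# d ℤ.+ (ι s * z) d                     ∎
      where
      open ≡-Reasoning
      ring : ∀ o z s → o ℤ.+ ℤ.- z ℤ.+ (1ℤ ℤ.+ s) ℤ.* z ≡ o ℤ.+ s ℤ.* z
      ring = solve-∀

  homogeneous-elementary≈∏linear : ∀ s → H (suc s) ≈ ∏linear s
  homogeneous-elementary≈∏linear zero = begin
    H 1                        ≈⟨ H-suc 0 ⟩
    (1-z + ι 1 * z) * H 0        ≈⟨ 𝕊.*-congʳ {H 0} (factor 0) ⟩
    (1# + ι 0 * z) * H 0       ≈⟨ 𝕊.*-congʳ {H 0} (𝕊.trans (𝕊.+-congˡ {1#} (const-* 0ℤ z)) (𝕊.+-identityʳ 1#)) ⟩
    1# * H 0                   ≈⟨ 𝕊.*-identityˡ (H 0) ⟩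
    H 0                        ≈⟨ (λ { zero → refl ; (suc _) → refl }) ⟩
    1#                         ∎
    where open import Relation.Binary.Reasoning.Setoid 𝕊.setoid
  homogeneous-elementary≈∏linear (suc s) = begin
    H (2 ℕ.+ s)                          ≈⟨ H-suc (suc s) ⟩
    (1-z + ι (2 ℕ.+ s) * z) * H (suc s)    ≈⟨ 𝕊.*-cong (factor (suc s)) (homogeneous-elementary≈∏linear s) ⟩
    linearFactor s * ∏linear s           ≈⟨ *-comm (linearFactor s) (∏linear s) ⟩
    ∏linear s * linearFactor s           ≈⟨ ∏linear-suc s ⟨
    ∏linear (suc s)                      ∎
    where open import Relation.Binary.Reasoning.Setoid 𝕊.setoid

  module _ (s : ℕ) {_≤_ : Rel (Edge (K (2 ℕ.+ s))) ℓ} (isTotal : IsTotalOrder _≡_ _≤_) where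

    homogeneous-faceCount : H𝕊.homogeneous z 1-z (ι ∘ faceCount (K (2 ℕ.+ s)) isTotal) (suc s) ≈ ∏linear s
    homogeneous-faceCount = 𝕊.trans
      (H𝕊.homogeneous-cong z 1-z {ι ∘ faceCount (K (2 ℕ.+ s)) isTotal} {ι ∘ elementary (suc s)} (suc s)
        (λ i i≤ → 𝕊.reflexive (cong ι (faceCount-K isTotal i i≤))))
      (homogeneous-elementary≈∏linear s)

    hPolynomial≈∏linear : hPolynomial (K (2 ℕ.+ s)) isTotal ≈ ∏linear s
    hPolynomial≈∏linear = 𝕊.trans
      (H𝕊.sum≈homogeneous z 1-z (ι ∘ faceCount (K (2 ℕ.+ s)) isTotal) (suc s))
      homogeneous-faceCount

-- The Hilbert series as a sum over faces

monomialSeries : Subset m → Series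
monomialSeries F d = + length (monomialsOn F d)

monomialSeries-false : (F : Subset m) → monomialSeries (false ∷ F) ≈ monomialSeries F
monomialSeries-false F d = cong +_ (List.length-map (0 ∷_) (monomialsOn F d))

-- Removing one copy of the first variable leaves a monomial with or without it. Solving this for
-- the series of `true ∷ F` yields the factor z / (1 - z).
monomialSeries-unfold : (F : Subset m) → monomialSeries (true ∷ F) ≈ z * (monomialSeries F + monomialSeries (true ∷ F))
monomialSeries-unfold F zero    = refl
monomialSeries-unfold F (suc d) = begin
  + length (List.map (1 ∷_) (monomialsOn F d) List.++ List.map raise (monomialsOn (true ∷ F) d))
    ≡⟨ cong +_ (List.length-++ (List.map (1 ∷_) (monomialsOn F d))) ⟩
  + (length (List.map (1 ∷_) (monomialsOn F d)) ℕ.+ length (List.map raise (monomialsOn (true ∷ F) d)))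
    ≡⟨ cong +_ (cong₂ ℕ._+_ (List.length-map (1 ∷_) (monomialsOn F d)) (List.length-map raise (monomialsOn (true ∷ F) d))) ⟩
  + (length (monomialsOn F d) ℕ.+ length (monomialsOn (true ∷ F) d))
    ≡⟨ ℤ.pos-+ (length (monomialsOn F d)) (length (monomialsOn (true ∷ F) d)) ⟩
  (monomialSeries F + monomialSeries (true ∷ F)) d
    ≡⟨ z*-tail (monomialSeries F + monomialSeries (true ∷ F)) d ⟨
  (z * (monomialSeries F + monomialSeries (true ∷ F))) (suc d) ∎
  where open ≡-Reasoning

module _ where
  open import Algebra.Properties.Ring 𝕊.ring using (-‿distribʳ-*)
  open import Relation.Binary.Reasoning.Setoid 𝕊.setoid

  monomialSeries-true : (F : Subset m) → monomialSeries (true ∷ F) * 1-z ≈ z * monomialSeries F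
  monomialSeries-true F = begin
    T * (1# + (- z))          ≈⟨ 𝕊.distribˡ T 1# (- z) ⟩
    T * 1# + T * (- z)        ≈⟨ 𝕊.+-cong (𝕊.*-identityʳ T) (𝕊.trans (𝕊.sym (-‿distribʳ-* T z)) (𝕊.-‿cong (𝕊.*-comm T z))) ⟩
    T + (- (z * T))           ≈⟨ 𝕊.+-congʳ { - (z * T)} (𝕊.trans (monomialSeries-unfold F) (𝕊.distribˡ z S T)) ⟩
    z * S + z * T + (- (z * T)) ≈⟨ 𝕊.+-assoc (z * S) (z * T) (- (z * T)) ⟩
    z * S + (z * T + (- (z * T))) ≈⟨ 𝕊.+-congˡ {z * S} (𝕊.-‿inverseʳ (z * T)) ⟩
    z * S + 0#                ≈⟨ 𝕊.+-identityʳ (z * S) ⟩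
    z * S                     ∎
    where
    S = monomialSeries F
    T = monomialSeries (true ∷ F)

  monomialSeries-* : (F : Subset m) → monomialSeries F * 1-z ^ ∣ F ∣ ≈ z ^ ∣ F ∣
  monomialSeries-* [] = begin
    monomialSeries [] * 1#    ≈⟨ 𝕊.*-identityʳ (monomialSeries []) ⟩
    monomialSeries []         ≈⟨ (λ { zero → refl ; (suc _) → refl }) ⟩
    1#                        ∎
  monomialSeries-* (false ∷ F) = 𝕊.trans (𝕊.*-congʳ {1-z ^ ∣ F ∣} (monomialSeries-false F)) (monomialSeries-* F)
  monomialSeries-* (true ∷ F) = begin
    T * (1-z * 1-z ^ ∣ F ∣)       ≈⟨ 𝕊.*-assoc T 1-z (1-z ^ ∣ F ∣) ⟨
    T * 1-z * 1-z ^ ∣ F ∣         ≈⟨ 𝕊.*-congʳ {1-z ^ ∣ F ∣} (monomialSeries-true F) ⟩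
    z * S * 1-z ^ ∣ F ∣         ≈⟨ 𝕊.*-assoc z S (1-z ^ ∣ F ∣) ⟩
    z * (S * 1-z ^ ∣ F ∣)       ≈⟨ 𝕊.*-congˡ {z} (monomialSeries-* F) ⟩
    z * z ^ ∣ F ∣             ∎
    where
    S = monomialSeries F
    T = monomialSeries (true ∷ F)

  -- The common denominator (1 - z)^r for all faces turns each series into a monomial of degree `r`
  -- in z and 1 - z.
  monomialSeries-*-^ : (F : Subset m) (r : ℕ) → ∣ F ∣ ≤ r →
    monomialSeries F * 1-z ^ r ≈ z ^ ∣ F ∣ * 1-z ^ (r ∸ ∣ F ∣)
  monomialSeries-*-^ F r ∣F∣≤r = begin
    S * 1-z ^ r                               ≡⟨ cong (λ t → S * 1-z ^ t) (ℕ.m+[n∸m]≡n ∣F∣≤r) ⟨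
    S * 1-z ^ (∣ F ∣ ℕ.+ (r ∸ ∣ F ∣))         ≈⟨ 𝕊.*-congˡ {S} (^-homo-* 1-z ∣ F ∣ (r ∸ ∣ F ∣)) ⟩
    S * (1-z ^ ∣ F ∣ * 1-z ^ (r ∸ ∣ F ∣))       ≈⟨ 𝕊.*-assoc S (1-z ^ ∣ F ∣) (1-z ^ (r ∸ ∣ F ∣)) ⟨
    S * 1-z ^ ∣ F ∣ * 1-z ^ (r ∸ ∣ F ∣)         ≈⟨ 𝕊.*-congʳ {1-z ^ (r ∸ ∣ F ∣)} (monomialSeries-* F) ⟩
    z ^ ∣ F ∣ * 1-z ^ (r ∸ ∣ F ∣)             ∎
    where S = monomialSeries F

length-concatMap : (g : ℕ → A → List B) (xs : List A) (d : ℕ) →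
  + length (concatMap (g d) xs) ≡ L𝕊.∑ xs (λ x d → + length (g d x)) d
length-concatMap g []       d = refl
length-concatMap g (x ∷ xs) d = trans (cong +_ (List.length-++ (g d x)))
  (trans (ℤ.pos-+ (length (g d x)) _) (cong (ℤ._+_ (+ length (g d x))) (length-concatMap g xs d)))

-- `homogeneous-count` over the series ring yields indicators that are series, while face counts are
-- integers; the constant embedding links the two.
∑-ind-const : {P : A → Set ρ} (P? : ∀ x → Dec (P x)) (xs : List A) →
  L𝕊.∑ xs (λ x → L𝕊.ind (P? x)) ≈ const (∑ xs (λ x → ind (P? x)))
∑-ind-const P? [] zero    = refl
∑-ind-const P? [] (suc d) = refl
∑-ind-const P? (x ∷ xs) d with P? x | ∑-ind-const P? xs d
∑-ind-const P? (x ∷ xs) zero    | yes _ | ih = cong (ℤ._+_ 1ℤ) ih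
∑-ind-const P? (x ∷ xs) (suc d) | yes _ | ih = cong (ℤ._+_ 0ℤ) ih
∑-ind-const P? (x ∷ xs) zero    | no _  | ih = cong (ℤ._+_ 0ℤ) ih
∑-ind-const P? (x ∷ xs) (suc d) | no _  | ih = cong (ℤ._+_ 0ℤ) ih

module _ (s : ℕ) {_≤ₑ_ : Rel (Edge (K (2 ℕ.+ s))) ℓ} (isTotal : IsTotalOrder _≡_ _≤ₑ_) where

  private
    G = K (2 ℕ.+ s)
    Fs = faces G isTotal

  hilbertSeries : Series
  hilbertSeries d = + length (standardMonomials G isTotal d)

  size≤ : {F : Subset (∣E∣ G)} → F ∈ Fs → ∣ F ∣ ≤ suc s
  size≤ {F} F∈ = face-size {r = suc s} isTotal {F} (∈-faces⁻ {r = suc s} isTotal {F} F∈)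

  -- After clearing denominators the sum over faces is the homogeneous form of the face numbers at z
  -- and 1 - z, which is the h-polynomial.
  hilbertSeries-* : hilbertSeries * 1-z ^ suc s ≈ ∏linear s
  hilbertSeries-* = begin
    hilbertSeries * 1-z ^ suc s
      ≈⟨ 𝕊.*-congʳ {1-z ^ suc s} {hilbertSeries} {L𝕊.∑ Fs monomialSeries} (length-concatMap (λ d F → monomialsOn F d) Fs) ⟩
    L𝕊.∑ Fs monomialSeries * 1-z ^ suc s
      ≈⟨ L𝕊.∑-*ʳ Fs (1-z ^ suc s) monomialSeries ⟨
    L𝕊.∑ Fs (λ F → monomialSeries F * 1-z ^ suc s)
      ≈⟨ L𝕊.∑-cong Fs {λ F → monomialSeries F * 1-z ^ suc s} {term}
           (λ {F} F∈ → monomialSeries-*-^ F (suc s) (size≤ F∈)) ⟩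
    L𝕊.∑ Fs term
      ≈⟨ H𝕊.homogeneous-count z 1-z Fs ∣_∣ (suc s) size≤ ⟨
    H𝕊.homogeneous z 1-z sizes (suc s)
      ≈⟨ H𝕊.homogeneous-cong z 1-z {sizes} {counts} (suc s) (λ i _ → sizes≈counts i) ⟩
    H𝕊.homogeneous z 1-z counts (suc s)
      ≈⟨ homogeneous-faceCount s isTotal ⟩
    ∏linear s ∎
    where
    open import Relation.Binary.Reasoning.Setoid 𝕊.setoid
    term : Subset (∣E∣ G) → Series
    term F = z ^ ∣ F ∣ * 1-z ^ (suc s ∸ ∣ F ∣)

    sizes counts : ℕ → Series
    sizes i  = L𝕊.∑ Fs (λ F → L𝕊.ind (∣ F ∣ ℕ.≟ i))
    counts i = const (+ faceCount G isTotal i)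

    sizes≈counts : ∀ i → sizes i ≈ counts i
    sizes≈counts i = 𝕊.trans {sizes i} {const (∑ Fs (λ F → ind (∣ F ∣ ℕ.≟ i)))} {counts i}
      (∑-ind-const (λ F → ∣ F ∣ ℕ.≟ i) Fs)
      (𝕊.reflexive (cong const (sym (faceCount≡∑ G isTotal i))))

theorem6p3 : {c ℓ₁ ℓ₂ ℓ : Level} (n : ℕ) → 2 ≤ n →
    {_≤ₑ_ : Rel (Edge (K n)) ℓ} (isTotal : IsTotalOrder _≡_ _≤ₑ_)
    (𝕜 : HeytingField c ℓ₁ ℓ₂) →
    let h = hPolynomial (K n) isTotal
        ∏[1+jz] = product {n ∸ 2} (λ i → 1# + const (+ suc (toℕ i)) * z)
    in  (h ≈ ∏[1+jz])
      × (∃ λ (Hilb : Series) → IsHilbertSeries 𝕜 (𝕜[BC]-part 𝕜 (K n) isTotal) Hilb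
                             × Hilb * (1# - z) ^ (n ∸ 1) ≈ ∏[1+jz])
      × (∀ i → i ≤ n ∸ 2 → h i ≡ + stirling₁ (n ∸ 1) ((n ∸ 1) ∸ i))
theorem6p3 (suc (suc s)) (s≤s (s≤s _)) isTotal 𝕜 =
  h≈∏ ,
  (hilbertSeries s isTotal ,
    (λ d → length (standardMonomials (K (2 ℕ.+ s)) isTotal d) , dimension 𝕜 (K (2 ℕ.+ s)) isTotal d , refl) ,
    hilbertSeries-* s isTotal) ,
  -- For i ≤ s the lower index (s + 1) - i is the successor of s - i, so the Stirling identity
  -- applies with k = s - i.
  λ i i≤s → trans (h≈∏ i) (trans (∏linear-coefficient s i) (cong +_ (sym (trans
    (cong (stirling₁ (suc s)) (ℕ.+-∸-assoc 1 i≤s))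
    (stirling₁≡elementary s (s ∸ i) i (ℕ.m∸n+n≡m i≤s))))))
  where
  h≈∏ = hPolynomial≈∏linear s isTotal
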